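{- Let $n,k\ge0$ be integers. The irreducible representations of the algebra $(\mathcal{D}_n^{(k)},*)$ are of dimension $1$, and (up to isomorphism) they are parametrized by the partitions of $n$ with at most $k$ parts equal to $1$.
   Context: $\mathbf{Sym}=\bigoplus_{n\ge0}\mathbf{Sym}_n$ (noncommutative symmetric functions, over $\mathbb{C}$) is the free associative unital algebra on generators $S_1,S_2,\dots$ with $\deg S_n=n$, $S_0=1$. For a composition $I=(i_1,\dots,i_r)$ of $n$, $S^I=S_{i_1}\cdots S_{i_r}$; these form a basis of $\mathbf{Sym}_n$. The internal product $*$ is the bilinear associative product on $\mathbf{Sym}$ with $F*G=0$ if $F,G$ are homogeneous of different degrees, and, for compositions $I,J$ of $n$, $S^I*S^J=\sum_M S^M$, sum over all nonnegative integer matrices $M$ with row sums $I$ and column sums $J$, where $S^M$ is the product of the $S_{m_{ij}}$ read row by row (left to right, top to bottom). Set $S_n^\sharp=\sum_{i=0}^n(-1)^i\frac{S_1^i}{i!}S_{n-i}$, $\mathcal{D}_n^{(0)}=\{F*S_n^\sharp : F\in\mathbf{Sym}_n\}$ and $\mathcal{D}_n^{(k)}=\bigoplus_{j=0}^{\min(k,n)}S_j\,\mathcal{D}^{(0)}_{n-j}$ (ordinary products). $(\mathcal{D}_n^{(k)},*)$ is a finite-dimensional unital algebra, with unit $\sum_{i=0}^{\min(k,n)}\frac{S_1^i}{i!}S_{n-i}^\sharp$; representations are unital. -}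

module Defs where

open import Algebra.Bundles using (CommutativeRing)
open import Algebra.Module.Bundles using (LeftModule)
open import Algebra.Module.Morphism.Structures using (module LeftModuleMorphisms)
import Algebra.Module.Morphism.Construct.Composition as Composition
import Algebra.Module.Morphism.Construct.Identity as Identity
import Algebra.Properties.Monoid.Sum as MonoidSum
open import Data.Bool.Base using (if_then_else_)
open import Data.Fin.Base using (Fin)
import Data.Integer.Base as ℤ
open import Data.List.Base
  using (List; []; _∷_; _++_; map; concat; cartesianProductWith; foldr; filter; length; replicate; upTo; zipWith)
import Data.List.Properties as List
open import Data.List.Relation.Unary.All using (All)
open import Data.List.Relation.Unary.Linked using (Linked)
open import Data.Nat.Base as ℕ using (ℕ; zero; suc; _∸_; _⊓_; _⊔_; _!)
import Data.Nat.Properties as ℕ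
open import Data.Nat.ListAction using (sum)
open import Data.Product.Base using (Σ; ∃; _×_; _,_; proj₁; proj₂)
open import Data.Rational.Base as ℚ using (ℚ; 0ℚ; 1ℚ; ½; ∣_∣)
import Data.Rational.Properties as ℚ
open import Data.Rational.Solver using (module +-*-Solver)
open import Data.Sum.Base using (_⊎_)
open import Function.Base using (_∘_; id)
open import Level using (Level; 0ℓ) renaming (_⊔_ to _⊔ˡ_; suc to lsuc)
open import Relation.Binary.Bundles using (Setoid)
open import Relation.Binary.Definitions using (DecidableEquality)
import Relation.Binary.Construct.On as On
open import Relation.Binary.PropositionalEquality
  using (_≡_; _≢_; refl; sym; trans; cong; subst; setoid)
open import Relation.Nullary using (¬_; does)
open import Relation.Nullary.Decidable using (_×-dec_)
open import Relation.Unary using (Pred)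

open +-*-Solver using (solve; _:=_; _:+_; _:*_; _:-_; :-_; con)

private
  half+half : ∀ ε → ½ ℚ.* ε ℚ.+ ½ ℚ.* ε ≡ ε
  half+half = solve 1 (λ ε → con ½ :* ε :+ con ½ :* ε := ε) refl

  swap-factor : ∀ b e r → b ℚ.* (e ℚ.* r) ≡ e ℚ.* (b ℚ.* r)
  swap-factor = solve 3 (λ b e r → b :* (e :* r) := e :* (b :* r)) refl

  diff-add : ∀ a b → (a ℚ.- b) ℚ.+ b ≡ a
  diff-add = solve 2 (λ a b → (a :- b) :+ b := a) refl

  diff-swap : ∀ a b → ℚ.- (a ℚ.- b) ≡ b ℚ.- a
  diff-swap = solve 2 (λ a b → :- (a :- b) := b :- a) refl

  diff-trans : ∀ a b c → (a ℚ.- b) ℚ.+ (b ℚ.- c) ≡ a ℚ.- c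
  diff-trans = solve 3 (λ a b c → (a :- b) :+ (b :- c) := a :- c) refl

  diff-+ : ∀ a b c d → (a ℚ.- b) ℚ.+ (c ℚ.- d) ≡ (a ℚ.+ c) ℚ.- (b ℚ.+ d)
  diff-+ = solve 4 (λ a b c d → (a :- b) :+ (c :- d) := (a :+ c) :- (b :+ d)) refl

  diff-neg : ∀ a b → ℚ.- (a ℚ.- b) ≡ ℚ.- a ℚ.- ℚ.- b
  diff-neg = solve 2 (λ a b → :- (a :- b) := :- a :- :- b) refl

  diff-* : ∀ a b c d → a ℚ.* (c ℚ.- d) ℚ.+ d ℚ.* (a ℚ.- b) ≡ a ℚ.* c ℚ.- b ℚ.* d
  diff-* = solve 4 (λ a b c d → a :* (c :- d) :+ d :* (a :- b) := a :* c :- b :* d) refl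

  half-pos : ∀ {ε} → 0ℚ ℚ.< ε → 0ℚ ℚ.< ½ ℚ.* ε
  half-pos {ε} 0<ε = subst (ℚ._< ½ ℚ.* ε) (ℚ.*-zeroʳ ½) (ℚ.*-monoʳ-<-pos ½ 0<ε)

  divide : ∀ B ε → 0ℚ ℚ.< B → 0ℚ ℚ.< ε → ∃ λ δ → 0ℚ ℚ.< δ × B ℚ.* δ ≡ ε
  divide B ε 0<B 0<ε =
      ε ℚ.* 1/B
    , subst (ℚ._< ε ℚ.* 1/B) (ℚ.*-zeroˡ 1/B) (ℚ.*-monoˡ-<-pos 1/B {{ℚ.1/pos⇒pos B}} 0<ε)
    , trans (swap-factor B ε 1/B) (trans (cong (ε ℚ.*_) (ℚ.*-inverseʳ B)) (ℚ.*-identityʳ ε))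
    where
    instance
      B-positive : ℚ.Positive B
      B-positive = ℚ.positive 0<B
      B-nonZero : ℚ.NonZero B
      B-nonZero = ℚ.pos⇒nonZero B
    1/B : ℚ
    1/B = ℚ.1/ B

  product-< : ∀ p q {B δ} → 0ℚ ℚ.< δ → ∣ p ∣ ℚ.< B → ∣ q ∣ ℚ.< δ → ∣ p ℚ.* q ∣ ℚ.< B ℚ.* δ
  product-< p q {B} {δ} 0<δ p<B q<δ = subst (ℚ._< B ℚ.* δ) (sym (ℚ.∣p*q∣≡∣p∣*∣q∣ p q))
    (ℚ.≤-<-trans (ℚ.*-monoˡ-≤-nonNeg ∣ p ∣ {{ℚ.∣-∣-nonNeg p}} (ℚ.<⇒≤ q<δ))
                 (ℚ.*-monoˡ-<-pos δ {{ℚ.positive 0<δ}} p<B))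

-- The field ℝ is the completion of ℚ by Cauchy sequences, and ℂ = ℝ + iℝ.

-- A family of rationals indexed by I converges to 0 along d → ∞.
Vanishes : {I : Set} → (I → ℕ) → (I → ℚ) → Set
Vanishes d f = ∀ ε → 0ℚ ℚ.< ε → ∃ λ N → ∀ i → N ℕ.≤ d i → ∣ f i ∣ ℚ.< ε

IsNull : (ℕ → ℚ) → Set
IsNull = Vanishes id

IsCauchy : (ℕ → ℚ) → Set
IsCauchy s = Vanishes {ℕ × ℕ} (λ (m , n) → m ⊓ n) (λ (m , n) → s m ℚ.- s n)

record ℝ : Set where
  no-eta-equality
  field
    seq    : ℕ → ℚ
    cauchy : IsCauchy seq

open ℝ public

infix 4 _≈ᴿ_

record _≈ᴿ_ (x y : ℝ) : Set where
  constructor mk≈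
  field null : IsNull (λ n → seq x n ℚ.- seq y n)

open _≈ᴿ_ public

module _ {I : Set} {d : I → ℕ} where

  EventuallyBounded : (I → ℚ) → Set
  EventuallyBounded f = ∃ λ B → 0ℚ ℚ.< B × ∃ λ N → ∀ i → N ℕ.≤ d i → ∣ f i ∣ ℚ.< B

  -- Abstract only to keep type checking fast.
  abstract
    vanishes-cong : {f g : I → ℚ} → (∀ i → f i ≡ g i) → Vanishes d f → Vanishes d g
    vanishes-cong f≗g f→0 ε 0<ε = let N , small = f→0 ε 0<ε in
      N , λ i N≤i → subst (λ q → ∣ q ∣ ℚ.< ε) (f≗g i) (small i N≤i)

    vanishes-0 : Vanishes d (λ _ → 0ℚ)
    vanishes-0 ε 0<ε = 0 , λ _ _ → 0<ε

    vanishes-neg : {f : I → ℚ} → Vanishes d f → Vanishes d (λ i → ℚ.- f i)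
    vanishes-neg {f} f→0 ε 0<ε = let N , small = f→0 ε 0<ε in
      N , λ i N≤i → subst (ℚ._< ε) (sym (ℚ.∣-p∣≡∣p∣ (f i))) (small i N≤i)

    vanishes-+ : {f g : I → ℚ} → Vanishes d f → Vanishes d g → Vanishes d (λ i → f i ℚ.+ g i)
    vanishes-+ {f} {g} f→0 g→0 ε 0<ε =
      let M , f-small = f→0 (½ ℚ.* ε) (half-pos 0<ε)
          N , g-small = g→0 (½ ℚ.* ε) (half-pos 0<ε)
      in M ⊔ N , λ i M⊔N≤i →
      ℚ.≤-<-trans (ℚ.∣p+q∣≤∣p∣+∣q∣ (f i) (g i))
        (subst (∣ f i ∣ ℚ.+ ∣ g i ∣ ℚ.<_) (half+half ε)
          (ℚ.+-mono-< (f-small i (ℕ.≤-trans (ℕ.m≤m⊔n M N) M⊔N≤i))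
                      (g-small i (ℕ.≤-trans (ℕ.m≤n⊔m M N) M⊔N≤i))))

    vanishes-* : {f g : I → ℚ} → EventuallyBounded f → Vanishes d g → Vanishes d (λ i → f i ℚ.* g i)
    vanishes-* {f} {g} (B , 0<B , M , f<B) g→0 ε 0<ε =
      let δ , 0<δ , Bδ≡ε = divide B ε 0<B 0<ε
          N , g<δ = g→0 δ 0<δ
      in M ⊔ N , λ i M⊔N≤i → subst (∣ f i ℚ.* g i ∣ ℚ.<_) Bδ≡ε
      (product-< (f i) (g i) 0<δ (f<B i (ℕ.≤-trans (ℕ.m≤m⊔n M N) M⊔N≤i))
                                 (g<δ i (ℕ.≤-trans (ℕ.m≤n⊔m M N) M⊔N≤i)))

abstract
  cauchy-bounded : ∀ x → EventuallyBounded {d = id} (seq x)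
  cauchy-bounded x = let N , small = cauchy x 1ℚ (ℚ.positive⁻¹ 1ℚ) in
      1ℚ ℚ.+ ∣ seq x N ∣
    , ℚ.+-mono-<-≤ (ℚ.positive⁻¹ 1ℚ) (ℚ.0≤∣p∣ (seq x N))
    , N
    , λ n N≤n → subst (λ q → ∣ q ∣ ℚ.< 1ℚ ℚ.+ ∣ seq x N ∣) (diff-add (seq x n) (seq x N))
        (ℚ.≤-<-trans (ℚ.∣p+q∣≤∣p∣+∣q∣ (seq x n ℚ.- seq x N) (seq x N))
          (ℚ.+-monoˡ-< ∣ seq x N ∣ (small (n , N) (ℕ.⊓-glb N≤n ℕ.≤-refl))))

≈ᴿ-pointwise : ∀ {x y} → (∀ n → seq x n ≡ seq y n) → x ≈ᴿ y
≈ᴿ-pointwise {x} {y} x≗y = mk≈ (vanishes-cong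
  (λ n → sym (trans (cong (ℚ._- seq y n) (x≗y n)) (ℚ.+-inverseʳ (seq y n)))) vanishes-0)

≈ᴿ-sym : ∀ {x y} → x ≈ᴿ y → y ≈ᴿ x
≈ᴿ-sym {x} {y} (mk≈ p) = mk≈ (vanishes-cong
  (λ n → diff-swap (seq x n) (seq y n)) (vanishes-neg p))

≈ᴿ-trans : ∀ {x y z} → x ≈ᴿ y → y ≈ᴿ z → x ≈ᴿ z
≈ᴿ-trans {x} {y} {z} (mk≈ p) (mk≈ q) = mk≈ (vanishes-cong
  (λ n → diff-trans (seq x n) (seq y n) (seq z n))
  (vanishes-+ p q))

fromℚ : ℚ → ℝ
fromℚ q .seq _ = q
fromℚ q .cauchy = vanishes-cong (λ _ → sym (ℚ.+-inverseʳ q)) vanishes-0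

infixl 6 _+ᴿ_ _-ᴿ_
infixl 7 _*ᴿ_
infix  8 -ᴿ_

_+ᴿ_ : ℝ → ℝ → ℝ
(x +ᴿ y) .seq n = seq x n ℚ.+ seq y n
(x +ᴿ y) .cauchy = vanishes-cong
  (λ (m , n) → diff-+ (seq x m) (seq x n) (seq y m) (seq y n))
  (vanishes-+ (cauchy x) (cauchy y))

-ᴿ_ : ℝ → ℝ
(-ᴿ x) .seq n = ℚ.- seq x n
(-ᴿ x) .cauchy = vanishes-cong
  (λ (m , n) → diff-neg (seq x m) (seq x n))
  (vanishes-neg (cauchy x))

_-ᴿ_ : ℝ → ℝ → ℝ
x -ᴿ y = x +ᴿ (-ᴿ y)

_*ᴿ_ : ℝ → ℝ → ℝ
(x *ᴿ y) .seq n = seq x n ℚ.* seq y n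
(x *ᴿ y) .cauchy = vanishes-cong
  (λ (m , n) → diff-* (seq x m) (seq x n) (seq y m) (seq y n))
  (vanishes-+ {f = λ (m , n) → seq x m ℚ.* (seq y m ℚ.- seq y n)}
              {g = λ (m , n) → seq y n ℚ.* (seq x m ℚ.- seq x n)}
    (vanishes-* {f = λ (m , n) → seq x m} {g = λ (m , n) → seq y m ℚ.- seq y n} (bounded₁ x) (cauchy y))
    (vanishes-* {f = λ (m , n) → seq y n} {g = λ (m , n) → seq x m ℚ.- seq x n} (bounded₂ y) (cauchy x)))
  where
  bounded₁ : ∀ z → EventuallyBounded {ℕ × ℕ} {λ (m , n) → m ⊓ n} (λ (m , n) → seq z m)
  bounded₁ z = let B , 0<B , N , z<B = cauchy-bounded z in
    B , 0<B , N , λ (m , n) N≤m⊓n → z<B m (ℕ.≤-trans N≤m⊓n (ℕ.m⊓n≤m m n))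
  bounded₂ : ∀ z → EventuallyBounded {ℕ × ℕ} {λ (m , n) → m ⊓ n} (λ (m , n) → seq z n)
  bounded₂ z = let B , 0<B , N , z<B = cauchy-bounded z in
    B , 0<B , N , λ (m , n) N≤m⊓n → z<B n (ℕ.≤-trans N≤m⊓n (ℕ.m⊓n≤n m n))

+ᴿ-cong : ∀ {x x′ y y′} → x ≈ᴿ x′ → y ≈ᴿ y′ → x +ᴿ y ≈ᴿ x′ +ᴿ y′
+ᴿ-cong {x} {x′} {y} {y′} (mk≈ p) (mk≈ q) = mk≈ (vanishes-cong
  (λ n → diff-+ (seq x n) (seq x′ n) (seq y n) (seq y′ n))
  (vanishes-+ p q))

-ᴿ-cong : ∀ {x x′} → x ≈ᴿ x′ → -ᴿ x ≈ᴿ -ᴿ x′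
-ᴿ-cong {x} {x′} (mk≈ p) = mk≈ (vanishes-cong
  (λ n → diff-neg (seq x n) (seq x′ n)) (vanishes-neg p))

*ᴿ-cong : ∀ {x x′ y y′} → x ≈ᴿ x′ → y ≈ᴿ y′ → x *ᴿ y ≈ᴿ x′ *ᴿ y′
*ᴿ-cong {x} {x′} {y} {y′} (mk≈ p) (mk≈ q) = mk≈ (vanishes-cong
  (λ n → diff-* (seq x n) (seq x′ n) (seq y n) (seq y′ n))
  (vanishes-+ {f = λ n → seq x n ℚ.* (seq y n ℚ.- seq y′ n)}
              {g = λ n → seq y′ n ℚ.* (seq x n ℚ.- seq x′ n)}
    (vanishes-* {d = id} {f = seq x} {g = λ n → seq y n ℚ.- seq y′ n} (cauchy-bounded x) q)
    (vanishes-* {d = id} {f = seq y′} {g = λ n → seq x n ℚ.- seq x′ n} (cauchy-bounded y′) p)))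

record ℂ : Set where
  no-eta-equality
  field re im : ℝ

open ℂ public

infix 4 _≈_

record _≈_ (z w : ℂ) : Set where
  constructor _,_
  field
    re≈ : re z ≈ᴿ re w
    im≈ : im z ≈ᴿ im w

infixl 6 _+_
infixl 7 _*_
infix  8 -_

_+_ : ℂ → ℂ → ℂ
(z + w) .re = re z +ᴿ re w
(z + w) .im = im z +ᴿ im w

-_ : ℂ → ℂ
(- z) .re = -ᴿ re z
(- z) .im = -ᴿ im z

_*_ : ℂ → ℂ → ℂ
(z * w) .re = re z *ᴿ re w -ᴿ im z *ᴿ im w
(z * w) .im = re z *ᴿ im w +ᴿ im z *ᴿ re w

rational : ℚ → ℂ
rational q .re = fromℚ q
rational q .im = fromℚ 0ℚ

0# 1# : ℂ
0# = rational 0ℚ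
1# = rational 1ℚ

≈-pointwise : ∀ {z w} → (∀ n → seq (re z) n ≡ seq (re w) n) → (∀ n → seq (im z) n ≡ seq (im w) n) → z ≈ w
≈-pointwise p q = ≈ᴿ-pointwise p , ≈ᴿ-pointwise q

private
  *-assoc-re : ∀ a b c d e f →
    (a ℚ.* c ℚ.- b ℚ.* d) ℚ.* e ℚ.- (a ℚ.* d ℚ.+ b ℚ.* c) ℚ.* f ≡ a ℚ.* (c ℚ.* e ℚ.- d ℚ.* f) ℚ.- b ℚ.* (c ℚ.* f ℚ.+ d ℚ.* e)
  *-assoc-re = solve 6
    (λ a b c d e f → (a :* c :- b :* d) :* e :- (a :* d :+ b :* c) :* f := a :* (c :* e :- d :* f) :- b :* (c :* f :+ d :* e)) refl

  *-assoc-im : ∀ a b c d e f →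
    (a ℚ.* c ℚ.- b ℚ.* d) ℚ.* f ℚ.+ (a ℚ.* d ℚ.+ b ℚ.* c) ℚ.* e ≡ a ℚ.* (c ℚ.* f ℚ.+ d ℚ.* e) ℚ.+ b ℚ.* (c ℚ.* e ℚ.- d ℚ.* f)
  *-assoc-im = solve 6
    (λ a b c d e f → (a :* c :- b :* d) :* f :+ (a :* d :+ b :* c) :* e := a :* (c :* f :+ d :* e) :+ b :* (c :* e :- d :* f)) refl

  *-identityˡ-re : ∀ a b →
    1ℚ ℚ.* a ℚ.- 0ℚ ℚ.* b ≡ a
  *-identityˡ-re = solve 2
    (λ a b → con 1ℚ :* a :- con 0ℚ :* b := a) refl

  *-identityˡ-im : ∀ a b →
    1ℚ ℚ.* b ℚ.+ 0ℚ ℚ.* a ≡ b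
  *-identityˡ-im = solve 2
    (λ a b → con 1ℚ :* b :+ con 0ℚ :* a := b) refl

  *-identityʳ-re : ∀ a b →
    a ℚ.* 1ℚ ℚ.- b ℚ.* 0ℚ ≡ a
  *-identityʳ-re = solve 2
    (λ a b → a :* con 1ℚ :- b :* con 0ℚ := a) refl

  *-identityʳ-im : ∀ a b →
    a ℚ.* 0ℚ ℚ.+ b ℚ.* 1ℚ ≡ b
  *-identityʳ-im = solve 2
    (λ a b → a :* con 0ℚ :+ b :* con 1ℚ := b) refl

  distribˡ-re : ∀ a b c d e f →
    a ℚ.* (c ℚ.+ e) ℚ.- b ℚ.* (d ℚ.+ f) ≡ (a ℚ.* c ℚ.- b ℚ.* d) ℚ.+ (a ℚ.* e ℚ.- b ℚ.* f)
  distribˡ-re = solve 6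
    (λ a b c d e f → a :* (c :+ e) :- b :* (d :+ f) := (a :* c :- b :* d) :+ (a :* e :- b :* f)) refl

  distribˡ-im : ∀ a b c d e f →
    a ℚ.* (d ℚ.+ f) ℚ.+ b ℚ.* (c ℚ.+ e) ≡ (a ℚ.* d ℚ.+ b ℚ.* c) ℚ.+ (a ℚ.* f ℚ.+ b ℚ.* e)
  distribˡ-im = solve 6
    (λ a b c d e f → a :* (d :+ f) :+ b :* (c :+ e) := (a :* d :+ b :* c) :+ (a :* f :+ b :* e)) refl

  distribʳ-re : ∀ a b c d e f →
    (c ℚ.+ e) ℚ.* a ℚ.- (d ℚ.+ f) ℚ.* b ≡ (c ℚ.* a ℚ.- d ℚ.* b) ℚ.+ (e ℚ.* a ℚ.- f ℚ.* b)
  distribʳ-re = solve 6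
    (λ a b c d e f → (c :+ e) :* a :- (d :+ f) :* b := (c :* a :- d :* b) :+ (e :* a :- f :* b)) refl

  distribʳ-im : ∀ a b c d e f →
    (c ℚ.+ e) ℚ.* b ℚ.+ (d ℚ.+ f) ℚ.* a ≡ (c ℚ.* b ℚ.+ d ℚ.* a) ℚ.+ (e ℚ.* b ℚ.+ f ℚ.* a)
  distribʳ-im = solve 6
    (λ a b c d e f → (c :+ e) :* b :+ (d :+ f) :* a := (c :* b :+ d :* a) :+ (e :* b :+ f :* a)) refl

  *-comm-re : ∀ a b c d →
    a ℚ.* c ℚ.- b ℚ.* d ≡ c ℚ.* a ℚ.- d ℚ.* b
  *-comm-re = solve 4
    (λ a b c d → a :* c :- b :* d := c :* a :- d :* b) refl

  *-comm-im : ∀ a b c d →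
    a ℚ.* d ℚ.+ b ℚ.* c ≡ c ℚ.* b ℚ.+ d ℚ.* a
  *-comm-im = solve 4
    (λ a b c d → a :* d :+ b :* c := c :* b :+ d :* a) refl

private
  +-assoc : ∀ x y z → (x + y) + z ≈ x + (y + z)
  +-assoc x y z = ≈-pointwise
    (λ n → ℚ.+-assoc (seq (re x) n) (seq (re y) n) (seq (re z) n))
    (λ n → ℚ.+-assoc (seq (im x) n) (seq (im y) n) (seq (im z) n))

  +-comm : ∀ x y → x + y ≈ y + x
  +-comm x y = ≈-pointwise
    (λ n → ℚ.+-comm (seq (re x) n) (seq (re y) n))
    (λ n → ℚ.+-comm (seq (im x) n) (seq (im y) n))

  +-identityˡ : ∀ x → 0# + x ≈ x
  +-identityˡ x = ≈-pointwise
    (λ n → ℚ.+-identityˡ (seq (re x) n)) (λ n → ℚ.+-identityˡ (seq (im x) n))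

  +-identityʳ : ∀ x → x + 0# ≈ x
  +-identityʳ x = ≈-pointwise
    (λ n → ℚ.+-identityʳ (seq (re x) n)) (λ n → ℚ.+-identityʳ (seq (im x) n))

  -‿inverseˡ : ∀ x → - x + x ≈ 0#
  -‿inverseˡ x = ≈-pointwise
    (λ n → ℚ.+-inverseˡ (seq (re x) n)) (λ n → ℚ.+-inverseˡ (seq (im x) n))

  -‿inverseʳ : ∀ x → x + - x ≈ 0#
  -‿inverseʳ x = ≈-pointwise
    (λ n → ℚ.+-inverseʳ (seq (re x) n)) (λ n → ℚ.+-inverseʳ (seq (im x) n))

  *-assoc : ∀ x y z → (x * y) * z ≈ x * (y * z)
  *-assoc x y z = ≈-pointwise
    (λ n → *-assoc-re (seq (re x) n) (seq (im x) n) (seq (re y) n) (seq (im y) n) (seq (re z) n) (seq (im z) n))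
    (λ n → *-assoc-im (seq (re x) n) (seq (im x) n) (seq (re y) n) (seq (im y) n) (seq (re z) n) (seq (im z) n))

  *-comm : ∀ x y → x * y ≈ y * x
  *-comm x y = ≈-pointwise
    (λ n → *-comm-re (seq (re x) n) (seq (im x) n) (seq (re y) n) (seq (im y) n))
    (λ n → *-comm-im (seq (re x) n) (seq (im x) n) (seq (re y) n) (seq (im y) n))

  *-identityˡ : ∀ x → 1# * x ≈ x
  *-identityˡ x = ≈-pointwise
    (λ n → *-identityˡ-re (seq (re x) n) (seq (im x) n))
    (λ n → *-identityˡ-im (seq (re x) n) (seq (im x) n))

  *-identityʳ : ∀ x → x * 1# ≈ x
  *-identityʳ x = ≈-pointwise
    (λ n → *-identityʳ-re (seq (re x) n) (seq (im x) n))
    (λ n → *-identityʳ-im (seq (re x) n) (seq (im x) n))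

  distribˡ : ∀ x y z → x * (y + z) ≈ x * y + x * z
  distribˡ x y z = ≈-pointwise
    (λ n → distribˡ-re (seq (re x) n) (seq (im x) n) (seq (re y) n) (seq (im y) n) (seq (re z) n) (seq (im z) n))
    (λ n → distribˡ-im (seq (re x) n) (seq (im x) n) (seq (re y) n) (seq (im y) n) (seq (re z) n) (seq (im z) n))

  distribʳ : ∀ x y z → (y + z) * x ≈ y * x + z * x
  distribʳ x y z = ≈-pointwise
    (λ n → distribʳ-re (seq (re x) n) (seq (im x) n) (seq (re y) n) (seq (im y) n) (seq (re z) n) (seq (im z) n))
    (λ n → distribʳ-im (seq (re x) n) (seq (im x) n) (seq (re y) n) (seq (im y) n) (seq (re z) n) (seq (im z) n))

  ≈-refl : ∀ {x} → x ≈ x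
  ≈-refl {x} = ≈-pointwise {x} {x} (λ _ → refl) (λ _ → refl)

  ≈-sym : ∀ {x y} → x ≈ y → y ≈ x
  ≈-sym (p , q) = ≈ᴿ-sym p , ≈ᴿ-sym q

  ≈-trans : ∀ {x y z} → x ≈ y → y ≈ z → x ≈ z
  ≈-trans (p , q) (r , s) = ≈ᴿ-trans p r , ≈ᴿ-trans q s

  +-cong : ∀ {x y u v} → x ≈ y → u ≈ v → x + u ≈ y + v
  +-cong (p , q) (r , s) = +ᴿ-cong p r , +ᴿ-cong q s

  *-cong : ∀ {x y u v} → x ≈ y → u ≈ v → x * u ≈ y * v
  *-cong (p , q) (r , s) =
      +ᴿ-cong (*ᴿ-cong p r) (-ᴿ-cong (*ᴿ-cong q s))
    , +ᴿ-cong (*ᴿ-cong p s) (*ᴿ-cong q r)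

  -‿cong : ∀ {x y} → x ≈ y → - x ≈ - y
  -‿cong (p , q) = -ᴿ-cong p , -ᴿ-cong q

ℂ-commutativeRing : CommutativeRing 0ℓ 0ℓ
ℂ-commutativeRing = record
  { Carrier = ℂ
  ; _≈_ = _≈_
  ; _+_ = _+_
  ; _*_ = _*_
  ; -_ = -_
  ; 0# = 0#
  ; 1# = 1#
  ; isCommutativeRing = record
    { isRing = record
      { +-isAbelianGroup = record
        { isGroup = record
          { isMonoid = record
            { isSemigroup = record
              { isMagma = record
                { isEquivalence = record { refl = ≈-refl ; sym = ≈-sym ; trans = ≈-trans }
                ; ∙-cong = +-cong
                }
              ; assoc = +-assoc
              }
            ; identity = +-identityˡ , +-identityʳ
            }
          ; inverse = -‿inverseˡ , -‿inverseʳ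
          ; ⁻¹-cong = -‿cong
          }
        ; comm = +-comm
        }
      ; *-cong = *-cong
      ; *-assoc = *-assoc
      ; *-identity = *-identityˡ , *-identityʳ
      ; distrib = distribˡ , distribʳ
      }
    ; *-comm = *-comm
    }
  }

ℂ-ring = CommutativeRing.ring ℂ-commutativeRing

-- The letter a stands for the generator S_{a+1}, so a word is the same as a
-- composition, whose parts are the successors of the letters.
Word : Set
Word = List ℕ

_≟ʷ_ : DecidableEquality Word
_≟ʷ_ = List.≡-dec ℕ._≟_

composition : Word → List ℕ
composition = map suc

weight : Word → ℕ
weight = sum ∘ composition

-- Elements of the free algebra are finite formal linear combinations of words,
-- identified when all their coefficients agree.
Sym : Set
Sym = List (ℂ × Word)

coeff : Sym → Word → ℂ
coeff []            w = 0#
coeff ((c , u) ∷ X) w = (if does (u ≟ʷ w) then c else 0#) + coeff X w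

infix 4 _≋_

_≋_ : Sym → Sym → Set
X ≋ Y = ∀ w → coeff X w ≈ coeff Y w

infixl 6 _⊕_
infixr 7 _•_ _·_ _⊛_
infixr 8 _^_

_⊕_ : Sym → Sym → Sym
_⊕_ = _++_

_•_ : ℂ → Sym → Sym
c • X = map (λ (d , u) → (c * d , u)) X

_·_ : Sym → Sym → Sym
_·_ = cartesianProductWith (λ (c , u) (d , v) → (c * d , u ++ v))

𝟙 : Sym
𝟙 = (1# , []) ∷ []

_^_ : Sym → ℕ → Sym
X ^ zero  = 𝟙
X ^ suc i = X · X ^ i

∑ : {A : Set} → List A → (A → Sym) → Sym
∑ as f = foldr _⊕_ [] (map f as)

S : ℕ → Sym
S zero    = 𝟙
S (suc a) = (1# , a ∷ []) ∷ []

Matrix : Set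
Matrix = List (List ℕ)

listsOver : {A : Set} → List A → ℕ → List (List A)
listsOver as zero    = [] ∷ []
listsOver as (suc r) = cartesianProductWith _∷_ as (listsOver as r)

rowSums : Matrix → List ℕ
rowSums = map sum

columnSums : ℕ → Matrix → List ℕ
columnSums s = foldr (zipWith ℕ._+_) (replicate s 0)

-- Every entry of a matrix with row sums I is at most the sum of I, so the
-- enumeration before the filter misses no such matrix.
matrices : List ℕ → List ℕ → List Matrix
matrices I J =
  filter (λ M → List.≡-dec ℕ._≟_ (rowSums M) I ×-dec List.≡-dec ℕ._≟_ (columnSums (length J) M) J)
    (listsOver (listsOver (upTo (suc (sum I))) (length J)) (length I))

S^ : Matrix → Sym
S^ M = foldr _·_ 𝟙 (map S (concat M))

-- The internal product.  Compositions of different integers are the row and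
-- column sums of no matrix, so different degrees multiply to zero.
_⊛_ : Sym → Sym → Sym
X ⊛ Y = ∑ X λ (c , u) → ∑ Y λ (d , v) →
  (c * d) • ∑ (matrices (composition u) (composition v)) S^

IsHomogeneous : ℕ → Sym → Set
IsHomogeneous n X = ∀ w → weight w ≢ n → coeff X w ≈ 0#

1/_! : ℕ → ℂ
1/ i ! = rational (ℚ._/_ (ℤ.+ 1) (i !) {{i ℕ.!≢0}})

-1^_ : ℕ → ℂ
-1^ i = rational ((ℤ.-1ℤ ℤ.^ i) ℚ./ 1)

S♯ : ℕ → Sym
S♯ n = ∑ (upTo (suc n)) λ i → (-1^ i * 1/ i !) • S 1 ^ i · S (n ∸ i)

D⁰ : ℕ → Pred Sym 0ℓ
D⁰ n X = ∃ λ F → IsHomogeneous n F × X ≋ F ⊛ S♯ n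

-- The direct sum of the subspaces S j · D⁰ (n ∸ j) is internal to Sym: as a
-- subset it is the set of all sums of their elements.
D : ℕ → ℕ → Pred Sym 0ℓ
D n k X = ∃ λ (Y : ℕ → Sym) →
  (∀ j → j ℕ.≤ k ⊓ n → D⁰ (n ∸ j) (Y j)) × X ≋ ∑ (upTo (suc (k ⊓ n))) (λ j → S j · Y j)

unit : ℕ → ℕ → Sym
unit n k = ∑ (upTo (suc (k ⊓ n))) λ i → 1/ i ! • S 1 ^ i · S♯ (n ∸ i)

Element : ℕ → ℕ → Set
Element n k = ∃ (D n k)

Linear : ∀ {c₁ ℓ₁ c₂ ℓ₂} (V : LeftModule ℂ-ring c₁ ℓ₁) (W : LeftModule ℂ-ring c₂ ℓ₂) →
         (LeftModule.Carrierᴹ V → LeftModule.Carrierᴹ W) → Set _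
Linear V W = LeftModuleMorphisms.IsLeftModuleHomomorphism
  (LeftModule.rawLeftModule V) (LeftModule.rawLeftModule W)

-- D n k is closed under the operations of the algebra, which enter through their
-- graphs: an element z of D n k is the product of x and y exactly when its
-- underlying element of Sym is x ⊛ y, and similarly for the sum, the multiples
-- and the unit.
record Representation (n k : ℕ) (c ℓ : Level) : Set (lsuc (c ⊔ˡ ℓ)) where
  field
    space : LeftModule ℂ-ring c ℓ

  open LeftModule space public using (Carrierᴹ; _≈ᴹ_; _+ᴹ_; _*ₗ_; 0ᴹ)

  field
    act        : Element n k → Carrierᴹ → Carrierᴹ
    act-linear : ∀ x → Linear space space (act x)
    act-cong   : ∀ x y → proj₁ x ≋ proj₁ y → ∀ v → act x v ≈ᴹ act y v
    act-+      : ∀ x y z → proj₁ z ≋ proj₁ x ⊕ proj₁ y → ∀ v → act z v ≈ᴹ act x v +ᴹ act y v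
    act-•      : ∀ a x z → proj₁ z ≋ a • proj₁ x → ∀ v → act z v ≈ᴹ a *ₗ act x v
    act-⊛      : ∀ x y z → proj₁ z ≋ proj₁ x ⊛ proj₁ y → ∀ v → act z v ≈ᴹ act x (act y v)
    act-unit   : ∀ z → proj₁ z ≋ unit n k → ∀ v → act z v ≈ᴹ v

module _ {n k : ℕ} {c ℓ : Level} where

  record IsSubrepresentation (V : Representation n k c ℓ) {p} (W : Pred (Representation.Carrierᴹ V) p)
         : Set (c ⊔ˡ ℓ ⊔ˡ p) where
    open Representation V
    field
      resp-≈ : ∀ {v w} → v ≈ᴹ w → W v → W w
      has-0  : W 0ᴹ
      has-+  : ∀ {v w} → W v → W w → W (v +ᴹ w)
      has-*ₗ : ∀ a {v} → W v → W (a *ₗ v)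
      has-act : ∀ x {v} → W v → W (act x v)

  IsIrreducible : Representation n k c ℓ → Set (lsuc (c ⊔ˡ ℓ))
  IsIrreducible V = (∃ λ v → ¬ v ≈ᴹ 0ᴹ)
                  × (∀ (W : Pred Carrierᴹ (c ⊔ˡ ℓ)) → IsSubrepresentation V W →
                       (∀ v → W v → v ≈ᴹ 0ᴹ) ⊎ (∀ v → W v))
    where open Representation V

  HasDimension : Representation n k c ℓ → ℕ → Set (c ⊔ˡ ℓ)
  HasDimension V d = ∃ λ (b : Fin d → Carrierᴹ) →
      (∀ v → ∃ λ (a : Fin d → ℂ) → v ≈ᴹ sumᴹ (λ i → a i *ₗ b i))
    × (∀ (a : Fin d → ℂ) → sumᴹ (λ i → a i *ₗ b i) ≈ᴹ 0ᴹ → ∀ i → a i ≈ 0#)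
    where
    open Representation V
    open MonoidSum (LeftModule.+ᴹ-monoid space) renaming (sum to sumᴹ)

  infix 4 _≅_

  record _≅_ (V W : Representation n k c ℓ) : Set (c ⊔ˡ ℓ) where
    private
      module V = Representation V
      module W = Representation W
    field
      to          : V.Carrierᴹ → W.Carrierᴹ
      from        : W.Carrierᴹ → V.Carrierᴹ
      to-linear   : Linear V.space W.space to
      from-linear : Linear W.space V.space from
      to-act      : ∀ x v → to (V.act x v) W.≈ᴹ W.act x (to v)
      from-act    : ∀ x w → from (W.act x w) V.≈ᴹ V.act x (from w)
      to∘from     : ∀ w → to (from w) W.≈ᴹ w
      from∘to     : ∀ v → from (to v) V.≈ᴹ v

  ≅-refl : ∀ {V} → V ≅ V
  ≅-refl {V} = record
    { to = id
    ; from = id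
    ; to-linear = Identity.isLeftModuleHomomorphism _ ≈ᴹ-refl
    ; from-linear = Identity.isLeftModuleHomomorphism _ ≈ᴹ-refl
    ; to-act = λ _ _ → ≈ᴹ-refl
    ; from-act = λ _ _ → ≈ᴹ-refl
    ; to∘from = λ _ → ≈ᴹ-refl
    ; from∘to = λ _ → ≈ᴹ-refl
    }
    where open LeftModule (Representation.space V)

  ≅-sym : ∀ {V W} → V ≅ W → W ≅ V
  ≅-sym i = record
    { to = from ; from = to
    ; to-linear = from-linear ; from-linear = to-linear
    ; to-act = from-act ; from-act = to-act
    ; to∘from = from∘to ; from∘to = to∘from
    }
    where open _≅_ i

  ≅-trans : ∀ {U V W} → U ≅ V → V ≅ W → U ≅ W
  ≅-trans {U} {V} {W} i j = record
    { to = j.to ∘ i.to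
    ; from = i.from ∘ j.from
    ; to-linear = Composition.isLeftModuleHomomorphism W.≈ᴹ-trans i.to-linear j.to-linear
    ; from-linear = Composition.isLeftModuleHomomorphism U.≈ᴹ-trans j.from-linear i.from-linear
    ; to-act = λ x v → W.≈ᴹ-trans (⟦⟧-cong j.to-linear (i.to-act x v)) (j.to-act x (i.to v))
    ; from-act = λ x w → U.≈ᴹ-trans (⟦⟧-cong i.from-linear (j.from-act x w)) (i.from-act x (j.from w))
    ; to∘from = λ w → W.≈ᴹ-trans (⟦⟧-cong j.to-linear (i.to∘from (j.from w))) (j.to∘from w)
    ; from∘to = λ v → U.≈ᴹ-trans (⟦⟧-cong i.from-linear (j.from∘to (i.to v))) (i.from∘to v)
    }
    where
    module i = _≅_ i
    module j = _≅_ j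
    module U = LeftModule (Representation.space U)
    module W = LeftModule (Representation.space W)
    open LeftModuleMorphisms.IsLeftModuleHomomorphism using (⟦⟧-cong)

IrreducibleRepresentation : ℕ → ℕ → (c ℓ : Level) → Set (lsuc (c ⊔ˡ ℓ))
IrreducibleRepresentation n k c ℓ = Σ (Representation n k c ℓ) IsIrreducible

irreducibles-up-to-≅ : ℕ → ℕ → (c ℓ : Level) → Setoid (lsuc (c ⊔ˡ ℓ)) (c ⊔ˡ ℓ)
irreducibles-up-to-≅ n k c ℓ = record
  { Carrier = IrreducibleRepresentation n k c ℓ
  ; _≈_ = λ V W → proj₁ V ≅ proj₁ W
  ; isEquivalence = record { refl = ≅-refl ; sym = ≅-sym ; trans = ≅-trans }
  }

record Partition (n : ℕ) : Set where
  field
    parts      : List ℕ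
    decreasing : Linked ℕ._≥_ parts
    positive   : All (ℕ._> 0) parts
    total      : sum parts ≡ n

open Partition public

PartitionWithFewOnes : ℕ → ℕ → Set
PartitionWithFewOnes n k = Σ (Partition n) λ p → length (filter (ℕ._≟ 1) (parts p)) ℕ.≤ k

-- Partitions are compared by their lists of parts, not by the attached proofs.
partitions-with-few-ones : ℕ → ℕ → Setoid 0ℓ 0ℓ
partitions-with-few-ones n k = On.setoid {B = PartitionWithFewOnes n k} (setoid (List ℕ)) (parts ∘ proj₁)

{-# OPTIONS --safe #-}

-- Sym is free on S₁, S♯₂, S♯₃, …, and D⁰ is the subalgebra generated by the S♯ₙ with
-- n ≥ 2.  As S♯ = e^{-S₁} σ₁ is grouplike and the derivation ∂ : Sₙ ↦ Sₙ₋₁ kills it,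
-- the elements b_{j,I} = S₁ʲ/j! · S♯^I with j ≤ k span D n k and multiply by
-- b_{j,I} * b_{l,L} = δ_{jl} Σ_M b_{j,M}, the sum being over the same matrices M as
-- in S^I * S^L.  A term M is either I or longer than I, and the coefficient of b_{j,I}
-- itself is χ_I(S^L), where χ_I is the character pairing commutative images with the
-- power sum p_I.
-- Hence, if (j , I) is the lexicographically largest (j , length I) for which β = b_{j,I}
-- acts nontrivially on an irreducible V, then β x v = χ(x) β v for the character χ of the
-- partition 1ʲ ∪ I.  The kernel of β is then a proper subrepresentation, so it is 0
-- and every x acts on V by χ(x).  Conversely the characters of the partitions with at
-- most k ones are pairwise distinct on the elements b_{j,I}.

module Submission where

open import Algebra.Bundles using (CommutativeRing)
open import Algebra.Module.Bundles using (LeftModule)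
open import Algebra.Module.Morphism.Structures using (module LeftModuleMorphisms)
import Algebra.Properties.AbelianGroup as AbelianGroupProperties
import Algebra.Properties.CommutativeSemigroup as CommutativeSemigroupProperties
import Algebra.Properties.Ring as RingProperties
import Algebra.Solver.Ring.NaturalCoefficients.Default as NaturalCoefficients
open import Axiom.ExcludedMiddle using (ExcludedMiddle)
open import Data.Bool.Base using (if_then_else_)
open import Data.Empty using (⊥-elim)
open import Data.Fin.Base using (Fin)
import Data.Integer.Base as ℤ
import Data.Integer.Properties as ℤ
open import Data.List.Base using (List; []; _∷_; _++_; map; concat; concatMap; cartesianProductWith; deduplicate; filter; foldr; length; replicate; upTo; zipWith)
open import Data.List.Membership.Propositional using (_∈_)
open import Data.List.Membership.Propositional.Properties using (∈-cartesianProductWith⁺; ∈-deduplicate⁺; ∈-map⁺; ∈-upTo⁺; ∈-upTo⁻; ∈-++⁺ˡ; ∈-++⁺ʳ)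
import Data.List.Properties as List
open import Data.List.Relation.Binary.Permutation.Propositional as ↭ using (_↭_; ↭-reflexive; ↭-sym; ↭-trans; ↭⇒↭ₛ)
import Data.List.Relation.Binary.Permutation.Propositional.Properties as ↭
open import Data.List.Relation.Binary.Pointwise using (Pointwise-≡⇒≡)
open import Data.List.Relation.Unary.All as All using (All; []; _∷_)
import Data.List.Relation.Unary.All.Properties as All
open import Data.List.Relation.Unary.AllPairs using ([]; _∷_)
open import Data.List.Relation.Unary.Any using (Any; here; there)
open import Data.List.Relation.Unary.Linked using (Linked)
import Data.List.Relation.Unary.Sorted.TotalOrder.Properties as Sorted
import Data.List.Relation.Unary.Unique.DecPropositional.Properties as DecUnique
open import Data.List.Relation.Unary.Unique.Propositional using (Unique)
import Data.List.Relation.Unary.Unique.Propositional.Properties as Unique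
import Data.List.Sort as Sort
open import Data.Nat.Base as ℕ using (ℕ; zero; suc; s≤s; z≤n; _!; _∸_; _⊓_)
open import Data.Nat.ListAction using (sum)
open import Data.Nat.ListAction.Properties using (sum-++; sum-↭)
import Data.Nat.Properties as ℕ
open import Data.Product.Base using (∃; _×_; _,_; proj₁; proj₂; uncurry)
open import Data.Rational.Base as ℚ using (ℚ; 0ℚ; 1ℚ; ½; ∣_∣)
import Data.Rational.Properties as ℚ
open import Data.Rational.Solver using (module +-*-Solver)
open import Data.Rational.Unnormalised.Base as ℚᵘ using (mkℚᵘ; *≡*)
import Data.Rational.Unnormalised.Properties as ℚᵘ
open import Data.Sum.Base using (_⊎_; inj₁; inj₂; [_,_]′)
open import Function.Base using (_∘_; flip; id)
open import Function.Bundles using (Bijection)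
open import Level using (Level; 0ℓ; Lift; lift; lower; _⊔_)
open import Relation.Binary.Bundles using (DecTotalOrder)
import Relation.Binary.Construct.Flip.EqAndOrd as Flip
open import Relation.Binary.Definitions using (tri<; tri≈; tri>)
open import Relation.Binary.PropositionalEquality using (_≡_; _≢_; refl; sym; trans; cong; cong₂; setoid; subst; subst₂; module ≡-Reasoning)
import Relation.Binary.Reasoning.Setoid as SetoidReasoning
open import Relation.Nullary using (¬_; Dec; yes; no; does)
open import Relation.Nullary.Decidable using (_×-dec_; decidable-stable; map′; toWitnessFalse)
open import Relation.Unary using (Pred)
open import Defs

open CommutativeRing ℂ-commutativeRing
  using (+-cong; +-congˡ; +-congʳ; +-assoc; +-comm; +-identityˡ; +-identityʳ; *-cong; *-congˡ; *-congʳ; *-assoc; *-comm;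
         *-identityˡ; *-identityʳ; distribˡ; distribʳ; zeroˡ; zeroʳ; -‿inverseʳ; -‿inverseˡ; -‿cong)
  renaming (refl to ≈-refl; sym to ≈-sym; trans to ≈-trans; reflexive to ≈-reflexive)
open RingProperties ℂ-ring using (-‿distribˡ-*; -‿+-comm)
open LeftModuleMorphisms.IsLeftModuleHomomorphism using (⟦⟧-cong; +ᴹ-homo; *ₗ-homo; 0ᴹ-homo; -ᴹ-homo)

-- Sums in ℂ and functionals on Sym

-- The value χ_I(S^L) comes from the shortest matrices: if the reading word has as many letters as I
-- has parts, each row has a single nonzero entry, so the rows place the parts of I into columns
-- with sums L, and pairing with p_I counts these placements. Multiplicativity of χ is obtained
-- separately: χ is a composite of adjoints of multiplication by power sums, and each adjoint
-- respects the internal product. The ones of the partition come from the factor S₁ʲ/j!. The adjoint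
-- of p₁ is ∂, which lowers S₁ʲ/j! by one step and kills the S♯, so p₁ᵐ detects the exponent j = m,
-- while the other power sums act on I alone. The obstacle is that * is given on the S, where a
-- product of S♯ has many terms. Grouplikeness lets Φ pass through the right factor row by row. On
-- the left, a row of sum 1 applies ∂ to the right factor, so every term of S♯ that starts with S₁
-- contributes 0 and S♯ acts like S.

module ≈-Reasoning = SetoidReasoning (CommutativeRing.setoid ℂ-commutativeRing)

module ℂ-Solver = NaturalCoefficients (CommutativeRing.commutativeSemiring ℂ-commutativeRing)

+-interchange : ∀ a b c d → (a + b) + (c + d) ≈ (a + c) + (b + d)
+-interchange = CommutativeSemigroupProperties.interchange
  (CommutativeRing.+-commutativeSemigroup ℂ-commutativeRing)

*-left-comm : ∀ a b c → a * (b * c) ≈ b * (a * c)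
*-left-comm = CommutativeSemigroupProperties.x∙yz≈y∙xz
  (CommutativeRing.*-commutativeSemigroup ℂ-commutativeRing)

private variable
  ℓᵃ ℓᵖ : Level
  A B C : Set ℓᵃ
  E : Set
  P Q R : Set ℓᵖ

δ : Dec P → ℂ
δ d = if does d then 1# else 0#

δ-yes : (d : Dec P) → P → δ d ≈ 1#
δ-yes (yes _) _ = ≈-refl
δ-yes (no ¬p) p = ⊥-elim (¬p p)

δ-no : (d : Dec P) → ¬ P → δ d ≈ 0#
δ-no (yes p) ¬p = ⊥-elim (¬p p)
δ-no (no _) _ = ≈-refl

δ-⇔ : (d : Dec P) (e : Dec Q) → (P → Q) → (Q → P) → δ d ≈ δ e
δ-⇔ (yes p) e to from = ≈-sym (δ-yes e (to p))
δ-⇔ (no ¬p) e to from = ≈-sym (δ-no e (¬p ∘ from))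

δ-cong : (d : Dec P) {x y : ℂ} → (P → x ≈ y) → δ d * x ≈ δ d * y
δ-cong (yes p) x≈y = *-congˡ (x≈y p)
δ-cong (no _) _ = ≈-trans (zeroˡ _) (≈-sym (zeroˡ _))

δ-yes-* : (d : Dec P) {x : ℂ} → P → δ d * x ≈ x
δ-yes-* d p = ≈-trans (*-congʳ (δ-yes d p)) (*-identityˡ _)

δ-no-* : (d : Dec P) {x : ℂ} → ¬ P → δ d * x ≈ 0#
δ-no-* d ¬p = ≈-trans (*-congʳ (δ-no d ¬p)) (zeroˡ _)

∑ℂ : List A → (A → ℂ) → ℂ
∑ℂ []       f = 0#
∑ℂ (x ∷ xs) f = f x + ∑ℂ xs f

∑ℂ-cong : (xs : List A) {f g : A → ℂ} → (∀ x → f x ≈ g x) → ∑ℂ xs f ≈ ∑ℂ xs g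
∑ℂ-cong []       f≈g = ≈-refl
∑ℂ-cong (x ∷ xs) f≈g = +-cong (f≈g x) (∑ℂ-cong xs f≈g)

∑ℂ-cong-All : {xs : List A} {f g : A → ℂ} → All (λ x → f x ≈ g x) xs → ∑ℂ xs f ≈ ∑ℂ xs g
∑ℂ-cong-All []          = ≈-refl
∑ℂ-cong-All (fx≈gx ∷ f≈g) = +-cong fx≈gx (∑ℂ-cong-All f≈g)

∑ℂ-0 : (xs : List A) → ∑ℂ xs (λ _ → 0#) ≈ 0#
∑ℂ-0 []       = ≈-refl
∑ℂ-0 (x ∷ xs) = ≈-trans (+-identityˡ _) (∑ℂ-0 xs)

∑ℂ-≈0 : (xs : List A) {f : A → ℂ} → (∀ x → f x ≈ 0#) → ∑ℂ xs f ≈ 0#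
∑ℂ-≈0 xs f≈0 = ≈-trans (∑ℂ-cong xs f≈0) (∑ℂ-0 xs)

∑ℂ-+ : (xs : List A) (f g : A → ℂ) → ∑ℂ xs (λ x → f x + g x) ≈ ∑ℂ xs f + ∑ℂ xs g
∑ℂ-+ []       f g = ≈-sym (+-identityˡ _)
∑ℂ-+ (x ∷ xs) f g = ≈-trans (+-congˡ (∑ℂ-+ xs f g)) (+-interchange _ _ _ _)

∑ℂ-* : (c : ℂ) (xs : List A) (f : A → ℂ) → c * ∑ℂ xs f ≈ ∑ℂ xs (λ x → c * f x)
∑ℂ-* c []       f = zeroʳ c
∑ℂ-* c (x ∷ xs) f = ≈-trans (distribˡ _ _ _) (+-congˡ (∑ℂ-* c xs f))

∑ℂ-*ʳ : (c : ℂ) (xs : List A) (f : A → ℂ) → ∑ℂ xs f * c ≈ ∑ℂ xs (λ x → f x * c)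
∑ℂ-*ʳ c xs f = ≈-trans (*-comm _ c) (≈-trans (∑ℂ-* c xs f) (∑ℂ-cong xs (λ x → *-comm c (f x))))

∑ℂ-++ : (xs ys : List A) (f : A → ℂ) → ∑ℂ (xs ++ ys) f ≈ ∑ℂ xs f + ∑ℂ ys f
∑ℂ-++ []       ys f = ≈-sym (+-identityˡ _)
∑ℂ-++ (x ∷ xs) ys f = ≈-trans (+-congˡ (∑ℂ-++ xs ys f)) (≈-sym (+-assoc _ _ _))

∑ℂ-map : (h : A → B) (xs : List A) (f : B → ℂ) → ∑ℂ (map h xs) f ≈ ∑ℂ xs (f ∘ h)
∑ℂ-map h []       f = ≈-refl
∑ℂ-map h (x ∷ xs) f = +-congˡ (∑ℂ-map h xs f)

∑ℂ-cartesianProductWith : (h : A → B → C) (xs : List A) (ys : List B) (f : C → ℂ) →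
  ∑ℂ (cartesianProductWith h xs ys) f ≈ ∑ℂ xs (λ x → ∑ℂ ys (λ y → f (h x y)))
∑ℂ-cartesianProductWith h []       ys f = ≈-refl
∑ℂ-cartesianProductWith h (x ∷ xs) ys f =
  ≈-trans (∑ℂ-++ (map (h x) ys) _ f) (+-cong (∑ℂ-map (h x) ys f) (∑ℂ-cartesianProductWith h xs ys f))

∑ℂ-filter : {R : A → Set ℓᵖ} (R? : ∀ x → Dec (R x)) (xs : List A) (f : A → ℂ) →
  ∑ℂ (filter R? xs) f ≈ ∑ℂ xs (λ x → δ (R? x) * f x)
∑ℂ-filter R? []       f = ≈-refl
∑ℂ-filter R? (x ∷ xs) f with R? x
... | yes _ = +-cong (≈-sym (*-identityˡ _)) (∑ℂ-filter R? xs f)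
... | no  _ = ≈-trans (∑ℂ-filter R? xs f) (≈-sym (≈-trans (+-congʳ (zeroˡ _)) (+-identityˡ _)))

∑ℂ-swap : (xs : List A) (ys : List B) (f : A → B → ℂ) →
  ∑ℂ xs (λ x → ∑ℂ ys (f x)) ≈ ∑ℂ ys (λ y → ∑ℂ xs (λ x → f x y))
∑ℂ-swap []       ys f = ≈-sym (∑ℂ-0 ys)
∑ℂ-swap (x ∷ xs) ys f = ≈-trans (+-congˡ (∑ℂ-swap xs ys f)) (≈-sym (∑ℂ-+ ys (f x) _))

∑ℂ-absent : {R : A → Set ℓᵖ} (R? : ∀ x → Dec (R x)) {xs : List A} (f : A → ℂ) →
  All (λ x → ¬ R x) xs → ∑ℂ xs (λ x → δ (R? x) * f x) ≈ 0#
∑ℂ-absent R? f []          = ≈-refl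
∑ℂ-absent R? f (¬r ∷ none) = ≈-trans (+-cong (δ-no-* (R? _) ¬r) (∑ℂ-absent R? f none)) (+-identityˡ _)

∑ℂ-pick : (_≟_ : ∀ (x y : A) → Dec (x ≡ y)) {x : A} {xs : List A} (f : A → ℂ) →
  Unique xs → x ∈ xs → ∑ℂ xs (λ y → δ (x ≟ y) * f y) ≈ f x
∑ℂ-pick _≟_ {x} f (x∉xs ∷ _) (here refl) =
  ≈-trans (+-cong (δ-yes-* (x ≟ x) refl) (∑ℂ-absent (x ≟_) f x∉xs)) (+-identityʳ _)
∑ℂ-pick _≟_ {x} {y ∷ _} f (y∉xs ∷ xs!) (there x∈xs) =
  ≈-trans (+-cong (δ-no-* (x ≟ y) (λ { refl → All.lookup y∉xs x∈xs refl })) (∑ℂ-pick _≟_ f xs! x∈xs)) (+-identityˡ _)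

-- By ∫⇒≋ and ≋⇒∫, an element of Sym is determined by its pairings ∫ X f with all
-- functionals f on words, and it is through these that all products are computed.
∫ : List (ℂ × A) → (A → ℂ) → ℂ
∫ X f = ∑ℂ X (λ (c , x) → c * f x)

∫-cong : (X : List (ℂ × A)) {f g : A → ℂ} → (∀ x → f x ≈ g x) → ∫ X f ≈ ∫ X g
∫-cong X f≈g = ∑ℂ-cong X (λ (c , x) → *-congˡ (f≈g x))

∫-0 : (X : List (ℂ × A)) → ∫ X (λ _ → 0#) ≈ 0#
∫-0 X = ∑ℂ-≈0 X (λ _ → zeroʳ _)

∫-≈0 : (X : List (ℂ × A)) {f : A → ℂ} → (∀ x → f x ≈ 0#) → ∫ X f ≈ 0#
∫-≈0 X f≈0 = ≈-trans (∫-cong X f≈0) (∫-0 X)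

∫-+ : (X : List (ℂ × A)) (f g : A → ℂ) → ∫ X (λ x → f x + g x) ≈ ∫ X f + ∫ X g
∫-+ X f g = ≈-trans (∑ℂ-cong X (λ _ → distribˡ _ _ _)) (∑ℂ-+ X _ _)

∫-* : (a : ℂ) (X : List (ℂ × A)) (f : A → ℂ) → a * ∫ X f ≈ ∫ X (λ x → a * f x)
∫-* a X f = ≈-trans (∑ℂ-* a X _) (∑ℂ-cong X (λ _ → *-left-comm _ _ _))

∫-*ʳ : (a : ℂ) (X : List (ℂ × A)) (f : A → ℂ) → ∫ X f * a ≈ ∫ X (λ x → f x * a)
∫-*ʳ a X f = ≈-trans (*-comm _ _) (≈-trans (∫-* a X f) (∫-cong X (λ x → *-comm _ _)))

∫-∑ℂ : (X : List (ℂ × A)) (ys : List B) (f : A → B → ℂ) →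
  ∫ X (λ x → ∑ℂ ys (f x)) ≈ ∑ℂ ys (λ y → ∫ X (λ x → f x y))
∫-∑ℂ X ys f = ≈-trans (∑ℂ-cong X (λ _ → ∑ℂ-* _ ys _)) (∑ℂ-swap X ys _)

∫-swap : (X : List (ℂ × A)) (Y : List (ℂ × B)) (f : A → B → ℂ) →
  ∫ X (λ x → ∫ Y (f x)) ≈ ∫ Y (λ y → ∫ X (λ x → f x y))
∫-swap X Y f = ≈-trans (∫-∑ℂ X Y _) (∑ℂ-cong Y (λ (c , y) → ≈-sym (∫-* c X (λ x → f x y))))

∫-⊕ : (X Y : Sym) (f : Word → ℂ) → ∫ (X ⊕ Y) f ≈ ∫ X f + ∫ Y f
∫-⊕ X Y f = ∑ℂ-++ X Y _

∫-• : (a : ℂ) (X : Sym) (f : Word → ℂ) → ∫ (a • X) f ≈ a * ∫ X f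
∫-• a X f = ≈-trans (∑ℂ-map _ X _) (≈-trans (∑ℂ-cong X (λ _ → *-assoc _ _ _)) (≈-sym (∑ℂ-* a X _)))

∫-· : (X Y : Sym) (f : Word → ℂ) → ∫ (X · Y) f ≈ ∫ X (λ u → ∫ Y (f ∘ (u ++_)))
∫-· X Y f = ≈-trans (∑ℂ-cartesianProductWith _ X Y _)
  (∑ℂ-cong X (λ (c , u) → ≈-trans (∑ℂ-cong Y (λ _ → *-assoc _ _ _)) (≈-sym (∑ℂ-* c Y _))))

∫-∑ : {A : Set} (xs : List A) (X : A → Sym) (f : Word → ℂ) → ∫ (∑ xs X) f ≈ ∑ℂ xs (λ x → ∫ (X x) f)
∫-∑ []       X f = ≈-refl
∫-∑ (x ∷ xs) X f = ≈-trans (∫-⊕ (X x) _ f) (+-congˡ (∫-∑ xs X f))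

∫-single : (u : Word) (f : Word → ℂ) → ∫ ((1# , u) ∷ []) f ≈ f u
∫-single u f = ≈-trans (+-identityʳ _) (*-identityˡ _)

coeff-∫ : (X : Sym) (w : Word) → coeff X w ≈ ∫ X (λ u → δ (u ≟ʷ w))
coeff-∫ []            w = ≈-refl
coeff-∫ ((c , u) ∷ X) w = +-cong (step (u ≟ʷ w)) (coeff-∫ X w)
  where
  step : (d : Dec (u ≡ w)) → (if does d then c else 0#) ≈ c * δ d
  step (yes _) = ≈-sym (*-identityʳ c)
  step (no _)  = ≈-sym (zeroʳ c)

∫⇒≋ : (X Y : Sym) → (∀ f → ∫ X f ≈ ∫ Y f) → X ≋ Y
∫⇒≋ X Y X≐Y w = ≈-trans (coeff-∫ X w) (≈-trans (X≐Y _) (≈-sym (coeff-∫ Y w)))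

-- A pairing depends on the list `X` only through its coefficients: `f u` is rewritten as a sum over
-- `ws`, where each word occurs once, and the two summations are exchanged.
∫-coeff : (X : Sym) (ws : List Word) → Unique ws → All (λ (c , u) → u ∈ ws) X → (f : Word → ℂ) →
  ∫ X f ≈ ∑ℂ ws (λ w → coeff X w * f w)
∫-coeff X ws ws! X⊆ws f = begin
  ∫ X f
    ≈⟨ ∑ℂ-cong-All (All.map (λ {(c , u)} u∈ws → *-congˡ {c} (≈-sym (∑ℂ-pick _≟ʷ_ f ws! u∈ws))) X⊆ws) ⟩
  ∫ X (λ u → ∑ℂ ws (λ w → δ (u ≟ʷ w) * f w))
    ≈⟨ ∫-∑ℂ X ws (λ u w → δ (u ≟ʷ w) * f w) ⟩
  ∑ℂ ws (λ w → ∫ X (λ u → δ (u ≟ʷ w) * f w))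
    ≈⟨ ∑ℂ-cong ws (λ w → ∫-*ʳ (f w) X _) ⟨
  ∑ℂ ws (λ w → ∫ X (λ u → δ (u ≟ʷ w)) * f w)
    ≈⟨ ∑ℂ-cong ws (λ w → *-congʳ (coeff-∫ X w)) ⟨
  ∑ℂ ws (λ w → coeff X w * f w) ∎
  where
  open ≈-Reasoning

≋⇒∫ : (X Y : Sym) → X ≋ Y → ∀ f → ∫ X f ≈ ∫ Y f
≋⇒∫ X Y X≋Y f = begin
  ∫ X f  ≈⟨ ∫-coeff X ws ws! (All.tabulate (λ {(c , u)} x∈X → mem (∈-++⁺ˡ (∈-map⁺ proj₂ x∈X)))) f ⟩
  ∑ℂ ws (λ w → coeff X w * f w)  ≈⟨ ∑ℂ-cong ws (λ w → *-congʳ (X≋Y w)) ⟩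
  ∑ℂ ws (λ w → coeff Y w * f w)  ≈⟨ ∫-coeff Y ws ws! (All.tabulate (λ {(c , u)} y∈Y → mem (∈-++⁺ʳ (map proj₂ X) (∈-map⁺ proj₂ y∈Y)))) f ⟨
  ∫ Y f ∎
  where
  open ≈-Reasoning
  -- One duplicate-free list holds the words of both sides, so that the two expansions have the same
  -- index set.
  ws : List Word
  ws = deduplicate _≟ʷ_ (map proj₂ X ++ map proj₂ Y)
  ws! : Unique ws
  ws! = DecUnique.deduplicate-! _≟ʷ_ _
  mem : ∀ {u} → u ∈ map proj₂ X ++ map proj₂ Y → u ∈ ws
  mem = ∈-deduplicate⁺ _≟ʷ_

-- The coproduct and the derivations dual to power sums

-- Built by recursion instead of as pairs `(i , n ∸ i)`: truncated subtraction disappears, and sums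
-- over `i + j = n` can be rearranged by induction on `n`. `∑ℂ-upTo` connects it with the sums in
-- the definitions.
splits : ℕ → List (ℕ × ℕ)
splits zero    = (0 , 0) ∷ []
splits (suc n) = (0 , suc n) ∷ map (λ (i , j) → suc i , j) (splits n)

conv : ℕ → (ℕ → ℕ → ℂ) → ℂ
conv n F = ∑ℂ (splits n) (uncurry F)

conv-cong : ∀ n {F G : ℕ → ℕ → ℂ} → (∀ i j → F i j ≈ G i j) → conv n F ≈ conv n G
conv-cong n F≈G = ∑ℂ-cong (splits n) (λ (i , j) → F≈G i j)

splits-sum : ∀ n → All (λ (i , j) → i ℕ.+ j ≡ n) (splits n)
splits-sum zero    = refl ∷ []
splits-sum (suc n) = refl ∷ All.map⁺ (All.map (cong suc) (splits-sum n))

conv-cong-≡ : ∀ n {F G : ℕ → ℕ → ℂ} → (∀ i j → i ℕ.+ j ≡ n → F i j ≈ G i j) → conv n F ≈ conv n G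
conv-cong-≡ n F≈G = ∑ℂ-cong-All (All.map (λ {(i , j)} → F≈G i j) (splits-sum n))

conv-+ : ∀ n (F G : ℕ → ℕ → ℂ) → conv n (λ i j → F i j + G i j) ≈ conv n F + conv n G
conv-+ n F G = ∑ℂ-+ (splits n) _ _

conv-* : ∀ c n (F : ℕ → ℕ → ℂ) → c * conv n F ≈ conv n (λ i j → c * F i j)
conv-* c n F = ∑ℂ-* c (splits n) _

conv-≈0 : ∀ n {F : ℕ → ℕ → ℂ} → (∀ i j → F i j ≈ 0#) → conv n F ≈ 0#
conv-≈0 n F≈0 = ∑ℂ-≈0 (splits n) (λ (i , j) → F≈0 i j)

conv-0 : (F : ℕ → ℕ → ℂ) → conv 0 F ≈ F 0 0
conv-0 F = +-identityʳ _

conv-suc : ∀ n (F : ℕ → ℕ → ℂ) → conv (suc n) F ≈ F 0 (suc n) + conv n (λ i j → F (suc i) j)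
conv-suc n F = +-congˡ (∑ℂ-map _ (splits n) _)

conv-last : ∀ n (F : ℕ → ℕ → ℂ) → conv (suc n) F ≈ conv n (λ i j → F i (suc j)) + F (suc n) 0
conv-last zero F = begin
  conv 1 F  ≈⟨ +-congˡ (conv-0 (λ i j → F (suc i) j)) ⟩
  F 0 1 + F 1 0  ≈⟨ +-congʳ (+-identityʳ _) ⟨
  conv 0 (λ i j → F i (suc j)) + F 1 0 ∎
  where open ≈-Reasoning
conv-last (suc n) F = begin
  conv (suc (suc n)) F
    ≈⟨ conv-suc (suc n) F ⟩
  F 0 (suc (suc n)) + conv (suc n) (λ i j → F (suc i) j)
    ≈⟨ +-congˡ (conv-last n (λ i j → F (suc i) j)) ⟩
  F 0 (suc (suc n)) + (conv n (λ i j → F (suc i) (suc j)) + F (suc (suc n)) 0)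
    ≈⟨ +-assoc _ _ _ ⟨
  F 0 (suc (suc n)) + conv n (λ i j → F (suc i) (suc j)) + F (suc (suc n)) 0
    ≈⟨ +-congʳ (conv-suc n (λ i j → F i (suc j))) ⟨
  conv (suc n) (λ i j → F i (suc j)) + F (suc (suc n)) 0 ∎
  where open ≈-Reasoning

conv-comm : ∀ n (F : ℕ → ℕ → ℂ) → conv n F ≈ conv n (flip F)
conv-comm zero    F = ≈-refl
conv-comm (suc n) F = begin
  conv (suc n) F  ≈⟨ conv-suc n F ⟩
  F 0 (suc n) + conv n (λ i j → F (suc i) j)  ≈⟨ +-comm _ _ ⟩
  conv n (λ i j → F (suc i) j) + F 0 (suc n)  ≈⟨ +-congʳ (conv-comm n (λ i j → F (suc i) j)) ⟩
  conv n (λ i j → F (suc j) i) + F 0 (suc n)  ≈⟨ conv-last n (flip F) ⟨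
  conv (suc n) (flip F) ∎
  where open ≈-Reasoning

conv-assoc : ∀ n (F : ℕ → ℕ → ℕ → ℂ) →
  conv n (λ i c → conv i (λ a b → F a b c)) ≈ conv n (λ a j → conv j (λ b c → F a b c))
conv-assoc zero    F = ≈-refl
conv-assoc (suc n) F = begin
  conv (suc n) (λ i c → conv i (λ a b → F a b c))
    ≈⟨ conv-suc n _ ⟩
  conv 0 (λ a b → F a b (suc n)) + conv n (λ i c → conv (suc i) (λ a b → F a b c))
    ≈⟨ +-cong (+-identityʳ _) (conv-cong n (λ i c → conv-suc i (λ a b → F a b c))) ⟩
  F 0 0 (suc n) + conv n (λ i c → F 0 (suc i) c + conv i (λ a b → F (suc a) b c))
    ≈⟨ +-congˡ (conv-+ n _ _) ⟩
  F 0 0 (suc n) + (conv n (λ i c → F 0 (suc i) c) + conv n (λ i c → conv i (λ a b → F (suc a) b c)))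
    ≈⟨ +-assoc _ _ _ ⟨
  F 0 0 (suc n) + conv n (λ i c → F 0 (suc i) c) + conv n (λ i c → conv i (λ a b → F (suc a) b c))
    ≈⟨ +-cong (conv-suc n (F 0)) (≈-sym (conv-assoc n (λ a b c → F (suc a) b c))) ⟨
  conv (suc n) (F 0) + conv n (λ a j → conv j (λ b c → F (suc a) b c))
    ≈⟨ conv-suc n (λ a j → conv j (λ b c → F a b c)) ⟨
  conv (suc n) (λ a j → conv j (λ b c → F a b c)) ∎
  where open ≈-Reasoning

-- Both sides run over `a + b + c + d = n`, and only the two middle indices trade places. This
-- regroups the coproducts of two factors by tensor factor.
conv-interchange : ∀ n (F : ℕ → ℕ → ℕ → ℕ → ℂ) →
  conv n (λ i j → conv i (λ a b → conv j (λ c d → F a b c d))) ≈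
  conv n (λ i j → conv i (λ a c → conv j (λ b d → F a b c d)))
conv-interchange n F = begin
  conv n (λ i j → conv i (λ a b → conv j (λ c d → F a b c d)))
    ≈⟨ conv-assoc n _ ⟩
  conv n (λ a m → conv m (λ b j → conv j (λ c d → F a b c d)))
    ≈⟨ conv-cong n (λ a m → middle m (F a)) ⟩
  conv n (λ a m → conv m (λ c j → conv j (λ b d → F a b c d)))
    ≈⟨ conv-assoc n _ ⟨
  conv n (λ i j → conv i (λ a c → conv j (λ b d → F a b c d))) ∎
  where
  open ≈-Reasoning
  middle : ∀ m (H : ℕ → ℕ → ℕ → ℂ) →
    conv m (λ b j → conv j (λ c d → H b c d)) ≈ conv m (λ c j → conv j (λ b d → H b c d))
  middle m H = begin
    conv m (λ b j → conv j (λ c d → H b c d))  ≈⟨ conv-assoc m H ⟨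
    conv m (λ i d → conv i (λ b c → H b c d))  ≈⟨ conv-cong m (λ i d → conv-comm i (λ b c → H b c d)) ⟩
    conv m (λ i d → conv i (λ c b → H b c d))  ≈⟨ conv-assoc m (λ c b d → H b c d) ⟩
    conv m (λ c j → conv j (λ b d → H b c d)) ∎

-- chop k n is the list of n ∸ suc k, empty if that subtraction is truncated.
chop : ℕ → ℕ → List ℕ
chop k       zero    = []
chop zero    (suc n) = n ∷ []
chop (suc k) (suc n) = chop k n

-- As `chop k` subtracts `k + 1`, the composite subtracts `k + l + 2`, which is the amount encoded
-- by `suc k + l`.
chop-chop : ∀ k l n (g : ℕ → ℂ) → ∑ℂ (chop k n) (λ m → ∑ℂ (chop l m) g) ≈ ∑ℂ (chop (suc k ℕ.+ l) n) g
chop-chop k       l zero    g = ≈-refl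
chop-chop zero    l (suc n) g = +-identityʳ _
chop-chop (suc k) l (suc n) g = chop-chop k l n g

chop-comm : ∀ k l n (g : ℕ → ℂ) →
  ∑ℂ (chop k n) (λ m → ∑ℂ (chop l m) g) ≈ ∑ℂ (chop l n) (λ m → ∑ℂ (chop k m) g)
chop-comm k l n g = ≈-trans (chop-chop k l n g)
  (≈-trans (≈-reflexive (cong (λ i → ∑ℂ (chop (suc i) n) g) (ℕ.+-comm k l))) (≈-sym (chop-chop l k n g)))

conv-chop₀ : ∀ n (F : ℕ → ℕ → ℂ) →
  conv n (λ i j → ∑ℂ (chop 0 j) (F i)) ≈ ∑ℂ (chop 0 n) (λ m → conv m F)
conv-chop₀ zero    F = +-identityʳ _
conv-chop₀ (suc n) F = begin
  conv (suc n) (λ i j → ∑ℂ (chop 0 j) (F i))  ≈⟨ conv-last n _ ⟩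
  conv n (λ i j → F i j + 0#) + 0#  ≈⟨ +-congʳ (conv-cong n (λ i j → +-identityʳ _)) ⟩
  conv n F + 0# ∎
  where open ≈-Reasoning

-- For generating series `chop k` is multiplication by t^(k+1), which moves freely from one factor
-- to the whole product.
conv-chopʳ : ∀ k n (F : ℕ → ℕ → ℂ) →
  conv n (λ i j → ∑ℂ (chop k j) (F i)) ≈ ∑ℂ (chop k n) (λ m → conv m F)
conv-chopʳ zero    n F = conv-chop₀ n F
conv-chopʳ (suc k) n F = begin
  conv n (λ i j → ∑ℂ (chop (suc k) j) (F i))
    ≈⟨ conv-cong n (λ i j → chop-chop 0 k j (F i)) ⟨
  conv n (λ i j → ∑ℂ (chop 0 j) (λ m → ∑ℂ (chop k m) (F i)))
    ≈⟨ conv-chop₀ n (λ i m → ∑ℂ (chop k m) (F i)) ⟩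
  ∑ℂ (chop 0 n) (λ m → conv m (λ i j → ∑ℂ (chop k j) (F i)))
    ≈⟨ ∑ℂ-cong (chop 0 n) (λ m → conv-chopʳ k m F) ⟩
  ∑ℂ (chop 0 n) (λ m → ∑ℂ (chop k m) (λ m → conv m F))
    ≈⟨ chop-chop 0 k n _ ⟩
  ∑ℂ (chop (suc k) n) (λ m → conv m F) ∎
  where open ≈-Reasoning

conv-chopˡ : ∀ k n (F : ℕ → ℕ → ℂ) →
  conv n (λ i j → ∑ℂ (chop k i) (λ m → F m j)) ≈ ∑ℂ (chop k n) (λ m → conv m F)
conv-chopˡ k n F = begin
  conv n (λ i j → ∑ℂ (chop k i) (λ m → F m j))  ≈⟨ conv-comm n _ ⟩
  conv n (λ i j → ∑ℂ (chop k j) (λ m → F m i))  ≈⟨ conv-chopʳ k n (flip F) ⟩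
  ∑ℂ (chop k n) (λ m → conv m (flip F))  ≈⟨ ∑ℂ-cong (chop k n) (λ m → conv-comm m F) ⟨
  ∑ℂ (chop k n) (λ m → conv m F) ∎
  where open ≈-Reasoning

-- The surviving split is `(m , n ∸ m)`. Since `chop m` subtracts `m + 1`, it is `chop m (suc n)`
-- that yields the second component; it is empty when `m > n` and no split qualifies.
conv-δ : ∀ m n (F : ℕ → ℕ → ℂ) → conv n (λ i j → δ (i ℕ.≟ m) * F i j) ≈ ∑ℂ (chop m (suc n)) (F m)
conv-δ zero zero F = +-congʳ (*-identityˡ _)
conv-δ zero (suc n) F = ≈-trans (conv-suc n _)
  (+-cong (*-identityˡ _) (conv-≈0 n (λ i j → δ-no-* (suc i ℕ.≟ 0) {F (suc i) j} λ ())))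
conv-δ (suc m) zero F = ≈-trans (conv-0 (λ i j → δ (i ℕ.≟ suc m) * F i j)) (zeroˡ _)
conv-δ (suc m) (suc n) F = begin
  conv (suc n) (λ i j → δ (i ℕ.≟ suc m) * F i j)
    ≈⟨ conv-suc n _ ⟩
  0# * F 0 (suc n) + conv n (λ i j → δ (suc i ℕ.≟ suc m) * F (suc i) j)
    ≈⟨ +-cong (zeroˡ _) (conv-cong n λ i j → *-congʳ (δ-⇔ (suc i ℕ.≟ suc m) (i ℕ.≟ m) ℕ.suc-injective (cong suc))) ⟩
  0# + conv n (λ i j → δ (i ℕ.≟ m) * F (suc i) j)
    ≈⟨ +-identityˡ _ ⟩
  conv n (λ i j → δ (i ℕ.≟ m) * F (suc i) j)
    ≈⟨ conv-δ m n (λ i → F (suc i)) ⟩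
  ∑ℂ (chop m (suc n)) (F (suc m)) ∎
  where open ≈-Reasoning

δ-chop : ∀ x k n → δ (x ℕ.+ suc k ℕ.≟ n) ≈ ∑ℂ (chop k n) (λ m → δ (x ℕ.≟ m))
δ-chop x k zero = δ-no (x ℕ.+ suc k ℕ.≟ 0) (λ eq → ℕ.1+n≢0 (trans (sym (ℕ.+-suc x k)) eq))
δ-chop x zero (suc n) = ≈-trans
  (δ-⇔ (x ℕ.+ 1 ℕ.≟ suc n) (x ℕ.≟ n) (λ eq → ℕ.suc-injective (trans (ℕ.+-comm 1 x) eq)) (λ eq → trans (ℕ.+-comm x 1) (cong suc eq)))
  (≈-sym (+-identityʳ _))
δ-chop x (suc k) (suc n) = ≈-trans
  (δ-⇔ (x ℕ.+ suc (suc k) ℕ.≟ suc n) (x ℕ.+ suc k ℕ.≟ n)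
    (λ eq → ℕ.suc-injective (trans (sym (ℕ.+-suc x (suc k))) eq)) (λ eq → trans (ℕ.+-suc x (suc k)) (cong suc eq)))
  (δ-chop x k n)

-- The word of `S n`. Because `S 0` is the unit, 0 goes to the empty word, and zero entries of a
-- matrix then vanish from its reading word by themselves.
letter : ℕ → Word
letter zero    = []
letter (suc a) = a ∷ []

weight-letter : ∀ n → weight (letter n) ≡ n
weight-letter zero    = refl
weight-letter (suc a) = ℕ.+-identityʳ (suc a)

weight-++ : ∀ u v → weight (u ++ v) ≡ weight u ℕ.+ weight v
weight-++ []      v = refl
weight-++ (a ∷ u) v = trans (cong (suc a ℕ.+_) (weight-++ u v)) (sym (ℕ.+-assoc (suc a) (weight u) (weight v)))

length≤weight : ∀ u → length u ℕ.≤ weight u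
length≤weight []      = z≤n
length≤weight (a ∷ u) = s≤s (ℕ.≤-trans (length≤weight u) (ℕ.m≤n+m (weight u) a))

unshuffles : Word → List (Word × Word)
unshuffles []      = ([] , []) ∷ []
unshuffles (a ∷ v) =
  cartesianProductWith (λ (i , j) (p , q) → letter i ++ p , letter j ++ q) (splits (suc a)) (unshuffles v)

-- The coproduct Δ S_n = Σ S_i ⊗ S_{n-i}, paired with a functional on the tensor square.
Δ : Word → (Word → Word → ℂ) → ℂ
Δ v F = ∑ℂ (unshuffles v) (uncurry F)

Δ-cong : ∀ v {F G : Word → Word → ℂ} → (∀ p q → F p q ≈ G p q) → Δ v F ≈ Δ v G
Δ-cong v F≈G = ∑ℂ-cong (unshuffles v) (λ (p , q) → F≈G p q)

Δ-≈0 : ∀ v {F : Word → Word → ℂ} → (∀ p q → F p q ≈ 0#) → Δ v F ≈ 0#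
Δ-≈0 v F≈0 = ∑ℂ-≈0 (unshuffles v) (λ (p , q) → F≈0 p q)

Δ-+ : ∀ v (F G : Word → Word → ℂ) → Δ v (λ p q → F p q + G p q) ≈ Δ v F + Δ v G
Δ-+ v F G = ∑ℂ-+ (unshuffles v) _ _

Δ-* : ∀ c v (F : Word → Word → ℂ) → c * Δ v F ≈ Δ v (λ p q → c * F p q)
Δ-* c v F = ∑ℂ-* c (unshuffles v) _

Δ-∑ℂ : ∀ v (xs : List A) (F : Word → Word → A → ℂ) → Δ v (λ p q → ∑ℂ xs (F p q)) ≈ ∑ℂ xs (λ x → Δ v (λ p q → F p q x))
Δ-∑ℂ v xs F = ∑ℂ-swap (unshuffles v) xs _

Δ-conv : ∀ v n (F : Word → Word → ℕ → ℕ → ℂ) →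
  Δ v (λ p q → conv n (F p q)) ≈ conv n (λ i j → Δ v (λ p q → F p q i j))
Δ-conv v n F = Δ-∑ℂ v (splits n) _

Δ-∫ : ∀ v (X : List (ℂ × A)) (F : Word → Word → A → ℂ) →
  Δ v (λ p q → ∫ X (F p q)) ≈ ∫ X (λ x → Δ v (λ p q → F p q x))
Δ-∫ v X F = ≈-sym (∫-∑ℂ X (unshuffles v) _)

Δ-[] : (F : Word → Word → ℂ) → Δ [] F ≈ F [] []
Δ-[] F = +-identityʳ _

Δ-∷ : ∀ a v (F : Word → Word → ℂ) →
  Δ (a ∷ v) F ≈ conv (suc a) (λ i j → Δ v (λ p q → F (letter i ++ p) (letter j ++ q)))
Δ-∷ a v F = ∑ℂ-cartesianProductWith _ (splits (suc a)) (unshuffles v) (uncurry F)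

Δ-letter : ∀ n v (F : Word → Word → ℂ) →
  Δ (letter n ++ v) F ≈ conv n (λ i j → Δ v (λ p q → F (letter i ++ p) (letter j ++ q)))
Δ-letter zero    v F = ≈-sym (+-identityʳ _)
Δ-letter (suc a) v F = Δ-∷ a v F

Δ-flip : ∀ v (F : Word → Word → ℂ) → Δ v F ≈ Δ v (flip F)
Δ-flip []      F = ≈-refl
Δ-flip (a ∷ v) F = begin
  Δ (a ∷ v) F
    ≈⟨ Δ-∷ a v F ⟩
  conv (suc a) (λ i j → Δ v (λ p q → F (letter i ++ p) (letter j ++ q)))
    ≈⟨ conv-cong (suc a) (λ i j → Δ-flip v _) ⟩
  conv (suc a) (λ i j → Δ v (λ p q → F (letter i ++ q) (letter j ++ p)))
    ≈⟨ conv-comm (suc a) _ ⟩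
  conv (suc a) (λ i j → Δ v (λ p q → F (letter j ++ q) (letter i ++ p)))
    ≈⟨ Δ-∷ a v (flip F) ⟨
  Δ (a ∷ v) (flip F) ∎
  where open ≈-Reasoning

Δ-++ : ∀ u v (F : Word → Word → ℂ) → Δ (u ++ v) F ≈ Δ u (λ p q → Δ v (λ p′ q′ → F (p ++ p′) (q ++ q′)))
Δ-++ []      v F = ≈-sym (+-identityʳ _)
Δ-++ (a ∷ u) v F = begin
  Δ (a ∷ u ++ v) F
    ≈⟨ Δ-∷ a (u ++ v) F ⟩
  conv (suc a) (λ i j → Δ (u ++ v) (λ p q → F (letter i ++ p) (letter j ++ q)))
    ≈⟨ conv-cong (suc a) (λ i j → Δ-++ u v _) ⟩
  conv (suc a) (λ i j → Δ u (λ p q → Δ v (λ p′ q′ → F (letter i ++ p ++ p′) (letter j ++ q ++ q′))))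
    ≈⟨ conv-cong (suc a) (λ i j → Δ-cong u (λ p q → Δ-cong v (λ p′ q′ →
         ≈-reflexive (cong₂ F (List.++-assoc (letter i) p p′) (List.++-assoc (letter j) q q′))))) ⟨
  conv (suc a) (λ i j → Δ u (λ p q → Δ v (λ p′ q′ → F ((letter i ++ p) ++ p′) ((letter j ++ q) ++ q′))))
    ≈⟨ Δ-∷ a u _ ⟨
  Δ (a ∷ u) (λ p q → Δ v (λ p′ q′ → F (p ++ p′) (q ++ q′))) ∎
  where open ≈-Reasoning

-- A functional that vanishes on nonempty left factors is the counit there, so this is the counit
-- law of the coproduct.
Δ-counit : ∀ v (F : Word → Word → ℂ) → (∀ a p q → F (a ∷ p) q ≈ 0#) → Δ v F ≈ F [] v
Δ-counit []      F F≈0 = Δ-[] F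
Δ-counit (b ∷ v) F F≈0 = begin
  Δ (b ∷ v) F
    ≈⟨ Δ-∷ b v F ⟩
  conv (suc b) (λ i j → Δ v (λ p q → F (letter i ++ p) (letter j ++ q)))
    ≈⟨ conv-suc b _ ⟩
  Δ v (λ p q → F p (b ∷ q)) + conv b (λ i j → Δ v (λ p q → F (i ∷ p) (letter j ++ q)))
    ≈⟨ +-cong (Δ-counit v (λ p q → F p (b ∷ q)) (λ a p q → F≈0 a p (b ∷ q)))
              (conv-≈0 b (λ i j → Δ-≈0 v (λ p q → F≈0 i p (letter j ++ q)))) ⟩
  F [] (b ∷ v) + 0#
    ≈⟨ +-identityʳ _ ⟩
  F [] (b ∷ v) ∎
  where open ≈-Reasoning

removals : ℕ → Word → List Word
removals k []      = []
removals k (a ∷ w) = map (λ m → letter m ++ w) (chop k (suc a)) ++ map (a ∷_) (removals k w)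

-- The derivation S_n ↦ S_{n-k-1}, acting on functionals by transposition.
d : ℕ → (Word → ℂ) → Word → ℂ
d k f w = ∑ℂ (removals k w) f

d-cong : ∀ k {f g : Word → ℂ} → (∀ w → f w ≈ g w) → ∀ w → d k f w ≈ d k g w
d-cong k f≈g w = ∑ℂ-cong (removals k w) f≈g

d-+ : ∀ k (f g : Word → ℂ) w → d k (λ v → f v + g v) w ≈ d k f w + d k g w
d-+ k f g w = ∑ℂ-+ (removals k w) f g

d-∷ : ∀ k f a w → d k f (a ∷ w) ≈ ∑ℂ (chop k (suc a)) (λ m → f (letter m ++ w)) + d k (f ∘ (a ∷_)) w
d-∷ k f a w = ≈-trans (∑ℂ-++ (map (λ m → letter m ++ w) (chop k (suc a))) _ f)
  (+-cong (∑ℂ-map _ (chop k (suc a)) f) (∑ℂ-map _ (removals k w) f))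

d-letter : ∀ k f n w →
  d k f (letter n ++ w) ≈ ∑ℂ (chop k n) (λ m → f (letter m ++ w)) + d k (f ∘ (letter n ++_)) w
d-letter k f zero    w = ≈-sym (+-identityˡ _)
d-letter k f (suc a) w = d-∷ k f a w

-- The transposed Leibniz rule: the derivation hits a letter of `u` or a letter of `w`.
d-++ : ∀ k f u w → d k f (u ++ w) ≈ d k (λ v → f (v ++ w)) u + d k (f ∘ (u ++_)) w
d-++ k f []      w = ≈-sym (+-identityˡ _)
d-++ k f (a ∷ u) w = begin
  d k f (a ∷ u ++ w)
    ≈⟨ d-∷ k f a (u ++ w) ⟩
  ∑ℂ (chop k (suc a)) (λ m → f (letter m ++ u ++ w)) + d k (f ∘ (a ∷_)) (u ++ w)
    ≈⟨ +-cong (∑ℂ-cong (chop k (suc a)) (λ m → ≈-reflexive (cong f (sym (List.++-assoc (letter m) u w)))))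
              (d-++ k (f ∘ (a ∷_)) u w) ⟩
  ∑ℂ (chop k (suc a)) (λ m → f ((letter m ++ u) ++ w)) + (d k (λ v → f (a ∷ v ++ w)) u + d k (λ v → f (a ∷ u ++ v)) w)
    ≈⟨ +-assoc _ _ _ ⟨
  ∑ℂ (chop k (suc a)) (λ m → f ((letter m ++ u) ++ w)) + d k (λ v → f (a ∷ v ++ w)) u + d k (λ v → f (a ∷ u ++ v)) w
    ≈⟨ +-congʳ (d-∷ k (λ v → f (v ++ w)) a u) ⟨
  d k (λ v → f (v ++ w)) (a ∷ u) + d k (λ v → f (a ∷ u ++ v)) w ∎
  where open ≈-Reasoning

-- On a single letter both orders subtract `k + l + 2`, and by the Leibniz rule the derivations then
-- commute on words. This makes `χ μ` independent of the order of `μ`.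
d-comm : ∀ k l f w → d k (d l f) w ≈ d l (d k f) w
d-comm k l f []      = ≈-refl
d-comm k l f (a ∷ w) = begin
  d k (d l f) (a ∷ w)
    ≈⟨ expand k l ⟩
  (cc k l + cd k l) + (cd l k + d k (d l f′) w)
    ≈⟨ +-cong (+-congʳ (chop-comm k l (suc a) _)) (+-congˡ (d-comm k l f′ w)) ⟩
  (cc l k + cd k l) + (cd l k + d l (d k f′) w)
    ≈⟨ +-interchange _ _ _ _ ⟩
  (cc l k + cd l k) + (cd k l + d l (d k f′) w)
    ≈⟨ expand l k ⟨
  d l (d k f) (a ∷ w) ∎
  where
  open ≈-Reasoning
  f′ : Word → ℂ
  f′ v = f (a ∷ v)
  -- `cc k l` collects the terms where both derivations hit the first letter, `cd k l` those where
  -- `d k` hits the first letter and `d l` the rest.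
  cc cd : ℕ → ℕ → ℂ
  cc k l = ∑ℂ (chop k (suc a)) (λ m → ∑ℂ (chop l m) (λ m′ → f (letter m′ ++ w)))
  cd k l = ∑ℂ (chop k (suc a)) (λ m → d l (f ∘ (letter m ++_)) w)
  expand : ∀ k l → d k (d l f) (a ∷ w) ≈ (cc k l + cd k l) + (cd l k + d k (d l f′) w)
  expand k l = begin
    d k (d l f) (a ∷ w)
      ≈⟨ d-∷ k (d l f) a w ⟩
    ∑ℂ (chop k (suc a)) (λ m → d l f (letter m ++ w)) + d k (λ v → d l f (a ∷ v)) w
      ≈⟨ +-cong (∑ℂ-cong (chop k (suc a)) (λ m → d-letter l f m w)) (d-cong k (λ v → d-∷ l f a v) w) ⟩
    ∑ℂ (chop k (suc a)) (λ m → ∑ℂ (chop l m) (λ m′ → f (letter m′ ++ w)) + d l (f ∘ (letter m ++_)) w)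
      + d k (λ v → ∑ℂ (chop l (suc a)) (λ m → f (letter m ++ v)) + d l f′ v) w
      ≈⟨ +-cong (∑ℂ-+ (chop k (suc a)) _ _) (d-+ k _ _ w) ⟩
    (cc k l + cd k l) + (d k (λ v → ∑ℂ (chop l (suc a)) (λ m → f (letter m ++ v))) w + d k (d l f′) w)
      ≈⟨ +-congˡ (+-congʳ (∑ℂ-swap (removals k w) (chop l (suc a)) _)) ⟩
    (cc k l + cd k l) + (cd l k + d k (d l f′) w) ∎

-- On functionals `Δ` is a commutative product in which `d k` is multiplication by the power sum
-- p_(k+1), as `Δ-d` shows, so one factor can absorb it. On a single letter this is `conv-chopˡ`.
Δ-dˡ : ∀ k v (F : Word → Word → ℂ) → d k (λ v′ → Δ v′ F) v ≈ Δ v (λ p q → d k (λ p′ → F p′ q) p)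
Δ-dˡ k []      F = ≈-sym (+-identityʳ _)
Δ-dˡ k (a ∷ v) F = begin
  d k (λ v′ → Δ v′ F) (a ∷ v)
    ≈⟨ d-∷ k (λ v′ → Δ v′ F) a v ⟩
  ∑ℂ (chop k (suc a)) (λ m → Δ (letter m ++ v) F) + d k (λ v′ → Δ (a ∷ v′) F) v
    ≈⟨ +-cong (∑ℂ-cong (chop k (suc a)) (λ m → Δ-letter m v F)) (d-cong k (λ v′ → Δ-∷ a v′ F) v) ⟩
  ∑ℂ (chop k (suc a)) (λ m → conv m (λ i j → Δ v (F′ i j)))
    + d k (λ v′ → conv (suc a) (λ i j → Δ v′ (F′ i j))) v
    ≈⟨ +-cong (≈-sym (conv-chopˡ k (suc a) (λ i j → Δ v (F′ i j)))) (∑ℂ-swap (removals k v) (splits (suc a)) _) ⟩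
  conv (suc a) (λ i j → ∑ℂ (chop k i) (λ m → Δ v (F′ m j)))
    + conv (suc a) (λ i j → d k (λ v′ → Δ v′ (F′ i j)) v)
    ≈⟨ conv-+ (suc a) _ _ ⟨
  conv (suc a) (λ i j → ∑ℂ (chop k i) (λ m → Δ v (F′ m j)) + d k (λ v′ → Δ v′ (F′ i j)) v)
    ≈⟨ conv-cong (suc a) (λ i j → +-cong (≈-sym (Δ-∑ℂ v (chop k i) _)) (Δ-dˡ k v (F′ i j))) ⟩
  conv (suc a) (λ i j → Δ v (λ p q → ∑ℂ (chop k i) (λ m → F′ m j p q)) + Δ v (λ p q → d k (λ p′ → F′ i j p′ q) p))
    ≈⟨ conv-cong (suc a) (λ i j → ≈-sym (Δ-+ v _ _)) ⟩
  conv (suc a) (λ i j → Δ v (λ p q → ∑ℂ (chop k i) (λ m → F′ m j p q) + d k (λ p′ → F′ i j p′ q) p))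
    ≈⟨ conv-cong (suc a) (λ i j → Δ-cong v (λ p q → d-letter k (λ p′ → F p′ (letter j ++ q)) i p)) ⟨
  conv (suc a) (λ i j → Δ v (λ p q → d k (λ p′ → F p′ (letter j ++ q)) (letter i ++ p)))
    ≈⟨ Δ-∷ a v _ ⟨
  Δ (a ∷ v) (λ p q → d k (λ p′ → F p′ q) p) ∎
  where
  open ≈-Reasoning
  F′ : ℕ → ℕ → Word → Word → ℂ
  F′ i j p q = F (letter i ++ p) (letter j ++ q)

Δ-dʳ : ∀ k v (F : Word → Word → ℂ) → d k (λ v′ → Δ v′ F) v ≈ Δ v (λ p q → d k (F p) q)
Δ-dʳ k v F = begin
  d k (λ v′ → Δ v′ F) v  ≈⟨ d-cong k (λ v′ → Δ-flip v′ F) v ⟩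
  d k (λ v′ → Δ v′ (flip F)) v  ≈⟨ Δ-dˡ k v (flip F) ⟩
  Δ v (λ p q → d k (F q) p)  ≈⟨ Δ-flip v _ ⟩
  Δ v (λ p q → d k (F p) q) ∎
  where open ≈-Reasoning

chop-+ : ∀ k n → All (λ m → m ℕ.+ suc k ≡ n) (chop k n)
chop-+ k       zero    = []
chop-+ zero    (suc n) = ℕ.+-comm n 1 ∷ []
chop-+ (suc k) (suc n) = All.map (λ {m} eq → trans (ℕ.+-suc m (suc k)) (cong suc eq)) (chop-+ k n)

removals-weight : ∀ k w → All (λ v → weight v ℕ.+ suc k ≡ weight w) (removals k w)
removals-weight k []      = []
removals-weight k (a ∷ w) = All.++⁺
  (All.map⁺ (All.map chopped (chop-+ k (suc a))))
  (All.map⁺ (All.map (λ {v} eq → trans (ℕ.+-assoc (suc a) (weight v) (suc k)) (cong (suc a ℕ.+_) eq)) (removals-weight k w)))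
  where
  chopped : ∀ {m} → m ℕ.+ suc k ≡ suc a → weight (letter m ++ w) ℕ.+ suc k ≡ suc a ℕ.+ weight w
  chopped {m} eq = begin
    weight (letter m ++ w) ℕ.+ suc k  ≡⟨ cong (ℕ._+ suc k) (trans (weight-++ (letter m) w) (cong (ℕ._+ weight w) (weight-letter m))) ⟩
    m ℕ.+ weight w ℕ.+ suc k  ≡⟨ ℕ.+-assoc m (weight w) (suc k) ⟩
    m ℕ.+ (weight w ℕ.+ suc k)  ≡⟨ cong (m ℕ.+_) (ℕ.+-comm (weight w) (suc k)) ⟩
    m ℕ.+ (suc k ℕ.+ weight w)  ≡⟨ ℕ.+-assoc m (suc k) (weight w) ⟨
    m ℕ.+ suc k ℕ.+ weight w  ≡⟨ cong (ℕ._+ weight w) eq ⟩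
    suc a ℕ.+ weight w ∎
    where open ≡-Reasoning

-- The part of Δ v in S_{m+1} ⊗ Sym is S_{m+1} ⊗ d_m v; the other terms of
-- degree m+1 in the left factor have at least two letters there.
Δ-d : ∀ m v (F : Word → Word → ℂ) →
  (∀ a b p q → weight (a ∷ b ∷ p) ≡ suc m → F (a ∷ b ∷ p) q ≈ 0#) →
  Δ v (λ p q → δ (weight p ℕ.≟ suc m) * F p q) ≈ d m (F (m ∷ [])) v
Δ-d m []      F long = ≈-trans (+-identityʳ _) (zeroˡ _)
Δ-d m (a ∷ v) F long = begin
  Δ (a ∷ v) (λ p q → δ (weight p ℕ.≟ suc m) * F p q)
    ≈⟨ Δ-∷ a v _ ⟩
  conv (suc a) (λ i j → Δ v (λ p q → δ (weight (letter i ++ p) ℕ.≟ suc m) * F (letter i ++ p) (letter j ++ q)))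
    ≈⟨ conv-suc a _ ⟩
  Δ v (λ p q → δ (weight p ℕ.≟ suc m) * F p (a ∷ q))
    + conv a (λ i j → Δ v (λ p q → δ (weight (i ∷ p) ℕ.≟ suc m) * F (i ∷ p) (letter j ++ q)))
    ≈⟨ +-cong (Δ-d m v (λ p q → F p (a ∷ q)) (λ b b′ p q → long b b′ p (a ∷ q))) (conv-cong a first) ⟩
  d m (λ v′ → F (m ∷ []) (a ∷ v′)) v + conv a (λ i j → δ (i ℕ.≟ m) * F (i ∷ []) (letter j ++ v))
    ≈⟨ +-comm _ _ ⟩
  conv a (λ i j → δ (i ℕ.≟ m) * F (i ∷ []) (letter j ++ v)) + d m (λ v′ → F (m ∷ []) (a ∷ v′)) v
    ≈⟨ +-congʳ (conv-δ m a _) ⟩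
  ∑ℂ (chop m (suc a)) (λ j → F (m ∷ []) (letter j ++ v)) + d m (λ v′ → F (m ∷ []) (a ∷ v′)) v
    ≈⟨ d-∷ m (F (m ∷ [])) a v ⟨
  d m (F (m ∷ [])) (a ∷ v) ∎
  where
  open ≈-Reasoning
  first : ∀ i j → Δ v (λ p q → δ (weight (i ∷ p) ℕ.≟ suc m) * F (i ∷ p) (letter j ++ q)) ≈ δ (i ℕ.≟ m) * F (i ∷ []) (letter j ++ v)
  first i j = begin
    Δ v (λ p q → δ (weight (i ∷ p) ℕ.≟ suc m) * F (i ∷ p) (letter j ++ q))
      ≈⟨ Δ-counit v _ (λ b p q → ≈-trans
           (δ-cong (weight (i ∷ b ∷ p) ℕ.≟ suc m) (long i b p (letter j ++ q))) (zeroʳ _)) ⟩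
    δ (suc (i ℕ.+ 0) ℕ.≟ suc m) * F (i ∷ []) (letter j ++ v)
      ≈⟨ *-congʳ (δ-⇔ (suc (i ℕ.+ 0) ℕ.≟ suc m) (i ℕ.≟ m)
           (λ eq → trans (sym (ℕ.+-identityʳ i)) (ℕ.suc-injective eq)) (λ eq → cong suc (trans (ℕ.+-identityʳ i) eq))) ⟩
    δ (i ℕ.≟ m) * F (i ∷ []) (letter j ++ v) ∎

δ-× : (e : Dec P) (e₁ : Dec Q) (e₂ : Dec R) →
  (P → Q) → (P → R) → (Q → R → P) → δ e ≈ δ e₁ * δ e₂
δ-× e (yes q) e₂ P⇒Q P⇒R Q,R⇒P = ≈-trans (δ-⇔ e e₂ P⇒R (Q,R⇒P q)) (≈-sym (*-identityˡ _))
δ-× e (no ¬q) e₂ P⇒Q P⇒R Q,R⇒P = ≈-trans (δ-no e (¬q ∘ P⇒Q)) (≈-sym (zeroˡ _))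

-- The internal product

-- The pairing of a functional f with S^u * S^v.  As matrices are read row by
-- row, their first row is the left part of an unshuffling of v.
star : (Word → ℂ) → Word → Word → ℂ
star f []      []      = f []
star f []      (_ ∷ _) = 0#
star f (a ∷ u) v       = Δ v (λ p q → δ (weight p ℕ.≟ suc a) * star (f ∘ (p ++_)) u q)

star-cong : ∀ {f g : Word → ℂ} → (∀ w → f w ≈ g w) → ∀ u v → star f u v ≈ star g u v
star-cong f≈g []      []      = f≈g []
star-cong f≈g []      (_ ∷ _) = ≈-refl
star-cong f≈g (a ∷ u) v       = Δ-cong v (λ p q → *-congˡ (star-cong (λ w → f≈g (p ++ w)) u q))

star-0 : ∀ u v → star (λ _ → 0#) u v ≈ 0#
star-0 []      []      = ≈-refl
star-0 []      (_ ∷ _) = ≈-refl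
star-0 (a ∷ u) v       = Δ-≈0 v (λ p q → ≈-trans (*-congˡ (star-0 u q)) (zeroʳ _))

star-+ : ∀ (f g : Word → ℂ) u v → star (λ w → f w + g w) u v ≈ star f u v + star g u v
star-+ f g []      []      = ≈-refl
star-+ f g []      (_ ∷ _) = ≈-sym (+-identityˡ _)
star-+ f g (a ∷ u) v       = ≈-trans
  (Δ-cong v (λ p q → ≈-trans (*-congˡ (star-+ _ _ u q)) (distribˡ _ _ _))) (Δ-+ v _ _)

star-* : ∀ c (f : Word → ℂ) u v → star (λ w → c * f w) u v ≈ c * star f u v
star-* c f []      []      = ≈-refl
star-* c f []      (_ ∷ _) = ≈-sym (zeroʳ c)
star-* c f (a ∷ u) v       = ≈-trans
  (Δ-cong v (λ p q → ≈-trans (*-congˡ (star-* c _ u q)) (*-left-comm _ _ _))) (≈-sym (Δ-* c v _))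

star-∑ℂ : (xs : List A) (f : Word → A → ℂ) → ∀ u v →
  star (λ w → ∑ℂ xs (f w)) u v ≈ ∑ℂ xs (λ x → star (λ w → f w x) u v)
star-∑ℂ []       f u v = star-0 u v
star-∑ℂ (x ∷ xs) f u v = ≈-trans (star-+ _ _ u v) (+-congˡ (star-∑ℂ xs f u v))

star-∫ : (X : List (ℂ × A)) (f : Word → A → ℂ) → ∀ u v →
  star (λ w → ∫ X (f w)) u v ≈ ∫ X (λ x → star (λ w → f w x) u v)
star-∫ X f u v = ≈-trans (star-∑ℂ X _ u v) (∑ℂ-cong X (λ (c , x) → star-* c _ u v))

star-letter : ∀ f n u v →
  star f (letter n ++ u) v ≈ Δ v (λ p q → δ (weight p ℕ.≟ n) * star (f ∘ (p ++_)) u q)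
star-letter f (suc a) u v = ≈-refl
star-letter f zero    u v = ≈-sym (≈-trans
  (Δ-counit v _ (λ a p q → δ-no-* (weight (a ∷ p) ℕ.≟ 0) λ ())) (*-identityˡ _))

star-0∷ : ∀ f u v → star f (0 ∷ u) v ≈ d 0 (star (f ∘ (0 ∷_)) u) v
star-0∷ f u v = Δ-d 0 v _ λ a b p q eq → ⊥-elim (two≰1 a b p eq)
  where
  two≰1 : ∀ a b p → weight (a ∷ b ∷ p) ≢ 1
  two≰1 a b p eq = ℕ.1+n≢0 (trans (sym (ℕ.+-suc a (b ℕ.+ weight p))) (ℕ.suc-injective eq))

-- Each row has positive sum and so contributes at least one letter: no reading word is shorter than
-- `u`.
star-short : ∀ f u v → (∀ w → length u ℕ.≤ length w → f w ≈ 0#) → star f u v ≈ 0#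
star-short f []      []      f≈0 = f≈0 [] z≤n
star-short f []      (_ ∷ _) f≈0 = ≈-refl
star-short f (a ∷ u) v       f≈0 = Δ-≈0 v λ where
  []      q → δ-no-* (0 ℕ.≟ suc a) λ ()
  (b ∷ p) q → ≈-trans (*-congˡ (star-short _ u q (λ w u≤w → f≈0 (b ∷ p ++ w)
    (s≤s (ℕ.≤-trans u≤w (ℕ.≤-trans (ℕ.m≤n+m (length w) (length p)) (ℕ.≤-reflexive (sym (List.length-++ p)))))))))
    (zeroʳ _)

-- d k, the adjoint of multiplication by the power sum p_{k+1}, is multiplicative for
-- the internal product: removing k+1 from an entry of a matrix removes it from
-- its row sum and from its column sum.
star-d : ∀ k f u v → star (d k f) u v ≈ d k (λ u′ → d k (star f u′) v) u
star-d k f []      []      = ≈-refl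
star-d k f []      (_ ∷ _) = ≈-refl
star-d k f (a ∷ u) v       = begin
  Δ v (λ p q → row p * star (λ w → d k f (p ++ w)) u q)
    ≈⟨ Δ-cong v (λ p q → *-congˡ (≈-trans (star-cong (λ w → d-++ k f p w) u q) (star-+ _ _ u q))) ⟩
  Δ v (λ p q → row p * (star (λ w → d k (λ p′ → f (p′ ++ w)) p) u q + star (d k (f ∘ (p ++_))) u q))
    ≈⟨ Δ-cong v (λ p q → distribˡ _ _ _) ⟩
  Δ v (λ p q → row p * star (λ w → d k (λ p′ → f (p′ ++ w)) p) u q + row p * star (d k (f ∘ (p ++_))) u q)
    ≈⟨ Δ-+ v _ _ ⟩
  Δ v (λ p q → row p * star (λ w → d k (λ p′ → f (p′ ++ w)) p) u q)
    + Δ v (λ p q → row p * star (d k (f ∘ (p ++_))) u q)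
    ≈⟨ +-cong in-first-row in-other-row ⟩
  ∑ℂ (chop k (suc a)) (λ m → d k (star f (letter m ++ u)) v) + d k (λ u′ → d k (star f (a ∷ u′)) v) u
    ≈⟨ d-∷ k (λ u′ → d k (star f u′) v) a u ⟨
  d k (λ u′ → d k (star f u′) v) (a ∷ u) ∎
  where
  open ≈-Reasoning
  row : Word → ℂ
  row p = δ (weight p ℕ.≟ suc a)
  rest : Word → Word → Word → ℂ
  rest p u q = star (f ∘ (p ++_)) u q
  -- The lowered entry lies in the first row `p`. Its weight before the removal was `suc a`, so
  -- `δ-chop` turns the condition into a first row of the smaller sum `m`, and `Δ-dˡ` turns the
  -- removal from `p` into one from the columns `v`.
  in-first-row : Δ v (λ p q → row p * star (λ w → d k (λ p′ → f (p′ ++ w)) p) u q) ≈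
                 ∑ℂ (chop k (suc a)) (λ m → d k (star f (letter m ++ u)) v)
  in-first-row = begin
    Δ v (λ p q → row p * star (λ w → d k (λ p′ → f (p′ ++ w)) p) u q)
      ≈⟨ Δ-cong v (λ p q → *-congˡ (star-∑ℂ (removals k p) _ u q)) ⟩
    Δ v (λ p q → row p * d k (λ p′ → rest p′ u q) p)
      ≈⟨ Δ-cong v (λ p q → ≈-trans (∑ℂ-* (row p) (removals k p) _)
           (∑ℂ-cong-All (All.map (λ {p′} eq → *-congʳ (≈-reflexive (cong (λ n → δ (n ℕ.≟ suc a)) (sym eq)))) (removals-weight k p)))) ⟩
    Δ v (λ p q → d k (λ p′ → δ (weight p′ ℕ.+ suc k ℕ.≟ suc a) * rest p′ u q) p)
      ≈⟨ Δ-dˡ k v _ ⟨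
    d k (λ v′ → Δ v′ (λ p q → δ (weight p ℕ.+ suc k ℕ.≟ suc a) * rest p u q)) v
      ≈⟨ d-cong k (λ v′ → Δ-cong v′ (λ p q → ≈-trans (*-congʳ (δ-chop (weight p) k (suc a)))
           (∑ℂ-*ʳ _ (chop k (suc a)) _))) v ⟩
    d k (λ v′ → Δ v′ (λ p q → ∑ℂ (chop k (suc a)) (λ m → δ (weight p ℕ.≟ m) * rest p u q))) v
      ≈⟨ d-cong k (λ v′ → ≈-trans (Δ-∑ℂ v′ (chop k (suc a)) _)
           (∑ℂ-cong (chop k (suc a)) (λ m → ≈-sym (star-letter f m u v′)))) v ⟩
    d k (λ v′ → ∑ℂ (chop k (suc a)) (λ m → star f (letter m ++ u) v′)) v
      ≈⟨ ∑ℂ-swap (removals k v) (chop k (suc a)) _ ⟩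
    ∑ℂ (chop k (suc a)) (λ m → d k (star f (letter m ++ u)) v) ∎
  -- The first row stays as it is, the induction hypothesis treats the remaining rows, and `Δ-dʳ`
  -- carries the removal from the remaining columns `q` over to `v`.
  in-other-row : Δ v (λ p q → row p * star (d k (f ∘ (p ++_))) u q) ≈ d k (λ u′ → d k (star f (a ∷ u′)) v) u
  in-other-row = begin
    Δ v (λ p q → row p * star (d k (f ∘ (p ++_))) u q)
      ≈⟨ Δ-cong v (λ p q → ≈-trans (*-congˡ (star-d k _ u q)) (∑ℂ-* (row p) (removals k u) _)) ⟩
    Δ v (λ p q → d k (λ u′ → row p * d k (rest p u′) q) u)
      ≈⟨ Δ-∑ℂ v (removals k u) _ ⟩
    d k (λ u′ → Δ v (λ p q → row p * d k (rest p u′) q)) u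
      ≈⟨ d-cong k (λ u′ → ≈-trans (Δ-cong v (λ p q → ∑ℂ-* (row p) (removals k q) _)) (≈-sym (Δ-dʳ k v _))) u ⟩
    d k (λ u′ → d k (star f (a ∷ u′)) v) u ∎

-- The scalar product of the commutative image with the power sum p_μ, which counts
-- the ways to distribute the parts of μ over bins of the given sizes.
χ : Word → Word → ℂ
χ []      w = δ (w ≟ʷ [])
χ (a ∷ μ) w = d a (χ μ) w

-- Each `d a` is multiplicative by `star-d`, hence so is their composite. The base case is the
-- constant term, which no matrix with a row of positive sum can reach.
χ-star : ∀ μ u v → star (χ μ) u v ≈ χ μ u * χ μ v
χ-star []      []      []      = ≈-sym (*-identityˡ _)
χ-star []      []      (_ ∷ _) = ≈-sym (zeroʳ _)
χ-star []      (a ∷ u) v       = ≈-trans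
  (star-short (χ []) (a ∷ u) v λ { (b ∷ w) _ → ≈-refl }) (≈-sym (zeroˡ _))
χ-star (a ∷ μ) u v = begin
  star (d a (χ μ)) u v
    ≈⟨ star-d a (χ μ) u v ⟩
  d a (λ u′ → d a (star (χ μ) u′) v) u
    ≈⟨ d-cong a (λ u′ → d-cong a (χ-star μ u′) v) u ⟩
  d a (λ u′ → d a (λ v′ → χ μ u′ * χ μ v′) v) u
    ≈⟨ d-cong a (λ u′ → ∑ℂ-* (χ μ u′) (removals a v) (χ μ)) u ⟨
  d a (λ u′ → χ μ u′ * d a (χ μ) v) u
    ≈⟨ ∑ℂ-*ʳ (d a (χ μ) v) (removals a u) (χ μ) ⟨
  d a (χ μ) u * d a (χ μ) v ∎
  where open ≈-Reasoning

-- The matrices that survive have exactly one nonzero entry in each row. All of them have reading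
-- word `u`, and each assigns the parts of `u` to columns, so there are `χ u v` of them.
star-leading : ∀ f u v → (∀ w → length u ℕ.< length w → f w ≈ 0#) → star f u v ≈ χ u v * f u
star-leading f []      []      f≈0 = ≈-sym (*-identityˡ _)
star-leading f []      (_ ∷ _) f≈0 = ≈-sym (zeroˡ _)
star-leading f (a ∷ u) v       f≈0 = begin
  star f (a ∷ u) v
    ≈⟨ Δ-d a v _ (λ b c p q _ → star-short _ u q (λ w u≤w → f≈0 (b ∷ c ∷ p ++ w)
         (s≤s (s≤s (ℕ.≤-trans u≤w (ℕ.≤-trans (ℕ.m≤n+m (length w) (length p)) (ℕ.≤-reflexive (sym (List.length-++ p))))))))) ⟩
  d a (star (f ∘ (a ∷_)) u) v
    ≈⟨ d-cong a (λ v′ → star-leading _ u v′ (λ w u<w → f≈0 (a ∷ w) (s≤s u<w))) v ⟩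
  d a (λ v′ → χ u v′ * f (a ∷ u)) v
    ≈⟨ ∑ℂ-*ʳ (f (a ∷ u)) (removals a v) (χ u) ⟨
  χ (a ∷ u) v * f (a ∷ u) ∎
  where open ≈-Reasoning

-- The enumeration of matrices compared with the recursion `star`

letters : List ℕ → Word
letters = concatMap letter

letters-++ : ∀ ns ms → letters (ns ++ ms) ≡ letters ns ++ letters ms
letters-++ = List.concatMap-++ letter

weight-letters : ∀ ns → weight (letters ns) ≡ sum ns
weight-letters []       = refl
weight-letters (n ∷ ns) = trans (weight-++ (letter n) (letters ns)) (cong₂ ℕ._+_ (weight-letter n) (weight-letters ns))

letters-[] : ∀ ns → letters ns ≡ [] → replicate (length ns) 0 ≡ ns
letters-[] []           _  = refl
letters-[] (zero ∷ ns)  eq = cong (0 ∷_) (letters-[] ns eq)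

letters-replicate : ∀ n → letters (replicate n 0) ≡ []
letters-replicate zero    = refl
letters-replicate (suc n) = letters-replicate n

letters-composition : ∀ u → letters (composition u) ≡ u
letters-composition []      = refl
letters-composition (a ∷ u) = cong (a ∷_) (letters-composition u)

∫-S : ∀ n (f : Word → ℂ) → ∫ (S n) f ≈ f (letter n)
∫-S zero    f = ∫-single [] f
∫-S (suc a) f = ∫-single (a ∷ []) f

∫-S^ : ∀ M (f : Word → ℂ) → ∫ (S^ M) f ≈ f (letters (concat M))
∫-S^ M = go (concat M)
  where
  go : ∀ ns (f : Word → ℂ) → ∫ (foldr _·_ 𝟙 (map S ns)) f ≈ f (letters ns)
  go []       f = ∫-single [] f
  go (n ∷ ns) f = ≈-trans (∫-· (S n) _ f) (≈-trans (∫-S n _) (go ns _))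

-- The unshufflings before zeros are dropped: `r` is a candidate for the first row and `K` holds the
-- column sums left for the other rows. Positions are kept because columns must be matched entry by
-- entry.
columnSplits : List ℕ → List (List ℕ × List ℕ)
columnSplits []      = ([] , []) ∷ []
columnSplits (n ∷ J) = cartesianProductWith (λ (i , j) (r , K) → i ∷ r , j ∷ K) (splits n) (columnSplits J)

columnSplits-length : ∀ J → All (λ (r , K) → length r ≡ length J × length K ≡ length J) (columnSplits J)
columnSplits-length []      = (refl , refl) ∷ []
columnSplits-length (n ∷ J) = All.cartesianProductWith⁺ (setoid _) (setoid _) _ (splits n) (columnSplits J)
  λ _ rK∈ → let r≡ , K≡ = All.lookup (columnSplits-length J) rK∈ in cong suc r≡ , cong suc K≡

columnSplits-Δ : ∀ J (F : Word → Word → ℂ) → ∑ℂ (columnSplits J) (λ (r , K) → F (letters r) (letters K)) ≈ Δ (letters J) F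
columnSplits-Δ []      F = ≈-refl
columnSplits-Δ (n ∷ J) F = begin
  ∑ℂ (columnSplits (n ∷ J)) (λ (r , K) → F (letters r) (letters K))
    ≈⟨ ∑ℂ-cartesianProductWith _ (splits n) (columnSplits J) _ ⟩
  conv n (λ i j → ∑ℂ (columnSplits J) (λ (r , K) → F (letter i ++ letters r) (letter j ++ letters K)))
    ≈⟨ conv-cong n (λ i j → columnSplits-Δ J (λ p q → F (letter i ++ p) (letter j ++ q))) ⟩
  conv n (λ i j → Δ (letters J) (λ p q → F (letter i ++ p) (letter j ++ q)))
    ≈⟨ Δ-letter n (letters J) F ⟨
  Δ (letters (n ∷ J)) F ∎
  where open ≈-Reasoning

_≟ˡ_ : (I J : List ℕ) → Dec (I ≡ J)
_≟ˡ_ = List.≡-dec ℕ._≟_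

-- At most one split of `J` has the components `x` and `c`, and it exists exactly when they add up
-- to `J`.
δ-columnSplits : ∀ x c J → length x ≡ length J → length c ≡ length J →
  δ (zipWith ℕ._+_ x c ≟ˡ J) ≈ ∑ℂ (columnSplits J) (λ (r , K) → δ (r ≟ˡ x) * δ (c ≟ˡ K))
δ-columnSplits []       []       []      _  _  = ≈-sym (≈-trans (+-identityʳ _) (*-identityˡ _))
δ-columnSplits (x₀ ∷ x) (c₀ ∷ c) (n ∷ J) x≡ c≡ = begin
  δ (zipWith ℕ._+_ (x₀ ∷ x) (c₀ ∷ c) ≟ˡ (n ∷ J))
    -- The equation for the first column is shifted by one, because both `δ-chop` and `conv-δ` then
    -- lead to the same sum over `chop x₀ (suc n)`.
    ≈⟨ δ-× (zipWith ℕ._+_ (x₀ ∷ x) (c₀ ∷ c) ≟ˡ (n ∷ J)) (c₀ ℕ.+ suc x₀ ℕ.≟ suc n) (zipWith ℕ._+_ x c ≟ˡ J)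
         (λ eq → trans (flip-suc x₀ c₀) (cong suc (List.∷-injectiveˡ eq))) List.∷-injectiveʳ
         (λ eq eqs → cong₂ _∷_ (ℕ.suc-injective (trans (sym (flip-suc x₀ c₀)) eq)) eqs) ⟩
  δ (c₀ ℕ.+ suc x₀ ℕ.≟ suc n) * δ (zipWith ℕ._+_ x c ≟ˡ J)
    ≈⟨ *-cong (≈-trans (δ-chop c₀ x₀ (suc n)) (≈-sym (conv-δ x₀ n (λ i j → δ (c₀ ℕ.≟ j)))))
              (δ-columnSplits x c J (ℕ.suc-injective x≡) (ℕ.suc-injective c≡)) ⟩
  conv n (λ i j → δ (i ℕ.≟ x₀) * δ (c₀ ℕ.≟ j)) * ∑ℂ (columnSplits J) (λ (r , K) → δ (r ≟ˡ x) * δ (c ≟ˡ K))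
    ≈⟨ ∑ℂ-*ʳ _ (splits n) _ ⟩
  conv n (λ i j → δ (i ℕ.≟ x₀) * δ (c₀ ℕ.≟ j) * ∑ℂ (columnSplits J) (λ (r , K) → δ (r ≟ˡ x) * δ (c ≟ˡ K)))
    ≈⟨ conv-cong n (λ i j → ≈-trans (∑ℂ-* _ (columnSplits J) _) (∑ℂ-cong (columnSplits J) (regroup i j))) ⟩
  conv n (λ i j → ∑ℂ (columnSplits J) (λ (r , K) → δ ((i ∷ r) ≟ˡ (x₀ ∷ x)) * δ ((c₀ ∷ c) ≟ˡ (j ∷ K))))
    ≈⟨ ∑ℂ-cartesianProductWith _ (splits n) (columnSplits J) _ ⟨
  ∑ℂ (columnSplits (n ∷ J)) (λ (r , K) → δ (r ≟ˡ (x₀ ∷ x)) * δ ((c₀ ∷ c) ≟ˡ K)) ∎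
  where
  open ≈-Reasoning
  flip-suc : ∀ x c → c ℕ.+ suc x ≡ suc (x ℕ.+ c)
  flip-suc x c = trans (ℕ.+-suc c x) (cong suc (ℕ.+-comm c x))
  δ-∷ : ∀ x y (xs ys : List ℕ) → δ ((x ∷ xs) ≟ˡ (y ∷ ys)) ≈ δ (x ℕ.≟ y) * δ (xs ≟ˡ ys)
  δ-∷ x y xs ys = δ-× ((x ∷ xs) ≟ˡ (y ∷ ys)) (x ℕ.≟ y) (xs ≟ˡ ys) List.∷-injectiveˡ List.∷-injectiveʳ (cong₂ _∷_)
  regroup : ∀ i j ((r , K) : List ℕ × List ℕ) →
    (δ (i ℕ.≟ x₀) * δ (c₀ ℕ.≟ j)) * (δ (r ≟ˡ x) * δ (c ≟ˡ K)) ≈ δ ((i ∷ r) ≟ˡ (x₀ ∷ x)) * δ ((c₀ ∷ c) ≟ˡ (j ∷ K))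
  regroup i j (r , K) = ≈-trans (*-interchange _ _ _ _) (≈-sym (*-cong (δ-∷ i x₀ r x) (δ-∷ c₀ j c K)))
    where
    open import Algebra.Properties.CommutativeSemigroup (CommutativeRing.*-commutativeSemigroup ℂ-commutativeRing)
      renaming (interchange to *-interchange)

listsOver-All : {P : E → Set ℓᵖ} {as : List E} → All P as → ∀ n → All (λ xs → length xs ≡ n × All P xs) (listsOver as n)
listsOver-All all zero    = (refl , []) ∷ []
listsOver-All all (suc n) = All.cartesianProductWith⁺ (setoid _) (setoid _) _∷_ _ (listsOver _ n)
  λ a∈ xs∈ → let len , ps = All.lookup (listsOver-All all n) xs∈ in cong suc len , All.lookup all a∈ ∷ ps

∈-listsOver : {as xs : List E} → All (_∈ as) xs → xs ∈ listsOver as (length xs)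
∈-listsOver []         = here refl
∈-listsOver (x∈ ∷ xs∈) = ∈-cartesianProductWith⁺ _∷_ x∈ (∈-listsOver xs∈)

listsOver-Unique : {as : List E} → Unique as → ∀ n → Unique (listsOver as n)
listsOver-Unique as! zero    = [] ∷ []
listsOver-Unique as! (suc n) = Unique.cartesianProductWith⁺ _∷_ List.∷-injective as! (listsOver-Unique as! n)

columnSums-length : ∀ s {M} → All (λ x → length x ≡ s) M → length (columnSums s M) ≡ s
columnSums-length s []       = List.length-replicate s
columnSums-length s {x ∷ M} (x≡ ∷ M≡) = begin
  length (zipWith ℕ._+_ x (columnSums s M))  ≡⟨ List.length-zipWith ℕ._+_ x (columnSums s M) ⟩
  length x ℕ.⊓ length (columnSums s M)  ≡⟨ cong₂ ℕ._⊓_ x≡ (columnSums-length s M≡) ⟩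
  s ℕ.⊓ s  ≡⟨ ℕ.⊓-idem s ⟩
  s ∎
  where open ≡-Reasoning

entries≤sum : ∀ xs → All (ℕ._≤ sum xs) xs
entries≤sum []       = []
entries≤sum (x ∷ xs) = ℕ.m≤m+n x (sum xs) ∷ All.map (λ y≤ → ℕ.≤-trans y≤ (ℕ.m≤n+m (sum xs) x)) (entries≤sum xs)

module _ (N s : ℕ) where

  rows : List (List ℕ)
  rows = listsOver (upTo (suc N)) s

  has-margins : (I J : List ℕ) (M : Matrix) → Dec (rowSums M ≡ I × columnSums s M ≡ J)
  has-margins I J M = (rowSums M ≟ˡ I) ×-dec (columnSums s M ≟ˡ J)

  boundedMatrices : List ℕ → List ℕ → List Matrix
  boundedMatrices I J = filter (has-margins I J) (listsOver rows (length I))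

  -- The bound on the entries loses nothing: if `r` has sum `suc a`, its entries are at most `N` and
  -- it occurs in `rows`. For any other sum both sides are 0.
  rows-pick : ∀ a r (H : List ℕ → ℂ) → suc a ℕ.≤ N → length r ≡ s →
    ∑ℂ rows (λ x → δ (r ≟ˡ x) * (δ (sum x ℕ.≟ suc a) * H x)) ≈ δ (sum r ℕ.≟ suc a) * H r
  rows-pick a r H a<N r≡s = by-cases (sum r ℕ.≟ suc a)
    where
    by-cases : Dec (sum r ≡ suc a) →
      ∑ℂ rows (λ x → δ (r ≟ˡ x) * (δ (sum x ℕ.≟ suc a) * H x)) ≈ δ (sum r ℕ.≟ suc a) * H r
    by-cases (yes Σr≡a) = ∑ℂ-pick _≟ˡ_ _ (listsOver-Unique (Unique.upTo⁺ (suc N)) s)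
      (subst (λ n → r ∈ listsOver (upTo (suc N)) n) r≡s (∈-listsOver
        (All.map (λ x≤ → ∈-upTo⁺ (s≤s (ℕ.≤-trans x≤ (subst (ℕ._≤ N) (sym Σr≡a) a<N)))) (entries≤sum r))))
    by-cases (no Σr≢a) = ≈-trans
      (∑ℂ-≈0 rows (λ x → ≈-trans
        (δ-cong (r ≟ˡ x) (λ { refl → δ-no-* (sum r ℕ.≟ suc a) Σr≢a })) (zeroʳ _)))
      (≈-sym (δ-no-* (sum r ℕ.≟ suc a) Σr≢a))

  -- Induction on the rows. The bound `N` and the number `s` of columns stay fixed while rows are
  -- removed and `weight u` shrinks, so the hypothesis has to be an inequality.
  boundedMatrices-star : ∀ u J → length J ≡ s → weight u ℕ.≤ N → (f : Word → ℂ) →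
    ∑ℂ (boundedMatrices (composition u) J) (λ M → f (letters (concat M))) ≈ star f u (letters J)
  boundedMatrices-star [] J J≡s _ f = ≈-trans (∑ℂ-filter (has-margins [] J) ([] ∷ []) _)
    (≈-trans (+-identityʳ _) (corner (letters J) refl))
    where
    corner : ∀ v → letters J ≡ v → δ (has-margins [] J []) * f [] ≈ star f [] v
    corner []      eq = δ-yes-* (has-margins [] J []) (refl , subst (λ n → replicate n 0 ≡ J) J≡s (letters-[] J eq))
    corner (b ∷ v) eq = δ-no-* (has-margins [] J []) λ (_ , 0≡J) → nonempty (trans (sym eq) (trans (cong letters (sym 0≡J)) (letters-replicate s)))
      where
      nonempty : b ∷ v ≢ []
      nonempty ()
  boundedMatrices-star (a ∷ u) J refl a+u≤N f = begin
    ∑ℂ (boundedMatrices (composition (a ∷ u)) J) g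
      ≈⟨ ∑ℂ-filter (has-margins (composition (a ∷ u)) J) (listsOver rows (suc (length (composition u)))) g ⟩
    ∑ℂ (listsOver rows (suc (length (composition u)))) (λ M → δ (has-margins (composition (a ∷ u)) J M) * g M)
      ≈⟨ ∑ℂ-cartesianProductWith _∷_ rows L _ ⟩
    ∑ℂ rows (λ x → ∑ℂ L (λ M → δ (has-margins (composition (a ∷ u)) J (x ∷ M)) * g (x ∷ M)))
      -- The column condition on `x ∷ M` is traded for a sum over the splits `(r , K)` of `J` with
      -- `r = x`. Once the sums are exchanged, `rows-pick` eliminates `x`, and `M` is left with the
      -- column sums `K`.
      ≈⟨ ∑ℂ-cong-All (All.map (λ {x} (x≡s , _) → ∑ℂ-cong-All (All.map (λ {M} (_ , M≡s) → *-congʳ (margins x M x≡s (All.map proj₁ M≡s))) L-lengths)) rows-lengths) ⟩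
    ∑ℂ rows (λ x → ∑ℂ L (λ M → (δ (sum x ℕ.≟ suc a) * (δ (rowSums M ≟ˡ composition u) *
      ∑ℂ Js (λ (r , K) → δ (r ≟ˡ x) * δ (columnSums s M ≟ˡ K)))) * g (x ∷ M)))
      ≈⟨ ∑ℂ-cong rows (λ x → ∑ℂ-cong L (λ M → expand x M)) ⟩
    ∑ℂ rows (λ x → ∑ℂ L (λ M → ∑ℂ Js (λ (r , K) → δ (r ≟ˡ x) * (δ (sum x ℕ.≟ suc a) *
      (δ (has-margins (composition u) K M) * g (x ∷ M))))))
      ≈⟨ ∑ℂ-cong rows (λ x → ∑ℂ-swap L Js _) ⟩
    ∑ℂ rows (λ x → ∑ℂ Js (λ (r , K) → ∑ℂ L (λ M → δ (r ≟ˡ x) * (δ (sum x ℕ.≟ suc a) *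
      (δ (has-margins (composition u) K M) * g (x ∷ M))))))
      ≈⟨ ∑ℂ-swap rows Js _ ⟩
    ∑ℂ Js (λ (r , K) → ∑ℂ rows (λ x → ∑ℂ L (λ M → δ (r ≟ˡ x) * (δ (sum x ℕ.≟ suc a) *
      (δ (has-margins (composition u) K M) * g (x ∷ M))))))
      ≈⟨ ∑ℂ-cong Js (λ (r , K) → ∑ℂ-cong rows (λ x → ≈-trans
           (*-congˡ (∑ℂ-* _ L _)) (∑ℂ-* _ L _))) ⟨
    ∑ℂ Js (λ (r , K) → ∑ℂ rows (λ x → δ (r ≟ˡ x) * (δ (sum x ℕ.≟ suc a) *
      ∑ℂ L (λ M → δ (has-margins (composition u) K M) * g (x ∷ M)))))
      ≈⟨ ∑ℂ-cong-All (All.map (λ {(r , K)} (r≡s , K≡s) → ≈-trans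
           (rows-pick a r _ a<N r≡s) (*-congˡ (induct r K K≡s))) (columnSplits-length J)) ⟩
    ∑ℂ Js (λ (r , K) → δ (sum r ℕ.≟ suc a) * star (f ∘ (letters r ++_)) u (letters K))
      ≈⟨ ∑ℂ-cong Js (λ (r , K) → *-congʳ (≈-reflexive (cong (λ n → δ (n ℕ.≟ suc a)) (sym (weight-letters r))))) ⟩
    ∑ℂ Js (λ (r , K) → δ (weight (letters r) ℕ.≟ suc a) * star (f ∘ (letters r ++_)) u (letters K))
      ≈⟨ columnSplits-Δ J (λ p q → δ (weight p ℕ.≟ suc a) * star (f ∘ (p ++_)) u q) ⟩
    star f (a ∷ u) (letters J) ∎
    where
    open ≈-Reasoning
    Js : List (List ℕ × List ℕ)
    Js = columnSplits J
    g : Matrix → ℂ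
    g M = f (letters (concat M))
    L : List Matrix
    L = listsOver rows (length (composition u))
    a<N : suc a ℕ.≤ N
    a<N = ℕ.≤-trans (ℕ.m≤m+n (suc a) (weight u)) a+u≤N
    rows-lengths : All (λ x → length x ≡ s × All (_∈ upTo (suc N)) x) rows
    rows-lengths = listsOver-All (All.tabulate id) s
    L-lengths : All (λ M → length M ≡ length (composition u) × All (λ x → length x ≡ s × All (_∈ upTo (suc N)) x) M) L
    L-lengths = listsOver-All rows-lengths (length (composition u))
    margins : ∀ x M → length x ≡ s → All (λ x → length x ≡ s) M →
      δ (has-margins (composition (a ∷ u)) J (x ∷ M)) ≈ δ (sum x ℕ.≟ suc a) * (δ (rowSums M ≟ˡ composition u) *
        ∑ℂ Js (λ (r , K) → δ (r ≟ˡ x) * δ (columnSums s M ≟ˡ K)))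
    margins x M x≡s M≡s = begin
      δ (has-margins (composition (a ∷ u)) J (x ∷ M))
        ≈⟨ δ-× (has-margins (composition (a ∷ u)) J (x ∷ M)) (sum x ℕ.≟ suc a) (has-margins′)
             (List.∷-injectiveˡ ∘ proj₁) (λ (rs , cs) → List.∷-injectiveʳ rs , cs) (λ r (rs , cs) → cong₂ _∷_ r rs , cs) ⟩
      δ (sum x ℕ.≟ suc a) * δ has-margins′
        ≈⟨ *-congˡ (δ-× has-margins′ (rowSums M ≟ˡ composition u) (columnSums s (x ∷ M) ≟ˡ J) proj₁ proj₂ _,_) ⟩
      δ (sum x ℕ.≟ suc a) * (δ (rowSums M ≟ˡ composition u) * δ (columnSums s (x ∷ M) ≟ˡ J))
        ≈⟨ *-congˡ (*-congˡ (δ-columnSplits x (columnSums s M) J x≡s (columnSums-length s M≡s))) ⟩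
      δ (sum x ℕ.≟ suc a) * (δ (rowSums M ≟ˡ composition u) *
        ∑ℂ Js (λ (r , K) → δ (r ≟ˡ x) * δ (columnSums s M ≟ˡ K))) ∎
      where
      has-margins′ : Dec (rowSums M ≡ composition u × columnSums s (x ∷ M) ≡ J)
      has-margins′ = (rowSums M ≟ˡ composition u) ×-dec (columnSums s (x ∷ M) ≟ˡ J)
    expand : ∀ x M →
      (δ (sum x ℕ.≟ suc a) * (δ (rowSums M ≟ˡ composition u) *
        ∑ℂ Js (λ (r , K) → δ (r ≟ˡ x) * δ (columnSums s M ≟ˡ K)))) * g (x ∷ M) ≈
      ∑ℂ Js (λ (r , K) → δ (r ≟ˡ x) * (δ (sum x ℕ.≟ suc a) *
        (δ (has-margins (composition u) K M) * g (x ∷ M))))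
    expand x M = begin
      (δ (sum x ℕ.≟ suc a) * (δ (rowSums M ≟ˡ composition u) *
        ∑ℂ Js (λ (r , K) → δ (r ≟ˡ x) * δ (columnSums s M ≟ˡ K)))) * g (x ∷ M)
        ≈⟨ ≈-trans (*-congʳ (≈-trans (*-congˡ (∑ℂ-* _ Js _)) (∑ℂ-* _ Js _))) (∑ℂ-*ʳ _ Js _) ⟩
      ∑ℂ Js (λ (r , K) → (δ (sum x ℕ.≟ suc a) * (δ (rowSums M ≟ˡ composition u) *
        (δ (r ≟ˡ x) * δ (columnSums s M ≟ˡ K)))) * g (x ∷ M))
        ≈⟨ ∑ℂ-cong Js (λ (r , K) → ≈-trans
             (rearrange (δ (sum x ℕ.≟ suc a)) (δ (rowSums M ≟ˡ composition u)) (δ (r ≟ˡ x)) (δ (columnSums s M ≟ˡ K)) (g (x ∷ M)))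
             (*-congˡ (*-congˡ (*-congʳ (≈-sym (δ-× (has-margins (composition u) K M) (rowSums M ≟ˡ composition u) (columnSums s M ≟ˡ K) proj₁ proj₂ _,_)))))) ⟩
      ∑ℂ Js (λ (r , K) → δ (r ≟ˡ x) * (δ (sum x ℕ.≟ suc a) *
        (δ (has-margins (composition u) K M) * g (x ∷ M)))) ∎
      where
      rearrange : ∀ a b c d e → (a * (b * (c * d))) * e ≈ c * (a * ((b * d) * e))
      rearrange = solve 5 (λ a b c d e → (a :* (b :* (c :* d))) :* e := c :* (a :* ((b :* d) :* e))) ≈-refl
        where open ℂ-Solver
    induct : ∀ r K → length K ≡ s →
      ∑ℂ L (λ M → δ (has-margins (composition u) K M) * g (r ∷ M)) ≈ star (f ∘ (letters r ++_)) u (letters K)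
    induct r K K≡s = begin
      ∑ℂ L (λ M → δ (has-margins (composition u) K M) * g (r ∷ M))
        ≈⟨ ∑ℂ-filter (has-margins (composition u) K) L (λ M → g (r ∷ M)) ⟨
      ∑ℂ (boundedMatrices (composition u) K) (λ M → g (r ∷ M))
        ≈⟨ ∑ℂ-cong (boundedMatrices (composition u) K) (λ M → ≈-reflexive (cong f (letters-++ r (concat M)))) ⟩
      ∑ℂ (boundedMatrices (composition u) K) (λ M → f (letters r ++ letters (concat M)))
        ≈⟨ boundedMatrices-star u K K≡s (ℕ.≤-trans (ℕ.m≤n+m (weight u) (suc a)) a+u≤N) _ ⟩
      star (f ∘ (letters r ++_)) u (letters K) ∎

matrices-star : ∀ u v (f : Word → ℂ) →
  ∑ℂ (matrices (composition u) (composition v)) (λ M → f (letters (concat M))) ≈ star f u v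
matrices-star u v f = ≈-trans
  (boundedMatrices-star (weight u) (length (composition v)) u (composition v) refl ℕ.≤-refl f)
  (≈-reflexive (cong (star f u) (letters-composition v)))

∫-⊛ : ∀ X Y (f : Word → ℂ) → ∫ (X ⊛ Y) f ≈ ∫ X (λ u → ∫ Y (star f u))
∫-⊛ X Y f = begin
  ∫ (X ⊛ Y) f
    ≈⟨ ∫-∑ X _ f ⟩
  ∑ℂ X (λ (c , u) → ∫ (∑ Y λ (d , v) → (c * d) • ∑ (matrices (composition u) (composition v)) S^) f)
    ≈⟨ ∑ℂ-cong X (λ (c , u) → ≈-trans (∫-∑ Y _ f) (≈-trans (∑ℂ-cong Y (λ (d , v) → term c d u v)) (≈-sym (∑ℂ-* c Y _)))) ⟩
  ∫ X (λ u → ∫ Y (star f u)) ∎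
  where
  open ≈-Reasoning
  term : ∀ c d u v → ∫ ((c * d) • ∑ (matrices (composition u) (composition v)) S^) f ≈ c * (d * star f u v)
  term c d u v = begin
    ∫ ((c * d) • ∑ (matrices (composition u) (composition v)) S^) f
      ≈⟨ ∫-• (c * d) (∑ (matrices (composition u) (composition v)) S^) f ⟩
    (c * d) * ∫ (∑ (matrices (composition u) (composition v)) S^) f
      ≈⟨ *-congˡ (≈-trans (∫-∑ (matrices (composition u) (composition v)) S^ f)
           (∑ℂ-cong (matrices (composition u) (composition v)) (λ M → ∫-S^ M f))) ⟩
    (c * d) * ∑ℂ (matrices (composition u) (composition v)) (λ M → f (letters (concat M)))
      ≈⟨ *-congˡ (matrices-star u v f) ⟩
    (c * d) * star f u v
      ≈⟨ *-assoc c d _ ⟩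
    c * (d * star f u v) ∎

-- Exponential series

rational-cong : ∀ {p q} → p ≡ q → rational p ≈ rational q
rational-cong p≡q = ≈-reflexive (cong rational p≡q)

rational-+ : ∀ p q → rational (p ℚ.+ q) ≈ rational p + rational q
rational-+ p q = ≈-pointwise (λ _ → refl) (λ _ → refl)

rational-* : ∀ p q → rational (p ℚ.* q) ≈ rational p * rational q
rational-* p q = ≈-pointwise
  (λ _ → sym (trans (cong (λ z → p ℚ.* q ℚ.- z) (ℚ.*-zeroˡ 0ℚ)) (ℚ.+-identityʳ (p ℚ.* q))))
  (λ _ → sym (cong₂ ℚ._+_ (ℚ.*-zeroʳ p) (ℚ.*-zeroˡ q)))

-- A fraction formed with `ℚ./` is the image under `fromℚᵘ` of an unnormalised one, for which sums
-- and products compute without reduction to lowest terms.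
fromℚᵘ-+ : ∀ x y → ℚ.fromℚᵘ (x ℚᵘ.+ y) ≡ ℚ.fromℚᵘ x ℚ.+ ℚ.fromℚᵘ y
fromℚᵘ-+ x y = ℚ.toℚᵘ-injective (ℚᵘ.≃-trans (ℚ.toℚᵘ-fromℚᵘ (x ℚᵘ.+ y)) (ℚᵘ.≃-sym (ℚᵘ.≃-trans
  (ℚ.toℚᵘ-homo-+ (ℚ.fromℚᵘ x) (ℚ.fromℚᵘ y)) (ℚᵘ.+-cong (ℚ.toℚᵘ-fromℚᵘ x) (ℚ.toℚᵘ-fromℚᵘ y)))))

fromℚᵘ-* : ∀ x y → ℚ.fromℚᵘ (x ℚᵘ.* y) ≡ ℚ.fromℚᵘ x ℚ.* ℚ.fromℚᵘ y
fromℚᵘ-* x y = ℚ.toℚᵘ-injective (ℚᵘ.≃-trans (ℚ.toℚᵘ-fromℚᵘ (x ℚᵘ.* y)) (ℚᵘ.≃-sym (ℚᵘ.≃-trans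
  (ℚ.toℚᵘ-homo-* (ℚ.fromℚᵘ x) (ℚ.fromℚᵘ y)) (ℚᵘ.*-cong (ℚ.toℚᵘ-fromℚᵘ x) (ℚ.toℚᵘ-fromℚᵘ y)))))

nat : ℕ → ℂ
nat zero    = 0#
nat (suc n) = 1# + nat n

nat-+ : ∀ m n → nat (m ℕ.+ n) ≈ nat m + nat n
nat-+ zero    n = ≈-sym (+-identityˡ _)
nat-+ (suc m) n = ≈-trans (+-congˡ (nat-+ m n)) (≈-sym (+-assoc _ _ _))

nat-* : ∀ m n → nat (m ℕ.* n) ≈ nat m * nat n
nat-* zero    n = ≈-sym (zeroˡ _)
nat-* (suc m) n = ≈-trans (nat-+ n (m ℕ.* n)) (≈-trans
  (+-cong (≈-sym (*-identityˡ _)) (nat-* m n)) (≈-sym (distribʳ _ _ _)))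

nat-rational : ∀ n → nat n ≈ rational ((ℤ.+ n) ℚ./ 1)
nat-rational zero    = ≈-refl
nat-rational (suc n) = ≈-trans (+-congˡ (nat-rational n)) (≈-trans (≈-sym (rational-+ 1ℚ _))
  (rational-cong (trans (sym (fromℚᵘ-+ (mkℚᵘ (ℤ.+ 1) 0) (mkℚᵘ (ℤ.+ n) 0)))
    (cong (λ z → (ℤ.+ 1 ℤ.+ z) ℚ./ 1) (ℤ.*-identityʳ (ℤ.+ n))))))

nat-inverse : ∀ n .{{_ : ℕ.NonZero n}} → rational ((ℤ.+ 1) ℚ./ n) * nat n ≈ 1#
nat-inverse (suc m) = begin
  rational ((ℤ.+ 1) ℚ./ suc m) * nat (suc m)  ≈⟨ *-congˡ (nat-rational (suc m)) ⟩
  rational ((ℤ.+ 1) ℚ./ suc m) * rational ((ℤ.+ suc m) ℚ./ 1)  ≈⟨ rational-* _ _ ⟨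
  rational ((ℤ.+ 1) ℚ./ suc m ℚ.* ((ℤ.+ suc m) ℚ./ 1))  ≈⟨ rational-cong cancel ⟩
  1# ∎
  where
  open ≈-Reasoning
  cancel : (ℤ.+ 1) ℚ./ suc m ℚ.* ((ℤ.+ suc m) ℚ./ 1) ≡ 1ℚ
  cancel = trans (sym (fromℚᵘ-* (mkℚᵘ (ℤ.+ 1) m) (mkℚᵘ (ℤ.+ suc m) 0)))
    (ℚ.fromℚᵘ-cong {mkℚᵘ (ℤ.+ 1) m ℚᵘ.* mkℚᵘ (ℤ.+ suc m) 0} {mkℚᵘ (ℤ.+ 1) 0} (*≡* (cong (λ n → ℤ.+ suc n)
      (trans (ℕ.*-identityʳ (m ℕ.+ 0)) (sym (trans (ℕ.+-identityʳ _) (trans (ℕ.*-identityʳ m) (sym (ℕ.+-identityʳ m)))))))))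

nat-cancel : ∀ n {x y} → nat (suc n) * x ≈ nat (suc n) * y → x ≈ y
nat-cancel n {x} {y} eq = ≈-trans (≈-sym (divide x)) (≈-trans (*-congˡ eq) (divide y))
  where
  divide : ∀ z → rational ((ℤ.+ 1) ℚ./ suc n) * (nat (suc n) * z) ≈ z
  divide z = ≈-trans (≈-sym (*-assoc _ _ _)) (≈-trans (*-congʳ (nat-inverse (suc n))) (*-identityˡ z))

1/!-suc : ∀ i → nat (suc i) * 1/ suc i ! ≈ 1/ i !
1/!-suc i = begin
  nat (suc i) * 1/ suc i !
    ≈⟨ *-identityʳ _ ⟨
  nat (suc i) * 1/ suc i ! * 1#
    ≈⟨ *-congˡ (nat-inverse (i !) {{i ℕ.!≢0}}) ⟨
  nat (suc i) * 1/ suc i ! * (1/ i ! * nat (i !))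
    ≈⟨ rearrange (nat (suc i)) (1/ suc i !) (1/ i !) (nat (i !)) ⟩
  1/ suc i ! * (nat (suc i) * nat (i !)) * 1/ i !
    ≈⟨ *-congʳ (*-congˡ (nat-* (suc i) (i !))) ⟨
  1/ suc i ! * nat (suc i !) * 1/ i !
    ≈⟨ *-congʳ (nat-inverse (suc i !) {{suc i ℕ.!≢0}}) ⟩
  1# * 1/ i !
    ≈⟨ *-identityˡ _ ⟩
  1/ i ! ∎
  where
  open ≈-Reasoning
  rearrange : ∀ a b c d → a * b * (c * d) ≈ b * (a * d) * c
  rearrange = solve 4 (λ a b c d → a :* b :* (c :* d) := b :* (a :* d) :* c) ≈-refl
    where open ℂ-Solver

-1^-suc : ∀ i → -1^ suc i ≈ - -1^ i
-1^-suc i = begin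
  rational ((ℤ.-1ℤ ℤ.* x) ℚ./ 1)  ≈⟨ rational-cong (fromℚᵘ-* (mkℚᵘ ℤ.-1ℤ 0) (mkℚᵘ x 0)) ⟩
  rational ((ℤ.-1ℤ ℚ./ 1) ℚ.* (x ℚ./ 1))  ≈⟨ rational-* _ _ ⟩
  rational (ℤ.-1ℤ ℚ./ 1) * rational (x ℚ./ 1)  ≈⟨ *-congʳ (≈-pointwise (λ _ → refl) (λ _ → refl)) ⟩
  - 1# * rational (x ℚ./ 1)  ≈⟨ -‿distribˡ-* 1# _ ⟨
  - (1# * rational (x ℚ./ 1))  ≈⟨ -‿cong (*-identityˡ _) ⟩
  - rational (x ℚ./ 1) ∎
  where
  open ≈-Reasoning
  x : ℤ.ℤ
  x = ℤ.-1ℤ ℤ.^ i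

-- The coefficients of e^(-t). All later arguments use only `ε-zero` and the differential equation
-- `ε-suc`.
ε : ℕ → ℂ
ε i = -1^ i * 1/ i !

ε-zero : ε 0 ≈ 1#
ε-zero = *-identityˡ _

ε-suc : ∀ i → nat (suc i) * ε (suc i) ≈ - ε i
ε-suc i = begin
  nat (suc i) * (-1^ suc i * 1/ suc i !)  ≈⟨ *-left-comm _ _ _ ⟩
  -1^ suc i * (nat (suc i) * 1/ suc i !)  ≈⟨ *-cong (-1^-suc i) (1/!-suc i) ⟩
  - -1^ i * 1/ i !  ≈⟨ -‿distribˡ-* _ _ ⟨
  - ε i ∎
  where open ≈-Reasoning

conv-head : ∀ n (F : ℕ → ℕ → ℂ) → (∀ i j → F (suc i) j ≈ 0#) → conv n F ≈ F 0 n
conv-head zero    F F≈0 = +-identityʳ _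
conv-head (suc n) F F≈0 = ≈-trans (conv-suc n F) (≈-trans (+-congˡ (conv-≈0 n F≈0)) (+-identityʳ _))

-- The product rule for formal power series in t: multiplying coefficient `n + 1` by `n + 1` gives
-- coefficient `n` of the derivative.
conv-leibniz : ∀ n (F : ℕ → ℕ → ℂ) → nat (suc n) * conv (suc n) F ≈
  conv n (λ i j → nat (suc i) * F (suc i) j) + conv n (λ i j → nat (suc j) * F i (suc j))
conv-leibniz n F = begin
  nat (suc n) * conv (suc n) F
    ≈⟨ conv-* (nat (suc n)) (suc n) F ⟩
  conv (suc n) (λ i j → nat (suc n) * F i j)
    ≈⟨ conv-cong-≡ (suc n) (λ i j eq → ≈-trans (*-congʳ (≈-trans (≈-reflexive (cong nat (sym eq))) (nat-+ i j))) (distribʳ _ _ _)) ⟩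
  conv (suc n) (λ i j → nat i * F i j + nat j * F i j)
    ≈⟨ conv-+ (suc n) _ _ ⟩
  conv (suc n) (λ i j → nat i * F i j) + conv (suc n) (λ i j → nat j * F i j)
    ≈⟨ +-cong (≈-trans (conv-suc n _) (≈-trans (+-congʳ (zeroˡ _)) (+-identityˡ _)))
              (≈-trans (conv-last n _) (≈-trans (+-congˡ (zeroˡ _)) (+-identityʳ _))) ⟩
  conv n (λ i j → nat (suc i) * F (suc i) j) + conv n (λ i j → nat (suc j) * F i (suc j)) ∎
  where open ≈-Reasoning

-- These are the higher coefficients of e^t e^(-t). The derivative of the product vanishes by the
-- product rule, and dividing by `n + 1` recovers the coefficient.
exp-inverse : ∀ n → conv (suc n) (λ i j → 1/ i ! * ε j) ≈ 0#
exp-inverse n = nat-cancel n (begin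
  nat (suc n) * conv (suc n) (λ i j → 1/ i ! * ε j)
    ≈⟨ conv-leibniz n _ ⟩
  conv n (λ i j → nat (suc i) * (1/ suc i ! * ε j)) + conv n (λ i j → nat (suc j) * (1/ i ! * ε (suc j)))
    ≈⟨ conv-+ n _ _ ⟨
  conv n (λ i j → nat (suc i) * (1/ suc i ! * ε j) + nat (suc j) * (1/ i ! * ε (suc j)))
    ≈⟨ conv-≈0 n (λ i j → begin
         nat (suc i) * (1/ suc i ! * ε j) + nat (suc j) * (1/ i ! * ε (suc j))
           ≈⟨ +-cong (≈-trans (≈-sym (*-assoc _ _ _)) (*-congʳ (1/!-suc i)))
                     (≈-trans (*-left-comm _ _ _) (*-congˡ (ε-suc j))) ⟩
         1/ i ! * ε j + 1/ i ! * - ε j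
           ≈⟨ distribˡ _ _ _ ⟨
         1/ i ! * (ε j + - ε j)
           ≈⟨ ≈-trans (*-congˡ (-‿inverseʳ _)) (zeroʳ _) ⟩
         0# ∎) ⟩
  0#
    ≈⟨ zeroʳ _ ⟨
  nat (suc n) * 0# ∎)
  where open ≈-Reasoning

∑ℂ-upTo : ∀ n (F : ℕ → ℕ → ℂ) → ∑ℂ (upTo (suc n)) (λ i → F i (n ∸ i)) ≈ conv n F
∑ℂ-upTo zero    F = ≈-refl
∑ℂ-upTo (suc n) F = begin
  ∑ℂ (upTo (suc (suc n))) (λ i → F i (suc n ∸ i))
    ≈⟨ +-congˡ (≈-reflexive (cong (λ is → ∑ℂ is (λ i → F i (suc n ∸ i))) (sym (List.map-upTo suc (suc n))))) ⟩
  F 0 (suc n) + ∑ℂ (map suc (upTo (suc n))) (λ i → F i (suc n ∸ i))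
    ≈⟨ +-congˡ (∑ℂ-map suc (upTo (suc n)) _) ⟩
  F 0 (suc n) + ∑ℂ (upTo (suc n)) (λ i → F (suc i) (n ∸ i))
    ≈⟨ +-congˡ (∑ℂ-upTo n (λ i j → F (suc i) j)) ⟩
  F 0 (suc n) + conv n (λ i j → F (suc i) j)
    ≈⟨ conv-suc n F ⟨
  conv (suc n) F ∎
  where open ≈-Reasoning

-- The morphism Φ : Sₙ ↦ S♯ₙ

ones : ℕ → Word
ones i = replicate i 0

ones-+ : ∀ i j w → ones i ++ ones j ++ w ≡ ones (i ℕ.+ j) ++ w
ones-+ zero    j w = refl
ones-+ (suc i) j w = cong (0 ∷_) (ones-+ i j w)

weight-ones : ∀ i → weight (ones i) ≡ i
weight-ones zero    = refl
weight-ones (suc i) = cong suc (weight-ones i)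

∫-S₁^ : ∀ i (f : Word → ℂ) → ∫ (S 1 ^ i) f ≈ f (ones i)
∫-S₁^ zero    f = ∫-single [] f
∫-S₁^ (suc i) f = ≈-trans (∫-· (S 1) (S 1 ^ i) f) (≈-trans (∫-S 1 (λ u → ∫ (S 1 ^ i) (f ∘ (u ++_)))) (∫-S₁^ i (f ∘ (0 ∷_))))

∫-S♯ : ∀ n (f : Word → ℂ) → ∫ (S♯ n) f ≈ conv n (λ i j → ε i * f (ones i ++ letter j))
∫-S♯ n f = begin
  ∫ (S♯ n) f
    ≈⟨ ∫-∑ (upTo (suc n)) (λ i → ε i • S 1 ^ i · S (n ∸ i)) f ⟩
  ∑ℂ (upTo (suc n)) (λ i → ∫ ((-1^ i * 1/ i !) • S 1 ^ i · S (n ∸ i)) f)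
    ≈⟨ ∑ℂ-cong (upTo (suc n)) (λ i → ≈-trans (∫-• (ε i) (S 1 ^ i · S (n ∸ i)) f) (*-congˡ
         (≈-trans (∫-· (S 1 ^ i) (S (n ∸ i)) f) (≈-trans (∫-S₁^ i _) (∫-S (n ∸ i) _))))) ⟩
  ∑ℂ (upTo (suc n)) (λ i → ε i * f (ones i ++ letter (n ∸ i)))
    ≈⟨ ∑ℂ-upTo n (λ i j → ε i * f (ones i ++ letter j)) ⟩
  conv n (λ i j → ε i * f (ones i ++ letter j)) ∎
  where open ≈-Reasoning

Φ : Word → Sym
Φ []      = 𝟙
Φ (a ∷ u) = S♯ (suc a) · Φ u

∫-Φ-[] : ∀ (f : Word → ℂ) → ∫ (Φ []) f ≈ f []
∫-Φ-[] = ∫-single []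

∫-Φ-∷ : ∀ a u (f : Word → ℂ) →
  ∫ (Φ (a ∷ u)) f ≈ conv (suc a) (λ i j → ε i * ∫ (Φ u) (λ w → f (ones i ++ letter j ++ w)))
∫-Φ-∷ a u f = ≈-trans (∫-· (S♯ (suc a)) (Φ u) f) (≈-trans (∫-S♯ (suc a) _)
  (conv-cong (suc a) (λ i j → *-congˡ (∫-cong (Φ u) (λ w → ≈-reflexive (cong f (List.++-assoc (ones i) (letter j) w)))))))

∫-Φ-letter : ∀ n u (f : Word → ℂ) →
  ∫ (Φ (letter n ++ u)) f ≈ conv n (λ i j → ε i * ∫ (Φ u) (λ w → f (ones i ++ letter j ++ w)))
∫-Φ-letter zero    u f = ≈-sym (≈-trans (+-identityʳ _) (≈-trans (*-congʳ ε-zero) (*-identityˡ _)))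
∫-Φ-letter (suc a) u f = ∫-Φ-∷ a u f

∫-Φ-++ : ∀ u v (f : Word → ℂ) → ∫ (Φ (u ++ v)) f ≈ ∫ (Φ u) (λ p → ∫ (Φ v) (λ q → f (p ++ q)))
∫-Φ-++ []      v f = ≈-sym (∫-Φ-[] (λ p → ∫ (Φ v) (λ q → f (p ++ q))))
∫-Φ-++ (a ∷ u) v f = begin
  ∫ (Φ (a ∷ u ++ v)) f
    ≈⟨ ∫-Φ-∷ a (u ++ v) f ⟩
  conv (suc a) (λ i j → ε i * ∫ (Φ (u ++ v)) (λ w → f (ones i ++ letter j ++ w)))
    ≈⟨ conv-cong (suc a) (λ i j → *-congˡ (≈-trans (∫-Φ-++ u v _) (∫-cong (Φ u) (λ p → ∫-cong (Φ v) (λ q →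
         ≈-reflexive (cong f (trans (cong (ones i ++_) (sym (List.++-assoc (letter j) p q))) (sym (List.++-assoc (ones i) (letter j ++ p) q))))))))) ⟩
  conv (suc a) (λ i j → ε i * ∫ (Φ u) (λ p → ∫ (Φ v) (λ q → f ((ones i ++ letter j ++ p) ++ q))))
    ≈⟨ ∫-Φ-∷ a u _ ⟨
  ∫ (Φ (a ∷ u)) (λ p → ∫ (Φ v) (λ q → f (p ++ q))) ∎
  where open ≈-Reasoning

Φ-homogeneous : ∀ u {f g : Word → ℂ} → (∀ w → weight w ≡ weight u → f w ≈ g w) → ∫ (Φ u) f ≈ ∫ (Φ u) g
Φ-homogeneous []      {f} {g} f≈g = ≈-trans (∫-Φ-[] f) (≈-trans (f≈g [] refl) (≈-sym (∫-Φ-[] g)))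
Φ-homogeneous (a ∷ u) {f} {g} f≈g = ≈-trans (∫-Φ-∷ a u f) (≈-trans
  (conv-cong-≡ (suc a) (λ i j i+j≡1+a → *-congˡ (Φ-homogeneous u (λ w w≡u → f≈g _ (weights i j w i+j≡1+a w≡u)))))
  (≈-sym (∫-Φ-∷ a u g)))
  where
  weights : ∀ i j w → i ℕ.+ j ≡ suc a → weight w ≡ weight u → weight (ones i ++ letter j ++ w) ≡ suc a ℕ.+ weight u
  weights i j w i+j≡1+a w≡u = begin
    weight (ones i ++ letter j ++ w)  ≡⟨ weight-++ (ones i) (letter j ++ w) ⟩
    weight (ones i) ℕ.+ weight (letter j ++ w)  ≡⟨ cong₂ ℕ._+_ (weight-ones i) (weight-++ (letter j) w) ⟩
    i ℕ.+ (weight (letter j) ℕ.+ weight w)  ≡⟨ cong (i ℕ.+_) (cong₂ ℕ._+_ (weight-letter j) w≡u) ⟩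
    i ℕ.+ (j ℕ.+ weight u)  ≡⟨ ℕ.+-assoc i j (weight u) ⟨
    i ℕ.+ j ℕ.+ weight u  ≡⟨ cong (ℕ._+ weight u) i+j≡1+a ⟩
    suc a ℕ.+ weight u ∎
    where open ≡-Reasoning

Φ-δ : ∀ u n (f : Word → ℂ) → ∫ (Φ u) (λ w → δ (weight w ℕ.≟ n) * f w) ≈ δ (weight u ℕ.≟ n) * ∫ (Φ u) f
Φ-δ u n f = ≈-trans
  (Φ-homogeneous u (λ w w≡u → *-congʳ (≈-reflexive (cong (λ m → δ (m ℕ.≟ n)) w≡u))))
  (≈-sym (∫-* _ (Φ u) f))

-- As ∂ S₁ = 1, the Leibniz rule gives (i+1) S₁^i from the leading power, and a remainder in which ∂
-- acts behind it.
d-ones-zero : ∀ f i w →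
  d 0 f (ones (suc i) ++ w) ≈ nat (suc i) * f (ones i ++ w) + d 0 (λ v → f (ones (suc i) ++ v)) w
d-ones-zero f zero w = ≈-trans (d-∷ 0 f 0 w) (+-congʳ
  (≈-trans (+-identityʳ _) (≈-sym (≈-trans (*-congʳ (+-identityʳ _)) (*-identityˡ _)))))
d-ones-zero f (suc i) w = begin
  d 0 f (0 ∷ ones (suc i) ++ w)
    ≈⟨ d-∷ 0 f 0 (ones (suc i) ++ w) ⟩
  (f (ones (suc i) ++ w) + 0#) + d 0 (f ∘ (0 ∷_)) (ones (suc i) ++ w)
    ≈⟨ +-cong (≈-trans (+-identityʳ _) (≈-sym (*-identityˡ _))) (d-ones-zero (f ∘ (0 ∷_)) i w) ⟩
  1# * f (ones (suc i) ++ w) + (nat (suc i) * f (ones (suc i) ++ w) + d 0 (λ v → f (ones (suc (suc i)) ++ v)) w)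
    ≈⟨ +-assoc _ _ _ ⟨
  1# * f (ones (suc i) ++ w) + nat (suc i) * f (ones (suc i) ++ w) + d 0 (λ v → f (ones (suc (suc i)) ++ v)) w
    ≈⟨ +-congʳ (distribʳ _ _ _) ⟨
  nat (suc (suc i)) * f (ones (suc i) ++ w) + d 0 (λ v → f (ones (suc (suc i)) ++ v)) w ∎
  where open ≈-Reasoning

-- Lowering an index by at least 2 kills S₁, so the derivation passes over the power of S₁.
d-ones-suc : ∀ k f i w → d (suc k) f (ones i ++ w) ≈ d (suc k) (f ∘ (ones i ++_)) w
d-ones-suc k f zero    w = ≈-refl
d-ones-suc k f (suc i) w = ≈-trans (d-∷ (suc k) f 0 (ones i ++ w))
  (≈-trans (+-identityˡ _) (d-ones-suc k (f ∘ (0 ∷_)) i w))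

-- The derivation ∂ = d₀ multiplies σ₁ = Σ S_n by 1 and e^{-S₁} by -1, so it kills S♯ = e^{-S₁} σ₁.
Φ-d-zero : ∀ u f → ∫ (Φ u) (d 0 f) ≈ 0#
Φ-d-zero []      f = ∫-Φ-[] (d 0 f)
Φ-d-zero (a ∷ u) f = begin
  ∫ (Φ (a ∷ u)) (d 0 f)
    ≈⟨ ∫-Φ-∷ a u (d 0 f) ⟩
  conv (suc a) (λ i j → ε i * ∫ (Φ u) (λ w → d 0 f (ones i ++ letter j ++ w)))
    ≈⟨ conv-cong (suc a) (λ i j → ≈-trans (*-congˡ (leibniz i j)) (distribˡ _ _ _)) ⟩
  conv (suc a) (λ i j → ε i * from-ones i j + ε i * ∑ℂ (chop 0 j) (α i))
    ≈⟨ conv-+ (suc a) _ _ ⟩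
  conv (suc a) (λ i j → ε i * from-ones i j) + conv (suc a) (λ i j → ε i * ∑ℂ (chop 0 j) (α i))
    -- Where ∂ hits S₁^(i+1), the factor `nat (suc i) * ε (suc i)` is `- ε i`. Where it hits a
    -- letter, that index drops by one with coefficient 1. Both sums now run over the splits of `a`,
    -- with opposite signs.
    ≈⟨ +-cong on-ones on-letter ⟩
  conv a (λ i j → - (ε i * α i j)) + conv a (λ i j → ε i * α i j)
    ≈⟨ conv-+ a _ _ ⟨
  conv a (λ i j → - (ε i * α i j) + ε i * α i j)
    ≈⟨ conv-≈0 a (λ i j → -‿inverseˡ _) ⟩
  0# ∎
  where
  open ≈-Reasoning
  α : ℕ → ℕ → ℂ
  α i j = ∫ (Φ u) (λ w → f (ones i ++ letter j ++ w))
  from-ones : ℕ → ℕ → ℂ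
  from-ones zero    j = 0#
  from-ones (suc i) j = nat (suc i) * α i j
  past-ones : ∀ i j → ∫ (Φ u) (λ w → d 0 (f ∘ (ones i ++_)) (letter j ++ w)) ≈ ∑ℂ (chop 0 j) (α i)
  past-ones i j = begin
    ∫ (Φ u) (λ w → d 0 (f ∘ (ones i ++_)) (letter j ++ w))
      ≈⟨ ∫-cong (Φ u) (λ w → d-letter 0 (f ∘ (ones i ++_)) j w) ⟩
    ∫ (Φ u) (λ w → ∑ℂ (chop 0 j) (λ m → f (ones i ++ letter m ++ w)) + d 0 (λ v → f (ones i ++ letter j ++ v)) w)
      ≈⟨ ∫-+ (Φ u) _ _ ⟩
    ∫ (Φ u) (λ w → ∑ℂ (chop 0 j) (λ m → f (ones i ++ letter m ++ w))) + ∫ (Φ u) (d 0 (λ v → f (ones i ++ letter j ++ v)))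
      ≈⟨ +-cong (∫-∑ℂ (Φ u) (chop 0 j) _) (Φ-d-zero u _) ⟩
    ∑ℂ (chop 0 j) (α i) + 0#
      ≈⟨ +-identityʳ _ ⟩
    ∑ℂ (chop 0 j) (α i) ∎
  leibniz : ∀ i j → ∫ (Φ u) (λ w → d 0 f (ones i ++ letter j ++ w)) ≈ from-ones i j + ∑ℂ (chop 0 j) (α i)
  leibniz zero    j = ≈-trans (past-ones 0 j) (≈-sym (+-identityˡ _))
  leibniz (suc i) j = begin
    ∫ (Φ u) (λ w → d 0 f (ones (suc i) ++ letter j ++ w))
      ≈⟨ ∫-cong (Φ u) (λ w → d-ones-zero f i (letter j ++ w)) ⟩
    ∫ (Φ u) (λ w → nat (suc i) * f (ones i ++ letter j ++ w) + d 0 (λ v → f (ones (suc i) ++ v)) (letter j ++ w))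
      ≈⟨ ∫-+ (Φ u) _ _ ⟩
    ∫ (Φ u) (λ w → nat (suc i) * f (ones i ++ letter j ++ w)) + ∫ (Φ u) (λ w → d 0 (λ v → f (ones (suc i) ++ v)) (letter j ++ w))
      ≈⟨ +-cong (≈-sym (∫-* _ (Φ u) _)) (past-ones (suc i) j) ⟩
    nat (suc i) * α i j + ∑ℂ (chop 0 j) (α (suc i)) ∎
  on-ones : conv (suc a) (λ i j → ε i * from-ones i j) ≈ conv a (λ i j → - (ε i * α i j))
  on-ones = begin
    conv (suc a) (λ i j → ε i * from-ones i j)
      ≈⟨ conv-suc a (λ i j → ε i * from-ones i j) ⟩
    ε 0 * 0# + conv a (λ i j → ε (suc i) * (nat (suc i) * α i j))
      ≈⟨ ≈-trans (+-congʳ (zeroʳ _)) (+-identityˡ _) ⟩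
    conv a (λ i j → ε (suc i) * (nat (suc i) * α i j))
      ≈⟨ conv-cong a (λ i j → ≈-trans (≈-sym (*-assoc _ _ _)) (≈-trans
           (*-congʳ (≈-trans (*-comm _ _) (ε-suc i))) (≈-sym (-‿distribˡ-* _ _)))) ⟩
    conv a (λ i j → - (ε i * α i j)) ∎
  on-letter : conv (suc a) (λ i j → ε i * ∑ℂ (chop 0 j) (α i)) ≈ conv a (λ i j → ε i * α i j)
  on-letter = begin
    conv (suc a) (λ i j → ε i * ∑ℂ (chop 0 j) (α i))
      ≈⟨ conv-cong (suc a) (λ i j → ∑ℂ-* (ε i) (chop 0 j) (α i)) ⟩
    conv (suc a) (λ i j → ∑ℂ (chop 0 j) (λ m → ε i * α i m))
      ≈⟨ conv-chopʳ 0 (suc a) (λ i m → ε i * α i m) ⟩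
    conv a (λ i j → ε i * α i j) + 0#
      ≈⟨ +-identityʳ _ ⟩
    conv a (λ i j → ε i * α i j) ∎

-- Since `d (suc k)` kills S₁, it passes the factor e^(-S₁) and acts on the S♯ as it does on the S.
Φ-d-suc : ∀ k u f → ∫ (Φ u) (d (suc k) f) ≈ d (suc k) (λ v → ∫ (Φ v) f) u
Φ-d-suc k []      f = ∫-Φ-[] (d (suc k) f)
Φ-d-suc k (a ∷ u) f = begin
  ∫ (Φ (a ∷ u)) (d (suc k) f)
    ≈⟨ ∫-Φ-∷ a u (d (suc k) f) ⟩
  conv (suc a) (λ i j → ε i * ∫ (Φ u) (λ w → d (suc k) f (ones i ++ letter j ++ w)))
    ≈⟨ conv-cong (suc a) (λ i j → *-congˡ (leibniz i j)) ⟩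
  conv (suc a) (λ i j → ε i * (∑ℂ (chop (suc k) j) (α u i) + d (suc k) (λ v → α v i j) u))
    ≈⟨ conv-cong (suc a) (λ i j → ≈-trans (distribˡ _ _ _)
         (+-cong (∑ℂ-* (ε i) (chop (suc k) j) (α u i)) (∑ℂ-* (ε i) (removals (suc k) u) _))) ⟩
  conv (suc a) (λ i j → ∑ℂ (chop (suc k) j) (λ m → ε i * α u i m) + d (suc k) (λ v → ε i * α v i j) u)
    ≈⟨ conv-+ (suc a) _ _ ⟩
  conv (suc a) (λ i j → ∑ℂ (chop (suc k) j) (λ m → ε i * α u i m)) + conv (suc a) (λ i j → d (suc k) (λ v → ε i * α v i j) u)
    ≈⟨ +-cong (conv-chopʳ (suc k) (suc a) (λ i m → ε i * α u i m)) (∑ℂ-swap (splits (suc a)) (removals (suc k) u) _) ⟩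
  ∑ℂ (chop (suc k) (suc a)) (λ m → conv m (λ i j → ε i * α u i j)) + d (suc k) (λ v → conv (suc a) (λ i j → ε i * α v i j)) u
    ≈⟨ +-cong (∑ℂ-cong (chop (suc k) (suc a)) (λ m → ∫-Φ-letter m u f)) (d-cong (suc k) (λ v → ∫-Φ-∷ a v f) u) ⟨
  ∑ℂ (chop (suc k) (suc a)) (λ m → ∫ (Φ (letter m ++ u)) f) + d (suc k) (λ v → ∫ (Φ (a ∷ v)) f) u
    ≈⟨ d-∷ (suc k) (λ v → ∫ (Φ v) f) a u ⟨
  d (suc k) (λ v → ∫ (Φ v) f) (a ∷ u) ∎
  where
  open ≈-Reasoning
  α : Word → ℕ → ℕ → ℂ
  α v i j = ∫ (Φ v) (λ w → f (ones i ++ letter j ++ w))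
  leibniz : ∀ i j → ∫ (Φ u) (λ w → d (suc k) f (ones i ++ letter j ++ w)) ≈
                    ∑ℂ (chop (suc k) j) (α u i) + d (suc k) (λ v → α v i j) u
  leibniz i j = begin
    ∫ (Φ u) (λ w → d (suc k) f (ones i ++ letter j ++ w))
      ≈⟨ ∫-cong (Φ u) (λ w → ≈-trans (d-ones-suc k f i (letter j ++ w)) (d-letter (suc k) (f ∘ (ones i ++_)) j w)) ⟩
    ∫ (Φ u) (λ w → ∑ℂ (chop (suc k) j) (λ m → f (ones i ++ letter m ++ w)) + d (suc k) (λ v → f (ones i ++ letter j ++ v)) w)
      ≈⟨ ∫-+ (Φ u) _ _ ⟩
    ∫ (Φ u) (λ w → ∑ℂ (chop (suc k) j) (λ m → f (ones i ++ letter m ++ w))) + ∫ (Φ u) (d (suc k) (λ v → f (ones i ++ letter j ++ v)))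
      ≈⟨ +-cong (∫-∑ℂ (Φ u) (chop (suc k) j) _) (Φ-d-suc k u _) ⟩
    ∑ℂ (chop (suc k) j) (α u i) + d (suc k) (λ v → α v i j) u ∎

-- Grouplikeness of e^(-S₁), where S₁ is primitive. Both sides satisfy the same recursion after
-- multiplication by `i + 1`, through `ε-suc` on the left and the product rule on the right.
Δ-ones : ∀ i (F : Word → Word → ℂ) → ε i * Δ (ones i) F ≈ conv i (λ a b → ε a * ε b * F (ones a) (ones b))
Δ-ones zero    F = ≈-trans (*-cong (≈-trans (≈-sym (*-identityʳ _)) (*-congˡ (≈-sym ε-zero))) (+-identityʳ _)) (≈-sym (+-identityʳ _))
Δ-ones (suc i) F = nat-cancel i (begin
  nat (suc i) * (ε (suc i) * Δ (ones (suc i)) F)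
    ≈⟨ ≈-trans (≈-sym (*-assoc _ _ _)) (*-congʳ (ε-suc i)) ⟩
  - ε i * Δ (ones (suc i)) F
    ≈⟨ *-congˡ (≈-trans (Δ-∷ 0 (ones i) F) (+-congˡ (+-identityʳ _))) ⟩
  - ε i * (Δ (ones i) (λ p q → F p (0 ∷ q)) + Δ (ones i) (λ p q → F (0 ∷ p) q))
    ≈⟨ ≈-trans (≈-sym (-‿distribˡ-* _ _)) (-‿cong (distribˡ _ _ _)) ⟩
  - (ε i * Δ (ones i) (λ p q → F p (0 ∷ q)) + ε i * Δ (ones i) (λ p q → F (0 ∷ p) q))
    ≈⟨ -‿cong (+-cong (Δ-ones i _) (Δ-ones i _)) ⟩
  - (conv i (λ a b → ε a * ε b * F (ones a) (ones (suc b))) + conv i (λ a b → ε a * ε b * F (ones (suc a)) (ones b)))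
    ≈⟨ ≈-trans (-‿cong (+-comm _ _)) (≈-sym (-‿+-comm _ _)) ⟩
  - conv i (λ a b → ε a * ε b * F (ones (suc a)) (ones b)) + - conv i (λ a b → ε a * ε b * F (ones a) (ones (suc b)))
    ≈⟨ +-cong (≈-trans (neg-conv _) (conv-cong i left)) (≈-trans (neg-conv _) (conv-cong i right)) ⟩
  conv i (λ a b → nat (suc a) * (ε (suc a) * ε b * F (ones (suc a)) (ones b)))
    + conv i (λ a b → nat (suc b) * (ε a * ε (suc b) * F (ones a) (ones (suc b))))
    ≈⟨ conv-leibniz i _ ⟨
  nat (suc i) * conv (suc i) (λ a b → ε a * ε b * F (ones a) (ones b)) ∎)
  where
  open ≈-Reasoning
  neg-conv : ∀ (G : ℕ → ℕ → ℂ) → - conv i G ≈ conv i (λ a b → - 1# * G a b)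
  neg-conv G = ≈-trans (≈-sym (≈-trans (≈-sym (-‿distribˡ-* _ _)) (-‿cong (*-identityˡ _)))) (conv-* (- 1#) i G)
  neg : ∀ x → - 1# * x ≈ - x
  neg x = ≈-trans (≈-sym (-‿distribˡ-* _ _)) (-‿cong (*-identityˡ _))
  left : ∀ a b → - 1# * (ε a * ε b * F (ones (suc a)) (ones b)) ≈ nat (suc a) * (ε (suc a) * ε b * F (ones (suc a)) (ones b))
  left a b = ≈-trans (shuffle (- 1#) (ε a) (ε b) _) (≈-trans
    (*-congʳ (*-congʳ (≈-trans (neg _) (≈-sym (ε-suc a))))) (≈-sym (shuffle (nat (suc a)) (ε (suc a)) (ε b) _)))
    where
    shuffle : ∀ m x y z → m * (x * y * z) ≈ (m * x) * y * z
    shuffle = solve 4 (λ m x y z → m :* (x :* y :* z) := (m :* x) :* y :* z) ≈-refl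
      where open ℂ-Solver
  right : ∀ a b → - 1# * (ε a * ε b * F (ones a) (ones (suc b))) ≈ nat (suc b) * (ε a * ε (suc b) * F (ones a) (ones (suc b)))
  right a b = ≈-trans (shuffle (- 1#) (ε a) (ε b) _) (≈-trans
    (*-congʳ (*-congˡ (≈-trans (neg _) (≈-sym (ε-suc b))))) (≈-sym (shuffle (nat (suc b)) (ε a) (ε (suc b)) _)))
    where
    shuffle : ∀ m x y z → m * (x * y * z) ≈ x * (m * y) * z
    shuffle = solve 4 (λ m x y z → m :* (x :* y :* z) := x :* (m :* y) :* z) ≈-refl
      where open ℂ-Solver

-- S♯ = e^{-S₁} σ₁ is grouplike, so Φ is a morphism of coalgebras.
Δ-Φ : ∀ v (F : Word → Word → ℂ) → ∫ (Φ v) (λ w → Δ w F) ≈ Δ v (λ p q → ∫ (Φ p) (λ p′ → ∫ (Φ q) (F p′)))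
Δ-Φ []      F = begin
  ∫ (Φ []) (λ w → Δ w F)  ≈⟨ ∫-Φ-[] (λ w → Δ w F) ⟩
  F [] [] + 0#  ≈⟨ +-congʳ (∫-Φ-[] (F [])) ⟨
  ∫ (Φ []) (F []) + 0#  ≈⟨ +-congʳ (∫-Φ-[] (λ p′ → ∫ (Φ []) (F p′))) ⟨
  ∫ (Φ []) (λ p′ → ∫ (Φ []) (F p′)) + 0# ∎
  where open ≈-Reasoning
Δ-Φ (a ∷ v) F = begin
  ∫ (Φ (a ∷ v)) (λ w → Δ w F)
    ≈⟨ ∫-Φ-∷ a v (λ w → Δ w F) ⟩
  conv (suc a) (λ i j → ε i * ∫ (Φ v) (λ w → Δ (ones i ++ letter j ++ w) F))
    ≈⟨ conv-cong (suc a) split-row ⟩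
  conv (suc a) (λ i j → conv i (λ b c → conv j (λ l m → κ b c l m)))
    -- The pair `b , c` splits the power of S₁ and `l , m` splits the letter. The regrouping
    -- collects `b , l` in the left tensor factor and `c , m` in the right one, where each pair
    -- forms an S♯.
    ≈⟨ conv-interchange (suc a) κ ⟩
  conv (suc a) (λ i j → conv i (λ b l → conv j (λ c m → κ b c l m)))
    ≈⟨ conv-cong (suc a) (λ i j → ≈-sym (collect i j)) ⟩
  conv (suc a) (λ i j → Δ v (λ p q → ∫ (Φ (letter i ++ p)) (λ p′ → ∫ (Φ (letter j ++ q)) (F p′))))
    ≈⟨ Δ-∷ a v _ ⟨
  Δ (a ∷ v) (λ p q → ∫ (Φ p) (λ p′ → ∫ (Φ q) (F p′))) ∎
  where
  open ≈-Reasoning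
  G : ℕ → ℕ → ℕ → ℕ → Word → Word → ℂ
  G b c l m p q = F (ones b ++ letter l ++ p) (ones c ++ letter m ++ q)
  κ : ℕ → ℕ → ℕ → ℕ → ℂ
  κ b c l m = ε b * ε c * Δ v (λ p q → ∫ (Φ p) (λ p′ → ∫ (Φ q) (G b c l m p′)))
  split-row : ∀ i j → ε i * ∫ (Φ v) (λ w → Δ (ones i ++ letter j ++ w) F) ≈ conv i (λ b c → conv j (λ l m → κ b c l m))
  split-row i j = begin
    ε i * ∫ (Φ v) (λ w → Δ (ones i ++ letter j ++ w) F)
      ≈⟨ ∫-* (ε i) (Φ v) _ ⟩
    ∫ (Φ v) (λ w → ε i * Δ (ones i ++ letter j ++ w) F)
      ≈⟨ ∫-cong (Φ v) (λ w → ≈-trans (*-congˡ (Δ-++ (ones i) (letter j ++ w) F)) (Δ-ones i _)) ⟩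
    ∫ (Φ v) (λ w → conv i (λ b c → ε b * ε c * Δ (letter j ++ w) (λ p q → F (ones b ++ p) (ones c ++ q))))
      ≈⟨ ∫-cong (Φ v) (λ w → conv-cong i (λ b c → *-congˡ (Δ-letter j w _))) ⟩
    ∫ (Φ v) (λ w → conv i (λ b c → ε b * ε c * conv j (λ l m → Δ w (G b c l m))))
      ≈⟨ ∫-∑ℂ (Φ v) (splits i) _ ⟩
    conv i (λ b c → ∫ (Φ v) (λ w → ε b * ε c * conv j (λ l m → Δ w (G b c l m))))
      ≈⟨ conv-cong i (λ b c → ≈-trans (≈-sym (∫-* _ (Φ v) _)) (*-congˡ (∫-∑ℂ (Φ v) (splits j) _))) ⟩
    conv i (λ b c → ε b * ε c * conv j (λ l m → ∫ (Φ v) (λ w → Δ w (G b c l m))))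
      ≈⟨ conv-cong i (λ b c → ≈-trans (conv-* _ j _) (conv-cong j (λ l m → *-congˡ (Δ-Φ v (G b c l m))))) ⟩
    conv i (λ b c → conv j (λ l m → κ b c l m)) ∎
  collect : ∀ i j → Δ v (λ p q → ∫ (Φ (letter i ++ p)) (λ p′ → ∫ (Φ (letter j ++ q)) (F p′))) ≈
                    conv i (λ b l → conv j (λ c m → κ b c l m))
  collect i j = begin
    Δ v (λ p q → ∫ (Φ (letter i ++ p)) (λ p′ → ∫ (Φ (letter j ++ q)) (F p′)))
      ≈⟨ Δ-cong v expand ⟩
    Δ v (λ p q → conv i (λ b l → conv j (λ c m → ε b * ε c * ∫ (Φ p) (λ p′ → ∫ (Φ q) (G b c l m p′)))))
      ≈⟨ Δ-conv v i _ ⟩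
    conv i (λ b l → Δ v (λ p q → conv j (λ c m → ε b * ε c * ∫ (Φ p) (λ p′ → ∫ (Φ q) (G b c l m p′)))))
      ≈⟨ conv-cong i (λ b l → ≈-trans (Δ-conv v j _) (conv-cong j (λ c m → ≈-sym (Δ-* (ε b * ε c) v _)))) ⟩
    conv i (λ b l → conv j (λ c m → κ b c l m)) ∎
    where
    expand : ∀ p q → ∫ (Φ (letter i ++ p)) (λ p′ → ∫ (Φ (letter j ++ q)) (F p′)) ≈
      conv i (λ b l → conv j (λ c m → ε b * ε c * ∫ (Φ p) (λ p′ → ∫ (Φ q) (G b c l m p′))))
    expand p q = begin
      ∫ (Φ (letter i ++ p)) (λ p′ → ∫ (Φ (letter j ++ q)) (F p′))
        ≈⟨ ∫-Φ-letter i p _ ⟩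
      conv i (λ b l → ε b * ∫ (Φ p) (λ p′ → ∫ (Φ (letter j ++ q)) (F (ones b ++ letter l ++ p′))))
        ≈⟨ conv-cong i (λ b l → *-congˡ (∫-cong (Φ p) (λ p′ → ∫-Φ-letter j q _))) ⟩
      conv i (λ b l → ε b * ∫ (Φ p) (λ p′ → conv j (λ c m → ε c * ∫ (Φ q) (G b c l m p′))))
        ≈⟨ conv-cong i (λ b l → ≈-trans (*-congˡ (∫-∑ℂ (Φ p) (splits j) _)) (conv-* (ε b) j _)) ⟩
      conv i (λ b l → conv j (λ c m → ε b * ∫ (Φ p) (λ p′ → ε c * ∫ (Φ q) (G b c l m p′))))
        ≈⟨ conv-cong i (λ b l → conv-cong j (λ c m → ≈-trans (*-congˡ (≈-sym (∫-* (ε c) (Φ p) _))) (≈-sym (*-assoc _ _ _)))) ⟩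
      conv i (λ b l → conv j (λ c m → ε b * ε c * ∫ (Φ p) (λ p′ → ∫ (Φ q) (G b c l m p′)))) ∎

-- As Φ preserves coproduct and degree, the first row can be split off from `v` before Φ is applied.
star-Φ-∷ : ∀ f a x v → ∫ (Φ v) (star f (a ∷ x)) ≈
  Δ v (λ p q → δ (weight p ℕ.≟ suc a) * ∫ (Φ p) (λ p′ → ∫ (Φ q) (star (f ∘ (p′ ++_)) x)))
star-Φ-∷ f a x v = begin
  ∫ (Φ v) (star f (a ∷ x))
    ≈⟨ Δ-Φ v _ ⟩
  Δ v (λ p q → ∫ (Φ p) (λ p′ → ∫ (Φ q) (λ q′ → δ (weight p′ ℕ.≟ suc a) * star (f ∘ (p′ ++_)) x q′)))
    ≈⟨ Δ-cong v (λ p q → ∫-cong (Φ p) (λ p′ → ≈-sym (∫-* _ (Φ q) _))) ⟩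
  Δ v (λ p q → ∫ (Φ p) (λ p′ → δ (weight p′ ℕ.≟ suc a) * ∫ (Φ q) (star (f ∘ (p′ ++_)) x)))
    ≈⟨ Δ-cong v (λ p q → Φ-δ p (suc a) _) ⟩
  Δ v (λ p q → δ (weight p ℕ.≟ suc a) * ∫ (Φ p) (λ p′ → ∫ (Φ q) (star (f ∘ (p′ ++_)) x))) ∎
  where open ≈-Reasoning

-- S^u * Φ(S^v) = Φ(S^u * S^v)
star-Φʳ : ∀ f u v → ∫ (Φ v) (star f u) ≈ star (λ w → ∫ (Φ w) f) u v
star-Φʳ f []      []      = ≈-trans (∫-Φ-[] (star f [])) (≈-sym (∫-Φ-[] f))
star-Φʳ f []      (b ∷ v) = ≈-trans (Φ-homogeneous (b ∷ v) {g = λ _ → 0#} λ { [] () ; (_ ∷ _) _ → ≈-refl }) (∫-0 (Φ (b ∷ v)))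
star-Φʳ f (a ∷ u) v       = begin
  ∫ (Φ v) (star f (a ∷ u))
    ≈⟨ star-Φ-∷ f a u v ⟩
  Δ v (λ p q → δ (weight p ℕ.≟ suc a) * ∫ (Φ p) (λ p′ → ∫ (Φ q) (star (f ∘ (p′ ++_)) u)))
    ≈⟨ Δ-cong v (λ p q → *-congˡ (≈-trans (∫-cong (Φ p) (λ p′ → star-Φʳ (f ∘ (p′ ++_)) u q)) (≈-sym (star-∫ (Φ p) _ u q)))) ⟩
  Δ v (λ p q → δ (weight p ℕ.≟ suc a) * star (λ w → ∫ (Φ p) (λ p′ → ∫ (Φ w) (λ w′ → f (p′ ++ w′)))) u q)
    ≈⟨ Δ-cong v (λ p q → *-congˡ (star-cong (λ w → ∫-Φ-++ p w f) u q)) ⟨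
  star (λ w → ∫ (Φ w) f) (a ∷ u) v ∎
  where open ≈-Reasoning

-- Only the term S_{a+1} of S♯_{a+1} survives, the others start with S₁ and ∂ kills Φ v.
star-Φ-head : ∀ f a u v → ∫ (Φ (a ∷ u)) (λ x → ∫ (Φ v) (star f x)) ≈ ∫ (Φ u) (λ x → ∫ (Φ v) (star f (a ∷ x)))
star-Φ-head f a u v = begin
  ∫ (Φ (a ∷ u)) (λ x → ∫ (Φ v) (star f x))
    ≈⟨ ∫-Φ-∷ a u _ ⟩
  conv (suc a) (λ i j → ε i * ∫ (Φ u) (λ x → ∫ (Φ v) (star f (ones i ++ letter j ++ x))))
    ≈⟨ conv-head (suc a) _ (λ i j → ≈-trans (*-congˡ (∫-≈0 (Φ u) (λ x → ≈-trans
         (∫-cong (Φ v) (star-0∷ f (ones i ++ letter j ++ x))) (Φ-d-zero v _)))) (zeroʳ _)) ⟩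
  ε 0 * ∫ (Φ u) (λ x → ∫ (Φ v) (star f (a ∷ x)))
    ≈⟨ ≈-trans (*-congʳ ε-zero) (*-identityˡ _) ⟩
  ∫ (Φ u) (λ x → ∫ (Φ v) (star f (a ∷ x))) ∎
  where open ≈-Reasoning

-- Against a right factor `Φ v`, the left factor `Φ u` acts like S^u: `star-Φ-head` replaces the
-- first S♯ by S, and splitting off its row leaves the same claim for the rest.
star-Φˡ : ∀ f u v → ∫ (Φ u) (λ x → ∫ (Φ v) (star f x)) ≈ ∫ (Φ v) (star f u)
star-Φˡ f []      v = ∫-Φ-[] (λ x → ∫ (Φ v) (star f x))
star-Φˡ f (a ∷ u) v = begin
  ∫ (Φ (a ∷ u)) (λ x → ∫ (Φ v) (star f x))
    ≈⟨ star-Φ-head f a u v ⟩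
  ∫ (Φ u) (λ x → ∫ (Φ v) (star f (a ∷ x)))
    ≈⟨ ∫-cong (Φ u) (λ x → star-Φ-∷ f a x v) ⟩
  ∫ (Φ u) (λ x → Δ v (λ p q → δ (weight p ℕ.≟ suc a) * ∫ (Φ p) (λ p′ → ∫ (Φ q) (star (f ∘ (p′ ++_)) x))))
    ≈⟨ Δ-∫ v (Φ u) _ ⟨
  Δ v (λ p q → ∫ (Φ u) (λ x → δ (weight p ℕ.≟ suc a) * ∫ (Φ p) (λ p′ → ∫ (Φ q) (star (f ∘ (p′ ++_)) x))))
    ≈⟨ Δ-cong v (λ p q → ≈-trans (≈-sym (∫-* _ (Φ u) _)) (*-congˡ (≈-trans (∫-swap (Φ u) (Φ p) _)
         (∫-cong (Φ p) (λ p′ → star-Φˡ (f ∘ (p′ ++_)) u q))))) ⟩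
  Δ v (λ p q → δ (weight p ℕ.≟ suc a) * ∫ (Φ p) (λ p′ → ∫ (Φ q) (star (f ∘ (p′ ++_)) u)))
    ≈⟨ star-Φ-∷ f a u v ⟨
  ∫ (Φ v) (star f (a ∷ u)) ∎
  where open ≈-Reasoning

star-Φ : ∀ f u v → ∫ (Φ u) (λ x → ∫ (Φ v) (star f x)) ≈ star (λ w → ∫ (Φ w) f) u v
star-Φ f u v = ≈-trans (star-Φˡ f u v) (star-Φʳ f u v)

-- The elements S₁ʲ/j! · S♯^I, their internal products and their characters

basis : ℕ → Word → Sym
basis j u = 1/ j ! • S 1 ^ j · Φ u

∫-basis : ∀ j u (f : Word → ℂ) → ∫ (basis j u) f ≈ 1/ j ! * ∫ (Φ u) (f ∘ (ones j ++_))
∫-basis j u f = ≈-trans (∫-• (1/ j !) (S 1 ^ j · Φ u) f) (*-congˡ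
  (≈-trans (∫-· (S 1 ^ j) (Φ u) f) (∫-S₁^ j (λ p → ∫ (Φ u) (f ∘ (p ++_))))))

-- S_n = Σ_i S₁^i/i! S♯_{n-i}, multiplied by Φ u on the right.
S-Φ : ∀ n u (f : Word → ℂ) → conv n (λ i j → ∫ (basis i (letter j ++ u)) f) ≈ ∫ (Φ u) (f ∘ (letter n ++_))
S-Φ n u f = begin
  conv n (λ i j → ∫ (basis i (letter j ++ u)) f)
    ≈⟨ conv-cong n (λ i j → ≈-trans (∫-basis i (letter j ++ u) f) (*-congˡ (∫-Φ-letter j u _))) ⟩
  conv n (λ i j → 1/ i ! * conv j (λ l m → ε l * ∫ (Φ u) (λ w → f (ones i ++ ones l ++ letter m ++ w))))
    ≈⟨ conv-cong n (λ i j → ≈-trans (conv-* (1/ i !) j _) (conv-cong j (λ l m → ≈-trans (≈-sym (*-assoc _ _ _))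
         (*-congˡ (∫-cong (Φ u) (λ w → ≈-reflexive (cong f (ones-+ i l (letter m ++ w))))))))) ⟩
  conv n (λ i j → conv j (λ l m → 1/ i ! * ε l * α (i ℕ.+ l) m))
    ≈⟨ conv-assoc n (λ i l m → 1/ i ! * ε l * α (i ℕ.+ l) m) ⟨
  conv n (λ x m → conv x (λ i l → 1/ i ! * ε l * α (i ℕ.+ l) m))
    ≈⟨ conv-cong n (λ x m → ≈-trans (conv-cong-≡ x (λ i l eq → *-congˡ (≈-reflexive (cong (λ y → α y m) eq))))
         (≈-sym (∑ℂ-*ʳ (α x m) (splits x) _))) ⟩
  conv n (λ x m → conv x (λ i l → 1/ i ! * ε l) * α x m)
    -- The inner sum is coefficient `x` of e^t e^(-t), so only `x = 0` is left.
    ≈⟨ conv-head n _ (λ x m → ≈-trans (*-congʳ (exp-inverse x)) (zeroˡ _)) ⟩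
  conv 0 (λ i l → 1/ i ! * ε l) * α 0 n
    ≈⟨ *-congʳ (≈-trans (+-identityʳ _) (≈-trans (*-congˡ ε-zero) (*-identityʳ _))) ⟩
  1# * α 0 n
    ≈⟨ *-identityˡ _ ⟩
  α 0 n ∎
  where
  open ≈-Reasoning
  α : ℕ → ℕ → ℂ
  α x m = ∫ (Φ u) (λ w → f (ones x ++ letter m ++ w))

basis-d-zero : ∀ u f → ∫ (basis 0 u) (d 0 f) ≈ 0#
basis-d-zero u f = ≈-trans (∫-basis 0 u (d 0 f)) (≈-trans (*-congˡ (Φ-d-zero u f)) (zeroʳ _))

-- Here the normalisation 1/j! pays off: ∂ lowers the exponent with coefficient 1, since it kills
-- the S♯ behind the power.
basis-suc-d-zero : ∀ j u f → ∫ (basis (suc j) u) (d 0 f) ≈ ∫ (basis j u) f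
basis-suc-d-zero j u f = begin
  ∫ (basis (suc j) u) (d 0 f)
    ≈⟨ ∫-basis (suc j) u (d 0 f) ⟩
  1/ suc j ! * ∫ (Φ u) (λ w → d 0 f (ones (suc j) ++ w))
    ≈⟨ *-congˡ (∫-cong (Φ u) (λ w → d-ones-zero f j w)) ⟩
  1/ suc j ! * ∫ (Φ u) (λ w → nat (suc j) * f (ones j ++ w) + d 0 (λ v → f (ones (suc j) ++ v)) w)
    ≈⟨ *-congˡ (≈-trans (∫-+ (Φ u) _ _) (≈-trans (+-cong (≈-sym (∫-* _ (Φ u) _)) (Φ-d-zero u _)) (+-identityʳ _))) ⟩
  1/ suc j ! * (nat (suc j) * ∫ (Φ u) (f ∘ (ones j ++_)))
    ≈⟨ ≈-trans (≈-sym (*-assoc _ _ _)) (*-congʳ (≈-trans (*-comm _ _) (1/!-suc j))) ⟩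
  1/ j ! * ∫ (Φ u) (f ∘ (ones j ++_))
    ≈⟨ ∫-basis j u f ⟨
  ∫ (basis j u) f ∎
  where open ≈-Reasoning

basis-d-suc : ∀ k j u f → ∫ (basis j u) (d (suc k) f) ≈ d (suc k) (λ v → ∫ (basis j v) f) u
basis-d-suc k j u f = begin
  ∫ (basis j u) (d (suc k) f)
    ≈⟨ ∫-basis j u (d (suc k) f) ⟩
  1/ j ! * ∫ (Φ u) (λ w → d (suc k) f (ones j ++ w))
    ≈⟨ *-congˡ (≈-trans (∫-cong (Φ u) (d-ones-suc k f j)) (Φ-d-suc k u _)) ⟩
  1/ j ! * d (suc k) (λ v → ∫ (Φ v) (f ∘ (ones j ++_))) u
    ≈⟨ ∑ℂ-* (1/ j !) (removals (suc k) u) _ ⟩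
  d (suc k) (λ v → 1/ j ! * ∫ (Φ v) (f ∘ (ones j ++_))) u
    ≈⟨ d-cong (suc k) (λ v → ∫-basis j v f) u ⟨
  d (suc k) (λ v → ∫ (basis j v) f) u ∎
  where open ≈-Reasoning

-- The `j` rows of sum 1 apply ∂ to the right factor `j` times, whereas `l + 1` times already kill
-- it.
basis-star-ones-< : ∀ {l j} → l ℕ.< j → ∀ w x f → ∫ (basis l w) (star f (ones j ++ x)) ≈ 0#
basis-star-ones-< {zero}  {suc j} _         w x f = ≈-trans
  (∫-cong (basis 0 w) (star-0∷ f (ones j ++ x))) (basis-d-zero w _)
basis-star-ones-< {suc l} {suc j} (s≤s l<j) w x f = ≈-trans
  (∫-cong (basis (suc l) w) (star-0∷ f (ones j ++ x))) (≈-trans (basis-suc-d-zero l w _) (basis-star-ones-< l<j w x (f ∘ (0 ∷_))))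

basis-star-ones : ∀ j w x f → ∫ (basis j w) (star f (ones j ++ x)) ≈ ∫ (Φ w) (star (f ∘ (ones j ++_)) x)
basis-star-ones zero    w x f = ≈-trans (∫-basis 0 w (star f x)) (*-identityˡ _)
basis-star-ones (suc j) w x f = ≈-trans
  (∫-cong (basis (suc j) w) (star-0∷ f (ones j ++ x))) (≈-trans (basis-suc-d-zero j w _) (basis-star-ones j w x (f ∘ (0 ∷_))))

basis-⊛-< : ∀ {l j} → l ℕ.< j → ∀ u w f → ∫ (basis j u ⊛ basis l w) f ≈ 0#
basis-⊛-< {l} {j} l<j u w f = ≈-trans (∫-⊛ (basis j u) (basis l w) f) (≈-trans (∫-basis j u _) (≈-trans
  (*-congˡ (∫-≈0 (Φ u) (λ x → basis-star-ones-< l<j w x f))) (zeroʳ _)))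

-- Every term of the left factor starts with `j` rows of sum 1. They strip S₁ʲ/j! from the right
-- factor and reproduce S₁ʲ in the result, and `star-Φ` multiplies what remains.
basis-⊛ : ∀ j u w f → ∫ (basis j u ⊛ basis j w) f ≈ star (λ z → ∫ (basis j z) f) u w
basis-⊛ j u w f = begin
  ∫ (basis j u ⊛ basis j w) f
    ≈⟨ ∫-⊛ (basis j u) (basis j w) f ⟩
  ∫ (basis j u) (λ x → ∫ (basis j w) (star f x))
    ≈⟨ ∫-basis j u _ ⟩
  1/ j ! * ∫ (Φ u) (λ x → ∫ (basis j w) (star f (ones j ++ x)))
    ≈⟨ *-congˡ (≈-trans (∫-cong (Φ u) (λ x → basis-star-ones j w x f)) (star-Φ _ u w)) ⟩
  1/ j ! * star (λ z → ∫ (Φ z) (f ∘ (ones j ++_))) u w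
    ≈⟨ star-* (1/ j !) _ u w ⟨
  star (λ z → 1/ j ! * ∫ (Φ z) (f ∘ (ones j ++_))) u w
    ≈⟨ star-cong (λ z → ∫-basis j z f) u w ⟨
  star (λ z → ∫ (basis j z) f) u w ∎
  where open ≈-Reasoning

-- `χ (ones m)` is ∂ applied `m` times, then the constant term: too few derivatives leave a power of
-- S₁, too many give 0.
χ-ones-basis : ∀ m l w → ∫ (basis l w) (χ (ones m)) ≈ δ (l ℕ.≟ m) * χ [] w
χ-ones-basis zero zero w = ≈-trans (∫-basis 0 w (χ [])) (*-congˡ (constant w))
  where
  constant : ∀ w → ∫ (Φ w) (χ []) ≈ χ [] w
  constant []      = ∫-Φ-[] (χ [])
  constant (a ∷ w) = ≈-trans (Φ-homogeneous (a ∷ w) {g = λ _ → 0#} λ { [] () ; (_ ∷ _) _ → ≈-refl }) (∫-0 (Φ (a ∷ w)))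
χ-ones-basis zero (suc l) w = ≈-trans (∫-basis (suc l) w (χ [])) (≈-trans
  (≈-trans (*-congˡ (∫-0 (Φ w))) (zeroʳ _)) (≈-sym (zeroˡ _)))
χ-ones-basis (suc m) zero w = ≈-trans (basis-d-zero w (χ (ones m))) (≈-sym (zeroˡ _))
χ-ones-basis (suc m) (suc l) w = ≈-trans (basis-suc-d-zero l w (χ (ones m)))
  (≈-trans (χ-ones-basis m l w) (*-congʳ (δ-⇔ (l ℕ.≟ m) (suc l ℕ.≟ suc m) (cong suc) ℕ.suc-injective)))

-- Parts greater than 1 act on the index `w` alone by `basis-d-suc`. They come first in
-- `μ ++ ones m`, so they can be moved to the index one after another until only ones are left.
χ-basis : ∀ {μ} m l w → All (0 ℕ.<_) μ → ∫ (basis l w) (χ (μ ++ ones m)) ≈ δ (l ℕ.≟ m) * χ μ w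
χ-basis m l w [] = χ-ones-basis m l w
χ-basis {suc k ∷ μ} m l w (_ ∷ μ>0) = begin
  ∫ (basis l w) (d (suc k) (χ (μ ++ ones m)))
    ≈⟨ basis-d-suc k l w (χ (μ ++ ones m)) ⟩
  d (suc k) (λ v → ∫ (basis l v) (χ (μ ++ ones m))) w
    ≈⟨ d-cong (suc k) (λ v → χ-basis m l v μ>0) w ⟩
  d (suc k) (λ v → δ (l ℕ.≟ m) * χ μ v) w
    ≈⟨ ∑ℂ-* _ (removals (suc k) w) (χ μ) ⟨
  δ (l ℕ.≟ m) * χ (suc k ∷ μ) w ∎
  where open ≈-Reasoning

-- Bases of the algebras D n k

-- A matrix with one column is determined by its row sums: S_m is a right unit in degree `m`.
star-letterʳ : ∀ g u m → star g u (letter m) ≈ δ (weight u ℕ.≟ m) * g u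
star-letterʳ g []      zero    = ≈-sym (*-identityˡ _)
star-letterʳ g []      (suc m) = ≈-sym (zeroˡ _)
star-letterʳ g (a ∷ u) m       = begin
  Δ (letter m) F
    ≈⟨ ≈-reflexive (cong (λ v → Δ v F) (sym (List.++-identityʳ (letter m)))) ⟩
  Δ (letter m ++ []) F
    ≈⟨ ≈-trans (Δ-letter m [] F) (conv-cong m (λ i j → +-identityʳ _)) ⟩
  conv m (λ i j → F (letter i ++ []) (letter j ++ []))
    ≈⟨ conv-cong m (λ i j → ≈-trans
         (≈-reflexive (cong₂ F (List.++-identityʳ (letter i)) (List.++-identityʳ (letter j))))
         (*-congʳ (≈-reflexive (cong (λ n → δ (n ℕ.≟ suc a)) (weight-letter i))))) ⟩
  conv m (λ i j → δ (i ℕ.≟ suc a) * star (λ w → g (letter i ++ w)) u (letter j))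
    ≈⟨ conv-δ (suc a) m (λ i j → star (λ w → g (letter i ++ w)) u (letter j)) ⟩
  ∑ℂ (chop a m) (λ j → star (λ w → g (a ∷ w)) u (letter j))
    ≈⟨ ∑ℂ-cong (chop a m) (star-letterʳ (λ w → g (a ∷ w)) u) ⟩
  ∑ℂ (chop a m) (λ j → δ (weight u ℕ.≟ j) * g (a ∷ u))
    ≈⟨ ∑ℂ-*ʳ (g (a ∷ u)) (chop a m) _ ⟨
  ∑ℂ (chop a m) (λ j → δ (weight u ℕ.≟ j)) * g (a ∷ u)
    ≈⟨ *-congʳ (≈-trans (≈-sym (δ-chop (weight u) a m)) (≈-reflexive (cong (λ n → δ (n ℕ.≟ m)) (ℕ.+-comm (weight u) (suc a))))) ⟩
  δ (weight (a ∷ u) ℕ.≟ m) * g (a ∷ u) ∎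
  where
  open ≈-Reasoning
  F : Word → Word → ℂ
  F p q = δ (weight p ℕ.≟ suc a) * star (λ w → g (p ++ w)) u q

Φ-S♯ : ∀ m (f : Word → ℂ) → ∫ (Φ (letter m)) f ≈ ∫ (S♯ m) f
Φ-S♯ m f = begin
  ∫ (Φ (letter m)) f
    ≈⟨ ≈-reflexive (cong (λ v → ∫ (Φ v) f) (sym (List.++-identityʳ (letter m)))) ⟩
  ∫ (Φ (letter m ++ [])) f
    ≈⟨ ∫-Φ-letter m [] f ⟩
  conv m (λ i j → ε i * ∫ (Φ []) (λ w → f (ones i ++ letter j ++ w)))
    ≈⟨ conv-cong m (λ i j → *-congˡ (≈-trans (∫-Φ-[] (λ w → f (ones i ++ letter j ++ w)))
         (≈-reflexive (cong (f ∘ (ones i ++_)) (List.++-identityʳ (letter j)))))) ⟩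
  conv m (λ i j → ε i * f (ones i ++ letter j))
    ≈⟨ ∫-S♯ m f ⟨
  ∫ (S♯ m) f ∎
  where open ≈-Reasoning

-- Since `S♯ m` is the image of S_m under Φ and S_m is a right unit, multiplying by it on the right
-- applies Φ to the words of weight `m`. This identifies `D⁰ m` with an image of Φ.
∫-⊛S♯ : ∀ F m (f : Word → ℂ) → ∫ (F ⊛ S♯ m) f ≈ ∫ F (λ u → δ (weight u ℕ.≟ m) * ∫ (Φ u) f)
∫-⊛S♯ F m f = ≈-trans (∫-⊛ F (S♯ m) f) (∫-cong F (λ u → begin
  ∫ (S♯ m) (star f u)  ≈⟨ Φ-S♯ m (star f u) ⟨
  ∫ (Φ (letter m)) (star f u)  ≈⟨ star-Φʳ f u (letter m) ⟩
  star (λ w → ∫ (Φ w) f) u (letter m)  ≈⟨ star-letterʳ _ u m ⟩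
  δ (weight u ℕ.≟ m) * ∫ (Φ u) f ∎))
  where open ≈-Reasoning

coeff-⊕ : ∀ X Y w → coeff (X ⊕ Y) w ≈ coeff X w + coeff Y w
coeff-⊕ X Y w = ≈-trans (coeff-∫ (X ⊕ Y) w) (≈-trans (∫-⊕ X Y _) (≈-sym (+-cong (coeff-∫ X w) (coeff-∫ Y w))))

coeff-• : ∀ a X w → coeff (a • X) w ≈ a * coeff X w
coeff-• a X w = ≈-trans (coeff-∫ (a • X) w) (≈-trans (∫-• a X _) (*-congˡ (≈-sym (coeff-∫ X w))))

weight-split : ∀ i l u {j} → i ℕ.+ l ≡ j → i ℕ.+ weight (letter l ++ u) ≡ j ℕ.+ weight u
weight-split i l u i+l≡j = trans
  (cong (i ℕ.+_) (trans (weight-++ (letter l) u) (cong (ℕ._+ weight u) (weight-letter l))))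
  (trans (sym (ℕ.+-assoc i l (weight u))) (cong (ℕ._+ weight u) i+l≡j))

degrees : ℕ → ℕ → List ℕ
degrees n k = upTo (suc (k ⊓ n))

module _ {n k : ℕ} where

  total-sum : (ℕ → Sym) → Sym
  total-sum Y = ∑ (degrees n k) (λ j → S j · Y j)

  D-resp : ∀ X Y → (∀ f → ∫ X f ≈ ∫ Y f) → D n k X → D n k Y
  D-resp X Y X≐Y (Z , Z∈ , X≋) = Z , Z∈ , ∫⇒≋ Y (total-sum Z) λ f → ≈-trans (≈-sym (X≐Y f)) (≋⇒∫ X (total-sum Z) X≋ f)

  D-[] : D n k []
  D-[] = (λ _ → []) , (λ j _ → [] , (λ _ _ → ≈-refl) , λ _ → ≈-refl) ,
    ∫⇒≋ [] (total-sum (λ _ → [])) λ f → ≈-sym (≈-trans (∫-∑ (degrees n k) (λ j → S j · []) f)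
      (∑ℂ-≈0 (degrees n k) (λ j → ≈-trans (∫-· (S j) [] f) (∫-0 (S j)))))

  D-⊕ : ∀ X X′ → D n k X → D n k X′ → D n k (X ⊕ X′)
  D-⊕ X X′ (Y , Y∈ , X≋) (Y′ , Y′∈ , X′≋) = (λ j → Y j ⊕ Y′ j) , (λ j j≤ → closed (Y j) (Y′ j) (Y∈ j j≤) (Y′∈ j j≤)) ,
    ∫⇒≋ (X ⊕ X′) (total-sum (λ j → Y j ⊕ Y′ j)) λ f → begin
      ∫ (X ⊕ X′) f
        ≈⟨ ∫-⊕ X X′ f ⟩
      ∫ X f + ∫ X′ f
        ≈⟨ +-cong (≈-trans (≋⇒∫ X (total-sum Y) X≋ f) (∫-∑ (degrees n k) (λ j → S j · Y j) f)) (≈-trans (≋⇒∫ X′ (total-sum Y′) X′≋ f) (∫-∑ (degrees n k) (λ j → S j · Y′ j) f)) ⟩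
      ∑ℂ (degrees n k) (λ j → ∫ (S j · Y j) f) + ∑ℂ (degrees n k) (λ j → ∫ (S j · Y′ j) f)
        ≈⟨ ∑ℂ-+ (degrees n k) _ _ ⟨
      ∑ℂ (degrees n k) (λ j → ∫ (S j · Y j) f + ∫ (S j · Y′ j) f)
        ≈⟨ ∑ℂ-cong (degrees n k) (λ j → ≈-trans (+-cong (∫-· (S j) (Y j) f) (∫-· (S j) (Y′ j) f)) (≈-sym (≈-trans (∫-· (S j) (Y j ⊕ Y′ j) f)
             (≈-trans (∫-cong (S j) (λ u → ∫-⊕ (Y j) (Y′ j) _)) (∫-+ (S j) _ _))))) ⟩
      ∑ℂ (degrees n k) (λ j → ∫ (S j · (Y j ⊕ Y′ j)) f)
        ≈⟨ ∫-∑ (degrees n k) (λ j → S j · (Y j ⊕ Y′ j)) f ⟨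
      ∫ (∑ (degrees n k) (λ j → S j · (Y j ⊕ Y′ j))) f ∎
    where
    open ≈-Reasoning
    closed : ∀ {m} Y Y′ → D⁰ m Y → D⁰ m Y′ → D⁰ m (Y ⊕ Y′)
    closed {m} Y Y′ (F , F-hom , Y≋) (F′ , F′-hom , Y′≋) = F ⊕ F′ ,
      (λ w w≢m → ≈-trans (coeff-⊕ F F′ w) (≈-trans (+-cong (F-hom w w≢m) (F′-hom w w≢m)) (+-identityˡ _))) ,
      ∫⇒≋ (Y ⊕ Y′) ((F ⊕ F′) ⊛ S♯ m) λ f → begin
        ∫ (Y ⊕ Y′) f
          ≈⟨ ∫-⊕ Y Y′ f ⟩
        ∫ Y f + ∫ Y′ f
          ≈⟨ +-cong (≈-trans (≋⇒∫ Y (F ⊛ S♯ m) Y≋ f) (∫-⊛ F (S♯ m) f)) (≈-trans (≋⇒∫ Y′ (F′ ⊛ S♯ m) Y′≋ f) (∫-⊛ F′ (S♯ m) f)) ⟩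
        ∫ F (λ u → ∫ (S♯ m) (star f u)) + ∫ F′ (λ u → ∫ (S♯ m) (star f u))
          ≈⟨ ≈-trans (∫-⊛ (F ⊕ F′) (S♯ m) f) (∫-⊕ F F′ _) ⟨
        ∫ ((F ⊕ F′) ⊛ S♯ m) f ∎

  D-• : ∀ a X → D n k X → D n k (a • X)
  D-• a X (Y , Y∈ , X≋) = (λ j → a • Y j) , (λ j j≤ → closed (Y j) (Y∈ j j≤)) ,
    ∫⇒≋ (a • X) (total-sum (λ j → a • Y j)) λ f → begin
      ∫ (a • X) f
        ≈⟨ ∫-• a X f ⟩
      a * ∫ X f
        ≈⟨ *-congˡ (≈-trans (≋⇒∫ X (total-sum Y) X≋ f) (∫-∑ (degrees n k) (λ j → S j · Y j) f)) ⟩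
      a * ∑ℂ (degrees n k) (λ j → ∫ (S j · Y j) f)
        ≈⟨ ∑ℂ-* a (degrees n k) _ ⟩
      ∑ℂ (degrees n k) (λ j → a * ∫ (S j · Y j) f)
        ≈⟨ ∑ℂ-cong (degrees n k) (λ j → ≈-trans (*-congˡ (∫-· (S j) (Y j) f)) (≈-sym (≈-trans (∫-· (S j) (a • Y j) f)
             (≈-trans (∫-cong (S j) (λ u → ∫-• a (Y j) _)) (≈-sym (∫-* a (S j) _)))))) ⟩
      ∑ℂ (degrees n k) (λ j → ∫ (S j · a • Y j) f)
        ≈⟨ ∫-∑ (degrees n k) (λ j → S j · a • Y j) f ⟨
      ∫ (∑ (degrees n k) (λ j → S j · a • Y j)) f ∎
    where
    open ≈-Reasoning
    closed : ∀ {m} Y → D⁰ m Y → D⁰ m (a • Y)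
    closed {m} Y (F , F-hom , Y≋) = a • F ,
      (λ w w≢m → ≈-trans (coeff-• a F w) (≈-trans (*-congˡ (F-hom w w≢m)) (zeroʳ a))) ,
      ∫⇒≋ (a • Y) ((a • F) ⊛ S♯ m) λ f → begin
        ∫ (a • Y) f  ≈⟨ ∫-• a Y f ⟩
        a * ∫ Y f  ≈⟨ *-congˡ (≈-trans (≋⇒∫ Y (F ⊛ S♯ m) Y≋ f) (∫-⊛ F (S♯ m) f)) ⟩
        a * ∫ F (λ u → ∫ (S♯ m) (star f u))  ≈⟨ ≈-trans (∫-⊛ (a • F) (S♯ m) f) (∫-• a F _) ⟨
        ∫ ((a • F) ⊛ S♯ m) f ∎

  D-∑ : {A : Set} (xs : List A) (X : A → Sym) → All (λ x → D n k (X x)) xs → D n k (∑ xs X)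
  D-∑ []       X []         = D-[]
  D-∑ (x ∷ xs) X (X∈ ∷ Xs∈) = D-⊕ (X x) (∑ xs X) X∈ (D-∑ xs X Xs∈)

  D-SΦ : ∀ j u → j ℕ.≤ k ⊓ n → j ℕ.+ weight u ≡ n → D n k (S j · Φ u)
  -- A single component is nonzero. At the other indices the coefficient `δ (j ≟ i)` is 0, which
  -- also makes the one-term `F` homogeneous of the degree required there.
  D-SΦ j u j≤k⊓n j+u≡n = (λ i → δ (j ℕ.≟ i) • Φ u) , (λ i _ → component i) ,
    ∫⇒≋ (S j · Φ u) (total-sum (λ i → δ (j ℕ.≟ i) • Φ u)) λ f → begin
      ∫ (S j · Φ u) f
        ≈⟨ ∑ℂ-pick ℕ._≟_ (λ i → ∫ (S i · Φ u) f) (Unique.upTo⁺ (suc (k ⊓ n))) (∈-upTo⁺ (s≤s j≤k⊓n)) ⟨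
      ∑ℂ (degrees n k) (λ i → δ (j ℕ.≟ i) * ∫ (S i · Φ u) f)
        ≈⟨ ∑ℂ-cong (degrees n k) (λ i → ≈-trans (*-congˡ (∫-· (S i) (Φ u) f)) (≈-trans (∫-* _ (S i) _)
             (≈-sym (≈-trans (∫-· (S i) (δ (j ℕ.≟ i) • Φ u) f) (∫-cong (S i) (λ v → ∫-• _ (Φ u) _)))))) ⟩
      ∑ℂ (degrees n k) (λ i → ∫ (S i · δ (j ℕ.≟ i) • Φ u) f)
        ≈⟨ ∫-∑ (degrees n k) (λ i → S i · δ (j ℕ.≟ i) • Φ u) f ⟨
      ∫ (∑ (degrees n k) (λ i → S i · δ (j ℕ.≟ i) • Φ u)) f ∎
    where
    open ≈-Reasoning
    u≡n∸j : weight u ≡ n ∸ j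
    u≡n∸j = trans (sym (ℕ.m+n∸m≡n j (weight u))) (cong (_∸ j) j+u≡n)
    component : ∀ i → D⁰ (n ∸ i) (δ (j ℕ.≟ i) • Φ u)
    component i = (δ (j ℕ.≟ i) , u) ∷ [] , homogeneous , ∫⇒≋ (δ (j ℕ.≟ i) • Φ u) (((δ (j ℕ.≟ i) , u) ∷ []) ⊛ S♯ (n ∸ i)) λ f → begin
      ∫ (δ (j ℕ.≟ i) • Φ u) f
        ≈⟨ ∫-• (δ (j ℕ.≟ i)) (Φ u) f ⟩
      δ (j ℕ.≟ i) * ∫ (Φ u) f
        ≈⟨ δ-cong (j ℕ.≟ i) (λ { refl → ≈-sym (δ-yes-* (weight u ℕ.≟ n ∸ j) u≡n∸j) }) ⟩
      δ (j ℕ.≟ i) * (δ (weight u ℕ.≟ n ∸ i) * ∫ (Φ u) f)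
        ≈⟨ +-identityʳ _ ⟨
      δ (j ℕ.≟ i) * (δ (weight u ℕ.≟ n ∸ i) * ∫ (Φ u) f) + 0#
        ≈⟨ ∫-⊛S♯ ((δ (j ℕ.≟ i) , u) ∷ []) (n ∸ i) f ⟨
      ∫ (((δ (j ℕ.≟ i) , u) ∷ []) ⊛ S♯ (n ∸ i)) f ∎
      where
      homogeneous : IsHomogeneous (n ∸ i) ((δ (j ℕ.≟ i) , u) ∷ [])
      homogeneous w w≢n∸i = ≈-trans (coeff-∫ ((δ (j ℕ.≟ i) , u) ∷ []) w) (≈-trans (+-identityʳ _) (≈-trans
        (δ-cong (j ℕ.≟ i) (λ { refl → δ-no (u ≟ʷ w) (λ { refl → w≢n∸i u≡n∸j }) })) (zeroʳ _)))

  -- By `S-Φ`, the element S_j · Φ u of the algebra is `basis j u` plus basis elements with a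
  -- smaller power of S₁, so the relation can be solved for `basis j u`.
  D-basis : ∀ j u → j ℕ.≤ k ⊓ n → j ℕ.+ weight u ≡ n → D n k (basis j u)
  D-basis j u = up-to j j u ℕ.≤-refl
    where
    -- The smaller exponents come out of a list, so the recursion runs on a bound `m` for the
    -- exponent.
    up-to : ∀ m j u → j ℕ.≤ m → j ℕ.≤ k ⊓ n → j ℕ.+ weight u ≡ n → D n k (basis j u)
    up-to m zero u _ 0≤ u≡n = D-resp (S 0 · Φ u) (basis 0 u) (λ f → ≈-trans (∫-· (S 0) (Φ u) f)
      (≈-trans (∫-S 0 (λ v → ∫ (Φ u) (f ∘ (v ++_)))) (≈-trans (≈-sym (S-Φ 0 u f)) (+-identityʳ _)))) (D-SΦ 0 u 0≤ u≡n)
    up-to (suc m) (suc j) u (s≤s j≤m) 1+j≤ 1+j+u≡n = D-resp (S (suc j) · Φ u ⊕ - 1# • smaller) (basis (suc j) u) triangular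
      (D-⊕ (S (suc j) · Φ u) (- 1# • smaller) (D-SΦ (suc j) u 1+j≤ 1+j+u≡n)
        (D-• (- 1#) smaller (D-∑ (splits j) (λ (i , l) → basis i (l ∷ u)) (All.map (λ {(i , l)} → smaller-D i l) (splits-sum j)))))
      where
      open ≈-Reasoning
      smaller : Sym
      smaller = ∑ (splits j) (λ (i , l) → basis i (l ∷ u))
      smaller-D : ∀ i l → i ℕ.+ l ≡ j → D n k (basis i (l ∷ u))
      smaller-D i l i+l≡j = up-to m i (l ∷ u) (ℕ.≤-trans i≤j j≤m) (ℕ.≤-trans (ℕ.m≤n⇒m≤1+n i≤j) 1+j≤) (trans (weight-split i (suc l) u (trans (ℕ.+-suc i l) (cong suc i+l≡j))) 1+j+u≡n)
        where
        i≤j : i ℕ.≤ j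
        i≤j = ℕ.≤-trans (ℕ.m≤m+n i l) (ℕ.≤-reflexive i+l≡j)
      triangular : ∀ f → ∫ (S (suc j) · Φ u ⊕ - 1# • smaller) f ≈ ∫ (basis (suc j) u) f
      triangular f = begin
        ∫ (S (suc j) · Φ u ⊕ - 1# • smaller) f
          ≈⟨ ≈-trans (∫-⊕ (S (suc j) · Φ u) (- 1# • smaller) f) (+-cong
               (≈-trans (∫-· (S (suc j)) (Φ u) f) (∫-S (suc j) (λ v → ∫ (Φ u) (f ∘ (v ++_))))) (∫-• (- 1#) smaller f)) ⟩
        ∫ (Φ u) (f ∘ (j ∷_)) + - 1# * ∫ smaller f
          ≈⟨ +-cong (≈-trans (≈-sym (S-Φ (suc j) u f)) (conv-last j (λ i l → ∫ (basis i (letter l ++ u)) f)))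
                    (*-congˡ (∫-∑ (splits j) _ f)) ⟩
        (L + ∫ (basis (suc j) u) f) + - 1# * L
          ≈⟨ +-cong (+-comm _ _) (≈-trans (≈-sym (-‿distribˡ-* 1# L)) (-‿cong (*-identityˡ L))) ⟩
        (∫ (basis (suc j) u) f + L) + - L
          ≈⟨ ≈-trans (+-assoc _ _ _) (≈-trans (+-congˡ (-‿inverseʳ L)) (+-identityʳ _)) ⟩
        ∫ (basis (suc j) u) f ∎
        where
        L : ℂ
        L = conv j (λ i l → ∫ (basis i (l ∷ u)) f)

-- (j , u) is the index of basis j u.
Index : Set
Index = ℕ × Word

Valid : ℕ → ℕ → Index → Set
Valid n k (j , u) = j ℕ.≤ k ⊓ n × j ℕ.+ weight u ≡ n

comb : List (ℂ × Index) → Sym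
comb Z = ∑ Z (λ (c , j , u) → c • basis j u)

∫-comb : ∀ Z (f : Word → ℂ) → ∫ (comb Z) f ≈ ∫ Z (λ (j , u) → ∫ (basis j u) f)
∫-comb Z f = ≈-trans (∫-∑ Z (λ (c , j , u) → c • basis j u) f) (∑ℂ-cong Z (λ (c , j , u) → ∫-• c (basis j u) f))

module _ {n k : ℕ} where

  D-comb : ∀ Z → All (Valid n k ∘ proj₂) Z → D n k (comb Z)
  D-comb Z valid = D-∑ Z (λ (c , j , u) → c • basis j u) (All.map (λ {(c , j , u)} (j≤ , eq) → D-• c (basis j u) (D-basis j u j≤ eq)) valid)

  InSpan : Sym → Set
  InSpan X = ∃ λ Z → All (Valid n k ∘ proj₂) Z × (∀ f → ∫ X f ≈ ∫ (comb Z) f)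

  span-resp : ∀ X Y → (∀ f → ∫ X f ≈ ∫ Y f) → InSpan Y → InSpan X
  span-resp X Y X≐Y (Z , valid , Y≐) = Z , valid , λ f → ≈-trans (X≐Y f) (Y≐ f)

  span-[] : InSpan []
  span-[] = [] , [] , λ _ → ≈-refl

  span-⊕ : ∀ X Y → InSpan X → InSpan Y → InSpan (X ⊕ Y)
  span-⊕ X Y (Z , valid , X≐) (Z′ , valid′ , Y≐) = Z ++ Z′ , All.++⁺ valid valid′ , λ f → begin
    ∫ (X ⊕ Y) f  ≈⟨ ∫-⊕ X Y f ⟩
    ∫ X f + ∫ Y f  ≈⟨ +-cong (≈-trans (X≐ f) (∫-comb Z f)) (≈-trans (Y≐ f) (∫-comb Z′ f)) ⟩
    ∫ Z (λ (j , u) → ∫ (basis j u) f) + ∫ Z′ (λ (j , u) → ∫ (basis j u) f)  ≈⟨ ∑ℂ-++ Z Z′ _ ⟨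
    ∫ (Z ++ Z′) (λ (j , u) → ∫ (basis j u) f)  ≈⟨ ∫-comb (Z ++ Z′) f ⟨
    ∫ (comb (Z ++ Z′)) f ∎
    where open ≈-Reasoning

  span-∑ : {A : Set} (xs : List A) (X : A → Sym) → All (λ x → InSpan (X x)) xs → InSpan (∑ xs X)
  span-∑ []       X []         = span-[]
  span-∑ (x ∷ xs) X (X∈ ∷ Xs∈) = span-⊕ (X x) (∑ xs X) X∈ (span-∑ xs X Xs∈)

  span-basis : ∀ c j u → Valid n k (j , u) → InSpan (c • basis j u)
  span-basis c j u valid = (c , j , u) ∷ [] , valid ∷ [] , λ f → ≈-sym (≈-trans (∫-⊕ (c • basis j u) [] f) (+-identityʳ _))

  -- Each element of `D⁰` is Φ applied to some `F` by `∫-⊛S♯`, and `S-Φ` expands S_j · Φ u into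
  -- basis elements whose exponents are at most `j`.
  D⇒span : ∀ X → D n k X → InSpan X
  D⇒span X (Y , Y∈ , X≋) = span-resp X (total-sum {n} {k} Y) (≋⇒∫ X (total-sum {n} {k} Y) X≋)
    (span-∑ (degrees n k) (λ j → S j · Y j) (All.tabulate (λ {j} j∈ → summand (Y j) (ℕ.s≤s⁻¹ (∈-upTo⁻ j∈)) (Y∈ j (ℕ.s≤s⁻¹ (∈-upTo⁻ j∈))))))
    where
    open ≈-Reasoning
    summand : ∀ {j} Y → j ℕ.≤ k ⊓ n → D⁰ (n ∸ j) Y → InSpan (S j · Y)
    summand {j} Y j≤ (F , _ , Y≋) = span-resp (S j · Y) (∑ F T) expand
      (span-∑ F T (All.universal (λ (c , u) → by-weight c u (weight u ℕ.≟ n ∸ j)) F))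
      where
      -- The list `F` may contain words of other weights with cancelling coefficients. `∫-⊛S♯` gives
      -- them the factor 0, so they are dropped.
      term : {P : Set} → Dec P → ℂ → Word → Sym
      term (yes _) c u = ∑ (splits j) (λ (i , l) → c • basis i (letter l ++ u))
      term (no _)  c u = []
      T : ℂ × Word → Sym
      T (c , u) = term (weight u ℕ.≟ n ∸ j) c u
      ∫-term : {P : Set} (e : Dec P) → ∀ c u f → ∫ (term e c u) f ≈ c * (δ e * ∫ (Φ u) (f ∘ (letter j ++_)))
      ∫-term (no _)  c u f = ≈-sym (≈-trans (*-congˡ (zeroˡ _)) (zeroʳ c))
      ∫-term (yes _) c u f = begin
        ∫ (∑ (splits j) (λ (i , l) → c • basis i (letter l ++ u))) f
          ≈⟨ ∫-∑ (splits j) _ f ⟩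
        conv j (λ i l → ∫ (c • basis i (letter l ++ u)) f)
          ≈⟨ conv-cong j (λ i l → ∫-• c (basis i (letter l ++ u)) f) ⟩
        conv j (λ i l → c * ∫ (basis i (letter l ++ u)) f)
          ≈⟨ conv-* c j _ ⟨
        c * conv j (λ i l → ∫ (basis i (letter l ++ u)) f)
          ≈⟨ *-congˡ (≈-trans (S-Φ j u f) (≈-sym (*-identityˡ _))) ⟩
        c * (1# * ∫ (Φ u) (f ∘ (letter j ++_))) ∎
      expand : ∀ f → ∫ (S j · Y) f ≈ ∫ (∑ F T) f
      expand f = begin
        ∫ (S j · Y) f
          ≈⟨ ≈-trans (∫-· (S j) Y f) (∫-S j (λ v → ∫ Y (f ∘ (v ++_)))) ⟩
        ∫ Y (f ∘ (letter j ++_))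
          ≈⟨ ≈-trans (≋⇒∫ Y (F ⊛ S♯ (n ∸ j)) Y≋ _) (∫-⊛S♯ F (n ∸ j) _) ⟩
        ∫ F (λ u → δ (weight u ℕ.≟ n ∸ j) * ∫ (Φ u) (f ∘ (letter j ++_)))
          ≈⟨ ∑ℂ-cong F (λ (c , u) → ≈-sym (∫-term (weight u ℕ.≟ n ∸ j) c u f)) ⟩
        ∑ℂ F (λ cu → ∫ (T cu) f)
          ≈⟨ ∫-∑ F T f ⟨
        ∫ (∑ F T) f ∎
      by-weight : ∀ c u → (e : Dec (weight u ≡ n ∸ j)) →
        InSpan (term e c u)
      by-weight c u (no _) = span-[]
      by-weight c u (yes u≡n∸j) = span-∑ (splits j) (λ (i , l) → c • basis i (letter l ++ u))
        (All.map (λ {(i , l)} i+l≡j → span-basis c i (letter l ++ u) (ℕ.≤-trans (i≤ i l i+l≡j) j≤ , adds-up i l i+l≡j)) (splits-sum j))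
        where
        i≤ : ∀ i l → i ℕ.+ l ≡ j → i ℕ.≤ j
        i≤ i l i+l≡j = ℕ.≤-trans (ℕ.m≤m+n i l) (ℕ.≤-reflexive i+l≡j)
        adds-up : ∀ i l → i ℕ.+ l ≡ j → i ℕ.+ weight (letter l ++ u) ≡ n
        adds-up i l i+l≡j = trans (weight-split i l u i+l≡j)
          (trans (cong (j ℕ.+_) u≡n∸j) (ℕ.m+[n∸m]≡n (ℕ.≤-trans j≤ (ℕ.m⊓n≤n k n))))

  unitTerms : List (ℂ × Index)
  unitTerms = map (λ i → 1# , i , letter (n ∸ i)) (degrees n k)

  unitTerms-valid : All (Valid n k ∘ proj₂) unitTerms
  unitTerms-valid = All.map⁺ (All.tabulate λ {i} i∈ → let i≤ = ℕ.s≤s⁻¹ (∈-upTo⁻ i∈) in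
    i≤ , trans (cong (i ℕ.+_) (weight-letter (n ∸ i))) (ℕ.m+[n∸m]≡n (ℕ.≤-trans i≤ (ℕ.m⊓n≤n k n))))

  ∫-unit : ∀ f → ∫ (unit n k) f ≈ ∑ℂ (degrees n k) (λ i → ∫ (basis i (letter (n ∸ i))) f)
  ∫-unit f = ≈-trans (∫-∑ (degrees n k) (λ i → 1/ i ! • S 1 ^ i · S♯ (n ∸ i)) f)
    (∑ℂ-cong (degrees n k) (λ i → begin
      ∫ (1/ i ! • S 1 ^ i · S♯ (n ∸ i)) f
        ≈⟨ ≈-trans (∫-• (1/ i !) (S 1 ^ i · S♯ (n ∸ i)) f) (*-congˡ
             (≈-trans (∫-· (S 1 ^ i) (S♯ (n ∸ i)) f) (∫-S₁^ i (λ p → ∫ (S♯ (n ∸ i)) (f ∘ (p ++_)))))) ⟩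
      1/ i ! * ∫ (S♯ (n ∸ i)) (f ∘ (ones i ++_))
        ≈⟨ *-congˡ (Φ-S♯ (n ∸ i) _) ⟨
      1/ i ! * ∫ (Φ (letter (n ∸ i))) (f ∘ (ones i ++_))
        ≈⟨ ∫-basis i (letter (n ∸ i)) f ⟨
      ∫ (basis i (letter (n ∸ i))) f ∎))
    where open ≈-Reasoning

  unit-comb : ∀ f → ∫ (unit n k) f ≈ ∫ (comb unitTerms) f
  unit-comb f = ≈-trans (∫-unit f) (≈-sym (≈-trans (∫-comb unitTerms f) (≈-trans
    (∑ℂ-map _ (degrees n k) _) (∑ℂ-cong (degrees n k) (λ i → *-identityˡ _)))))

-- Inverses in ℂ

lower-excluded-middle : ∀ {ℓ} → ExcludedMiddle ℓ → ExcludedMiddle 0ℓ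
lower-excluded-middle {ℓ} em {P} = map′ lower lift (em {Lift ℓ P})

1≉0 : ¬ 1# ≈ 0#
1≉0 1≈0 = let N , small = null (_≈_.re≈ 1≈0) ½ (ℚ.positive⁻¹ ½) in
  toWitnessFalse {a? = ∣ 1ℚ ℚ.- 0ℚ ∣ ℚ.<? ½} _ (small N ℕ.≤-refl)

nat-suc≉0 : ∀ n → ¬ nat (suc n) ≈ 0#
nat-suc≉0 n eq = 1≉0 (≈-trans (≈-sym (nat-inverse (suc n))) (≈-trans (*-congˡ eq) (zeroʳ _)))

BoundedAway : (ℕ → ℚ) → Set
BoundedAway s = ∃ λ ε → 0ℚ ℚ.< ε × ∃ λ N → ∀ n → N ℕ.≤ n → ε ℚ.≤ ∣ s n ∣

vanishes-eventually : {I : Set} {d : I → ℕ} {f g : I → ℚ} (M : ℕ) → (∀ i → M ℕ.≤ d i → f i ≡ g i) →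
  Vanishes d f → Vanishes d g
vanishes-eventually M f≡g f→0 ε 0<ε = let N , small = f→0 ε 0<ε in
  M ℕ.⊔ N , λ i M⊔N≤ → subst (λ q → ∣ q ∣ ℚ.< ε) (f≡g i (ℕ.m⊔n≤o⇒m≤o M N M⊔N≤)) (small i (ℕ.m⊔n≤o⇒n≤o M N M⊔N≤))

-- The value 0 at 0 is a default: a sequence bounded away from 0 may still have finitely many zero
-- terms at its beginning.
recip : ℚ → ℚ
recip q with q ℚ.≟ 0ℚ
... | yes _  = 0ℚ
... | no q≢0 = (ℚ.1/ q) {{ℚ.≢-nonZero q≢0}}

recip-inverse : ∀ {q} → q ≢ 0ℚ → recip q ℚ.* q ≡ 1ℚ
recip-inverse {q} q≢0 with q ℚ.≟ 0ℚ
... | yes q≡0 = ⊥-elim (q≢0 q≡0)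
... | no q≢0  = ℚ.*-inverseˡ q {{ℚ.≢-nonZero q≢0}}

positive-abs : ∀ {q ε} → 0ℚ ℚ.< ε → ε ℚ.≤ ∣ q ∣ → q ≢ 0ℚ
positive-abs 0<ε ε≤ refl = ℚ.<-irrefl refl (ℚ.<-≤-trans 0<ε ε≤)

recip-bound : ∀ {q ε} → 0ℚ ℚ.< ε → ε ℚ.≤ ∣ q ∣ → ∣ recip q ∣ ℚ.≤ recip ε
recip-bound {q} {ε} 0<ε ε≤q = begin
  ∣ recip q ∣  ≡⟨ ℚ.*-identityʳ _ ⟨
  ∣ recip q ∣ ℚ.* 1ℚ  ≡⟨ cong (∣ recip q ∣ ℚ.*_) (trans (ℚ.*-comm ε (recip ε)) recip-ε) ⟨
  ∣ recip q ∣ ℚ.* (ε ℚ.* recip ε)  ≡⟨ ℚ.*-assoc ∣ recip q ∣ ε (recip ε) ⟨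
  ∣ recip q ∣ ℚ.* ε ℚ.* recip ε  ≤⟨ ℚ.*-monoʳ-≤-nonNeg (recip ε) {{recip-ε-nonNeg}} (ℚ.*-monoˡ-≤-nonNeg ∣ recip q ∣ {{ℚ.∣-∣-nonNeg (recip q)}} ε≤q) ⟩
  ∣ recip q ∣ ℚ.* ∣ q ∣ ℚ.* recip ε  ≡⟨ cong (ℚ._* recip ε) (sym (ℚ.∣p*q∣≡∣p∣*∣q∣ (recip q) q)) ⟩
  ∣ recip q ℚ.* q ∣ ℚ.* recip ε  ≡⟨ cong (λ r → ∣ r ∣ ℚ.* recip ε) (recip-inverse (positive-abs 0<ε ε≤q)) ⟩
  1ℚ ℚ.* recip ε  ≡⟨ ℚ.*-identityˡ _ ⟩
  recip ε ∎
  where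
  open ℚ.≤-Reasoning
  ε≢0 : ε ≢ 0ℚ
  ε≢0 refl = ℚ.<-irrefl refl 0<ε
  recip-ε : recip ε ℚ.* ε ≡ 1ℚ
  recip-ε = recip-inverse ε≢0
  recip-ε-nonNeg : ℚ.NonNegative (recip ε)
  recip-ε-nonNeg with ε ℚ.≟ 0ℚ
  ... | yes ε≡0 = ⊥-elim (ε≢0 ε≡0)
  ... | no ε≢0  = ℚ.pos⇒nonNeg ((ℚ.1/ ε) {{ℚ.≢-nonZero ε≢0}}) {{ℚ.1/pos⇒pos ε {{ℚ.positive 0<ε}}}}

-- Writes a difference of reciprocals as bounded factors times a difference of the original terms,
-- the form to which `vanishes-*` applies.
recip-diff : ∀ {p q} → p ≢ 0ℚ → q ≢ 0ℚ → recip p ℚ.* (recip q ℚ.* (q ℚ.- p)) ≡ recip p ℚ.- recip q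
recip-diff {p} {q} p≢0 q≢0 = begin
  recip p ℚ.* (recip q ℚ.* (q ℚ.- p))
    ≡⟨ expand (recip p) (recip q) p q ⟩
  recip p ℚ.* (recip q ℚ.* q) ℚ.- recip q ℚ.* (recip p ℚ.* p)
    ≡⟨ cong₂ (λ x y → recip p ℚ.* x ℚ.- recip q ℚ.* y) (recip-inverse q≢0) (recip-inverse p≢0) ⟩
  recip p ℚ.* 1ℚ ℚ.- recip q ℚ.* 1ℚ
    ≡⟨ cong₂ ℚ._-_ (ℚ.*-identityʳ (recip p)) (ℚ.*-identityʳ (recip q)) ⟩
  recip p ℚ.- recip q ∎
  where
  open ≡-Reasoning
  open +-*-Solver using (solve; _:=_; _:*_; _:-_)
  expand : ∀ r s p q → r ℚ.* (s ℚ.* (q ℚ.- p)) ≡ r ℚ.* (s ℚ.* q) ℚ.- s ℚ.* (r ℚ.* p)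
  expand = solve 4 (λ r s p q → r :* (s :* (q :- p)) := r :* (s :* q) :- s :* (r :* p)) refl

module _ (x : ℝ) (x≉0 : BoundedAway (seq x)) where
  private
    lower-bound : ℚ
    lower-bound = proj₁ x≉0
    0<lower-bound : 0ℚ ℚ.< lower-bound
    0<lower-bound = proj₁ (proj₂ x≉0)
    N : ℕ
    N = proj₁ (proj₂ (proj₂ x≉0))
    beyond : ∀ n → N ℕ.≤ n → lower-bound ℚ.≤ ∣ seq x n ∣
    beyond = proj₂ (proj₂ (proj₂ x≉0))
    seq≢0 : ∀ n → N ℕ.≤ n → seq x n ≢ 0ℚ
    seq≢0 n N≤n = positive-abs 0<lower-bound (beyond n N≤n)
    bound : ℚ
    bound = recip lower-bound ℚ.+ 1ℚ
    recip<bound : ∀ n → N ℕ.≤ n → ∣ recip (seq x n) ∣ ℚ.< bound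
    recip<bound n N≤n = ℚ.≤-<-trans (recip-bound 0<lower-bound (beyond n N≤n))
      (subst (ℚ._< bound) (ℚ.+-identityʳ _) (ℚ.+-monoʳ-< (recip lower-bound) (ℚ.positive⁻¹ 1ℚ)))
    0<bound : 0ℚ ℚ.< bound
    0<bound = ℚ.≤-<-trans (ℚ.0≤∣p∣ (recip (seq x N))) (recip<bound N ℕ.≤-refl)

  inverseᴿ : ℝ
  inverseᴿ .seq n = recip (seq x n)
  inverseᴿ .cauchy = vanishes-eventually N
    (λ (m , n) N≤ → recip-diff (seq≢0 m (ℕ.m≤n⊓o⇒m≤n m n N≤)) (seq≢0 n (ℕ.m≤n⊓o⇒m≤o m n N≤)))
    (vanishes-* {f = λ (m , n) → recip (seq x m)} {g = λ (m , n) → recip (seq x n) ℚ.* (seq x n ℚ.- seq x m)}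
      (bound , 0<bound , N , λ (m , n) N≤ → recip<bound m (ℕ.m≤n⊓o⇒m≤n m n N≤))
      (vanishes-* {f = λ (m , n) → recip (seq x n)} {g = λ (m , n) → seq x n ℚ.- seq x m}
        (bound , 0<bound , N , λ (m , n) N≤ → recip<bound n (ℕ.m≤n⊓o⇒m≤o m n N≤))
        (vanishes-cong (λ (m , n) → flip-diff (seq x m) (seq x n)) (vanishes-neg (cauchy x)))))
    where
    open +-*-Solver
    flip-diff : ∀ p q → ℚ.- (p ℚ.- q) ≡ q ℚ.- p
    flip-diff = solve 2 (λ p q → :- (p :- q) := q :- p) refl

  inverseᴿ-inverse : inverseᴿ *ᴿ x ≈ᴿ fromℚ 1ℚ
  inverseᴿ-inverse = mk≈ (vanishes-eventually N
    (λ n N≤n → sym (trans (cong (ℚ._- 1ℚ) (recip-inverse (seq≢0 n N≤n))) (ℚ.+-inverseʳ 1ℚ))) vanishes-0)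

module _ (em : ExcludedMiddle 0ℓ) where

  -- Classically, failing to be null gives an `ε` that terms of arbitrarily large index reach. Once
  -- the Cauchy oscillation is below `ε/2`, comparison with such a term keeps all later ones above
  -- `ε/2`.
  bounded-away : ∀ x → ¬ IsNull (seq x) → BoundedAway (seq x)
  bounded-away x ¬null with em {∃ λ ε → 0ℚ ℚ.< ε × (∀ N → ∃ λ n → N ℕ.≤ n × ¬ ∣ seq x n ∣ ℚ.< ε)}
  ... | no ¬large = ⊥-elim (¬null λ ε 0<ε → decidable-stable em λ ¬small → ¬large (ε , 0<ε , λ N →
          decidable-stable em λ ¬big → ¬small (N , λ n N≤n →
            decidable-stable (∣ seq x n ∣ ℚ.<? ε) λ x≮ε → ¬big (n , N≤n , x≮ε))))
  ... | yes (ε , 0<ε , large) = ε/2 , 0<ε/2 , N , λ n N≤n → ℚ.≮⇒≥ λ xₙ<ε/2 →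
          x₀≮ε (subst₂ (λ p q → ∣ p ∣ ℚ.< q) (diff-add (seq x n₀) (seq x n)) (half+half ε)
            (ℚ.≤-<-trans (ℚ.∣p+q∣≤∣p∣+∣q∣ (seq x n₀ ℚ.- seq x n) (seq x n))
              (ℚ.+-mono-< (close (n₀ , n) (ℕ.⊓-glb N≤n₀ N≤n)) xₙ<ε/2)))
    where
    open +-*-Solver
    ε/2 : ℚ
    ε/2 = ½ ℚ.* ε
    0<ε/2 : 0ℚ ℚ.< ε/2
    0<ε/2 = subst (ℚ._< ε/2) (ℚ.*-zeroʳ ½) (ℚ.*-monoʳ-<-pos ½ 0<ε)
    N : ℕ
    N = proj₁ (cauchy x ε/2 0<ε/2)
    close : ∀ ((m , n) : ℕ × ℕ) → N ℕ.≤ m ℕ.⊓ n → ∣ seq x m ℚ.- seq x n ∣ ℚ.< ε/2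
    close = proj₂ (cauchy x ε/2 0<ε/2)
    n₀ : ℕ
    n₀ = proj₁ (large N)
    N≤n₀ : N ℕ.≤ n₀
    N≤n₀ = proj₁ (proj₂ (large N))
    x₀≮ε : ¬ ∣ seq x n₀ ∣ ℚ.< ε
    x₀≮ε = proj₂ (proj₂ (large N))
    diff-add : ∀ p q → (p ℚ.- q) ℚ.+ q ≡ p
    diff-add = solve 2 (λ p q → (p :- q) :+ q := p) refl
    half+half : ∀ ε → ½ ℚ.* ε ℚ.+ ½ ℚ.* ε ≡ ε
    half+half = solve 1 (λ ε → con ½ :* ε :+ con ½ :* ε := ε) refl

  square-bounded-away : ∀ (s t : ℕ → ℚ) → BoundedAway s → BoundedAway (λ n → s n ℚ.* s n ℚ.+ t n ℚ.* t n)
  square-bounded-away s t (ε , 0<ε , N , ε≤) = ε ℚ.* ε , 0<ε² , N , λ n N≤n → begin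
    ε ℚ.* ε  ≤⟨ ℚ.*-monoˡ-≤-nonNeg ε {{ℚ.nonNegative (ℚ.<⇒≤ 0<ε)}} (ε≤ n N≤n) ⟩
    ε ℚ.* ∣ s n ∣  ≤⟨ ℚ.*-monoʳ-≤-nonNeg ∣ s n ∣ {{ℚ.∣-∣-nonNeg (s n)}} (ε≤ n N≤n) ⟩
    ∣ s n ∣ ℚ.* ∣ s n ∣  ≡⟨ square (s n) ⟩
    s n ℚ.* s n  ≡⟨ ℚ.+-identityʳ _ ⟨
    s n ℚ.* s n ℚ.+ 0ℚ  ≤⟨ ℚ.+-monoʳ-≤ (s n ℚ.* s n) (0≤square (t n)) ⟩
    s n ℚ.* s n ℚ.+ t n ℚ.* t n  ≡⟨ ℚ.0≤p⇒∣p∣≡p (ℚ.+-mono-≤ (0≤square (s n)) (0≤square (t n))) ⟨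
    ∣ s n ℚ.* s n ℚ.+ t n ℚ.* t n ∣ ∎
    where
    open ℚ.≤-Reasoning
    square : ∀ q → ∣ q ∣ ℚ.* ∣ q ∣ ≡ q ℚ.* q
    square q with ℚ.∣p∣≡p∨∣p∣≡-p q
    ... | inj₁ eq rewrite eq = refl
    ... | inj₂ eq rewrite eq = solve 1 (λ q → (:- q) :* (:- q) := q :* q) refl q
      where open +-*-Solver
    0≤square : ∀ q → 0ℚ ℚ.≤ q ℚ.* q
    0≤square q = subst (0ℚ ℚ.≤_) (square q) (ℚ.nonNegative⁻¹ (∣ q ∣ ℚ.* ∣ q ∣)
      {{ℚ.nonNeg*nonNeg⇒nonNeg (∣ q ∣) {{ℚ.∣-∣-nonNeg q}} (∣ q ∣) {{ℚ.∣-∣-nonNeg q}}}})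
    0<ε² : 0ℚ ℚ.< ε ℚ.* ε
    0<ε² = subst (ℚ._< ε ℚ.* ε) (ℚ.*-zeroʳ ε) (ℚ.*-monoʳ-<-pos ε {{ℚ.positive 0<ε}} 0<ε)

  norm : ℂ → ℝ
  norm z = re z *ᴿ re z +ᴿ im z *ᴿ im z

  norm-bounded-away : ∀ z → ¬ z ≈ 0# → BoundedAway (seq (norm z))
  norm-bounded-away z z≉0 with em {IsNull (seq (re z))} | em {IsNull (seq (im z))}
  ... | no re≉0 | _ = square-bounded-away (seq (re z)) (seq (im z)) (bounded-away (re z) re≉0)
  ... | yes _ | no im≉0 = let ε , 0<ε , N , ε≤ = square-bounded-away (seq (im z)) (seq (re z)) (bounded-away (im z) im≉0) in
        ε , 0<ε , N , λ n N≤n → subst (λ q → ε ℚ.≤ ∣ q ∣) (ℚ.+-comm (seq (im z) n ℚ.* seq (im z) n) _) (ε≤ n N≤n)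
  ... | yes re≈0 | yes im≈0 = ⊥-elim (z≉0 (≈0 re≈0 , ≈0 im≈0))
    where
    ≈0 : ∀ {x} → IsNull (seq x) → x ≈ᴿ fromℚ 0ℚ
    ≈0 {x} x→0 = mk≈ (vanishes-cong (λ n → sym (ℚ.+-identityʳ (seq x n))) x→0)

  inverse : ∀ z → ¬ z ≈ 0# → ∃ λ w → w * z ≈ 1#
  inverse z z≉0 = w , (re≈1 , im≈0)
    where
    open +-*-Solver
    r : ℝ
    r = inverseᴿ (norm z) (norm-bounded-away z z≉0)
    -- The conjugate of `z` divided by the square of its absolute value.
    w : ℂ
    w .re = r *ᴿ re z
    w .im = -ᴿ (r *ᴿ im z)
    re≈1 : re (w * z) ≈ᴿ fromℚ 1ℚ
    re≈1 = ≈ᴿ-trans (≈ᴿ-pointwise {re (w * z)} {r *ᴿ norm z} λ n → expand (seq r n) (seq (re z) n) (seq (im z) n))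
      (inverseᴿ-inverse (norm z) (norm-bounded-away z z≉0))
      where
      expand : ∀ r a b → r ℚ.* a ℚ.* a ℚ.- (ℚ.- (r ℚ.* b)) ℚ.* b ≡ r ℚ.* (a ℚ.* a ℚ.+ b ℚ.* b)
      expand = solve 3 (λ r a b → r :* a :* a :- (:- (r :* b)) :* b := r :* (a :* a :+ b :* b)) refl
    im≈0 : im (w * z) ≈ᴿ fromℚ 0ℚ
    im≈0 = ≈ᴿ-pointwise {im (w * z)} {fromℚ 0ℚ} λ n → cancel (seq r n) (seq (re z) n) (seq (im z) n)
      where
      cancel : ∀ r a b → r ℚ.* a ℚ.* b ℚ.+ (ℚ.- (r ℚ.* b)) ℚ.* a ≡ 0ℚ
      cancel = solve 3 (λ r a b → r :* a :* b :+ (:- (r :* b)) :* a := con 0ℚ) refl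

  *-cancelʳ : ∀ {z} x y → ¬ z ≈ 0# → x * z ≈ y * z → x ≈ y
  *-cancelʳ {z} x y z≉0 xz≈yz = ≈-trans (undo x) (≈-trans (*-congʳ xz≈yz) (≈-sym (undo y)))
    where
    w : ℂ
    w = proj₁ (inverse z z≉0)
    undo : ∀ x → x ≈ x * z * w
    undo x = ≈-sym (≈-trans (*-assoc x z w) (≈-trans (*-congˡ (≈-trans (*-comm z w) (proj₂ (inverse z z≉0)))) (*-identityʳ x)))

-- Characters and partitions

χ-↭ : ∀ {μ ν} → μ ↭ ν → ∀ w → χ μ w ≈ χ ν w
χ-↭ ↭.refl                 w = ≈-refl
χ-↭ (↭.prep a μ↭ν)         w = d-cong a (χ-↭ μ↭ν) w
χ-↭ (↭.swap {μ} a b μ↭ν)   w = ≈-trans (d-comm a b (χ μ) w) (d-cong b (d-cong a (χ-↭ μ↭ν)) w)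
χ-↭ (↭.trans μ↭ν ν↭ρ)      w = ≈-trans (χ-↭ μ↭ν w) (χ-↭ ν↭ρ w)

IsNat : ℂ → Set
IsNat z = ∃ λ n → z ≈ nat n

∑ℂ-IsNat : {A : Set} (xs : List A) {f : A → ℂ} → (∀ x → IsNat (f x)) → IsNat (∑ℂ xs f)
∑ℂ-IsNat []       f-nat = 0 , ≈-refl
∑ℂ-IsNat (x ∷ xs) f-nat = let m , fx≈m = f-nat x ; n , Σ≈n = ∑ℂ-IsNat xs f-nat in
  m ℕ.+ n , ≈-trans (+-cong fx≈m Σ≈n) (≈-sym (nat-+ m n))

χ-IsNat : ∀ μ w → IsNat (χ μ w)
χ-IsNat []      []      = 1 , ≈-sym (+-identityʳ _)
χ-IsNat []      (_ ∷ _) = 0 , ≈-refl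
χ-IsNat (a ∷ μ) w       = ∑ℂ-IsNat (removals a w) (χ-IsNat μ)

chop-suc : ∀ a n → chop a (suc (a ℕ.+ n)) ≡ n ∷ []
chop-suc zero    n = refl
chop-suc (suc a) n = chop-suc a n

-- One distribution puts each part into its own bin, and all others contribute natural numbers, so
-- nothing can cancel it.
χ-self : ∀ μ → ∃ λ n → χ μ μ ≈ nat (suc n)
χ-self []      = 0 , ≈-sym (+-identityʳ _)
χ-self (a ∷ μ) = m ℕ.+ n , (begin
  χ (a ∷ μ) (a ∷ μ)
    ≈⟨ d-∷ a (χ μ) a μ ⟩
  ∑ℂ (chop a (suc a)) (λ l → χ μ (letter l ++ μ)) + d a (λ v → χ μ (a ∷ v)) μ
    ≈⟨ +-cong (≈-trans (≈-reflexive (cong (λ ls → ∑ℂ ls (λ l → χ μ (letter l ++ μ))) chop-all)) (+-identityʳ _)) rest≈n ⟩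
  χ μ μ + nat n
    ≈⟨ +-congʳ χ≈1+m ⟩
  nat (suc m) + nat n
    ≈⟨ nat-+ (suc m) n ⟨
  nat (suc (m ℕ.+ n)) ∎)
  where
  open ≈-Reasoning
  chop-all : chop a (suc a) ≡ 0 ∷ []
  chop-all = trans (cong (λ i → chop a (suc i)) (sym (ℕ.+-identityʳ a))) (chop-suc a 0)
  m n : ℕ
  m = proj₁ (χ-self μ)
  χ≈1+m : χ μ μ ≈ nat (suc m)
  χ≈1+m = proj₂ (χ-self μ)
  rest-nat : IsNat (d a (λ v → χ μ (a ∷ v)) μ)
  rest-nat = ∑ℂ-IsNat (removals a μ) (λ v → χ-IsNat μ (a ∷ v))
  n = proj₁ rest-nat
  rest≈n : d a (λ v → χ μ (a ∷ v)) μ ≈ nat n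
  rest≈n = proj₂ rest-nat

χ-self≉0 : ∀ μ → ¬ χ μ μ ≈ 0#
χ-self≉0 μ eq = let n , χ≈ = χ-self μ in nat-suc≉0 n (≈-trans (≈-sym χ≈) eq)

-- With a single bin there is just one distribution. This is why characters take the unit to 1.
χ-letter : ∀ μ → χ μ (letter (weight μ)) ≈ 1#
χ-letter []      = ≈-refl
χ-letter (a ∷ μ) = begin
  d a (χ μ) (a ℕ.+ weight μ ∷ [])
    ≈⟨ d-∷ a (χ μ) (a ℕ.+ weight μ) [] ⟩
  ∑ℂ (chop a (suc (a ℕ.+ weight μ))) (λ m → χ μ (letter m ++ [])) + 0#
    ≈⟨ +-identityʳ _ ⟩
  ∑ℂ (chop a (suc (a ℕ.+ weight μ))) (λ m → χ μ (letter m ++ []))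
    ≈⟨ ≈-reflexive (cong (λ ms → ∑ℂ ms (λ m → χ μ (letter m ++ []))) (chop-suc a (weight μ))) ⟩
  χ μ (letter (weight μ) ++ []) + 0#
    ≈⟨ ≈-trans (+-identityʳ _) (≈-reflexive (cong (χ μ) (List.++-identityʳ (letter (weight μ))))) ⟩
  χ μ (letter (weight μ))
    ≈⟨ χ-letter μ ⟩
  1# ∎
  where open ≈-Reasoning

-- Either a bin is only lowered and the length stays the same, or it is emptied, which happens only
-- to a bin of size exactly `k + 1`.
removals-shape : ∀ k w → All (λ v → length v ≡ length w ⊎ w ↭ k ∷ v) (removals k w)
removals-shape k []      = []
removals-shape k (a ∷ w) = All.++⁺
  (All.map⁺ (All.map (λ {m} → chopped m) (chop-+ k (suc a))))
  (All.map⁺ (All.map below (removals-shape k w)))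
  where
  chopped : ∀ m → m ℕ.+ suc k ≡ suc a → length (letter m ++ w) ≡ length (a ∷ w) ⊎ a ∷ w ↭ k ∷ letter m ++ w
  chopped zero    refl = inj₂ ↭.refl
  chopped (suc m) _    = inj₁ refl
  below : ∀ {v} → length v ≡ length w ⊎ w ↭ k ∷ v → length (a ∷ v) ≡ length (a ∷ w) ⊎ a ∷ w ↭ k ∷ a ∷ v
  below (inj₁ eq)   = inj₁ (cong suc eq)
  below (inj₂ w↭kv) = inj₂ (↭-trans (↭.prep a w↭kv) (↭.swap a k ↭.refl))

-- Every bin receives a part, so there are at most as many bins as parts, and
-- when there are equally many the bins are the parts.
χ-≈0 : ∀ μ w → ¬ length w ℕ.< length μ → ¬ (w ↭ μ) → χ μ w ≈ 0#
χ-≈0 []      []      _   w≁μ = ⊥-elim (w≁μ ↭.refl)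
χ-≈0 []      (_ ∷ _) _   _   = ≈-refl
χ-≈0 (a ∷ μ) w       w≮μ w≁μ = ≈-trans
  (∑ℂ-cong-All {g = λ _ → 0#} (All.map (λ {v} → vanish v) (removals-shape a w))) (∑ℂ-0 (removals a w))
  where
  vanish : ∀ v → length v ≡ length w ⊎ w ↭ a ∷ v → χ μ v ≈ 0#
  vanish v (inj₁ |v|≡|w|) = χ-≈0 μ v
    (λ v<μ → w≮μ (ℕ.m<n⇒m<1+n (subst (ℕ._< length μ) |v|≡|w| v<μ)))
    (λ v↭μ → w≮μ (s≤s (ℕ.≤-reflexive (trans (sym |v|≡|w|) (↭.↭-length v↭μ)))))
  vanish v (inj₂ w↭av) = χ-≈0 μ v
    (λ v<μ → w≮μ (subst (ℕ._< suc (length μ)) (sym (↭.↭-length w↭av)) (s≤s v<μ)))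
    (λ v↭μ → w≁μ (↭-trans w↭av (↭.prep a v↭μ)))

-- The word of a partition is split into the letters of the parts greater than 1
-- and the number of parts equal to 1.
bigLetters : List ℕ → Word
bigLetters ps = map ℕ.pred (filter (1 ℕ.<?_) ps)

countOnes : List ℕ → ℕ
countOnes ps = length (filter (ℕ._≟ 1) ps)

bigLetters>0 : ∀ ps → All (0 ℕ.<_) (bigLetters ps)
bigLetters>0 ps = All.map⁺ (All.map (λ { (s≤s 0<p) → 0<p }) (All.all-filter (1 ℕ.<?_) ps))

parts-split : ∀ {ps} → All (ℕ._> 0) ps → map suc (bigLetters ps ++ ones (countOnes ps)) ↭ ps
parts-split [] = ↭.refl
parts-split {suc zero ∷ ps} (_ ∷ ps>0) = ↭-trans
  (↭.map⁺ suc (↭.shift 0 (bigLetters ps) (ones (countOnes ps)))) (↭.prep 1 (parts-split ps>0))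
parts-split {suc (suc p) ∷ ps} (_ ∷ ps>0) = ↭.prep (suc (suc p)) (parts-split ps>0)

countOnes-letters : ∀ {u} j → All (0 ℕ.<_) u → countOnes (map suc (u ++ ones j)) ≡ j
countOnes-letters zero    []            = refl
countOnes-letters (suc j) []            = cong suc (countOnes-letters j [])
countOnes-letters j (_∷_ {suc a} _ u>0) = countOnes-letters j u>0

bigLetters-letters : ∀ {u} j → All (0 ℕ.<_) u → bigLetters (map suc (u ++ ones j)) ≡ u
bigLetters-letters zero    []            = refl
bigLetters-letters (suc j) []            = bigLetters-letters j []
bigLetters-letters j (_∷_ {suc a} _ u>0) = cong (suc a ∷_) (bigLetters-letters j u>0)

≥-decTotalOrder : DecTotalOrder _ _ _
≥-decTotalOrder = Flip.decTotalOrder ℕ.≤-decTotalOrder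

decreasing-unique : ∀ {ps qs} → Linked ℕ._≥_ ps → Linked ℕ._≥_ qs → ps ↭ qs → ps ≡ qs
decreasing-unique ps↘ qs↘ ps↭qs = Pointwise-≡⇒≡
  (Sorted.↗↭↗⇒≋ (DecTotalOrder.totalOrder ≥-decTotalOrder) ps↘ qs↘ (↭⇒↭ₛ ps↭qs))

module _ {n : ℕ} (p : Partition n) where

  partLetters : Word
  partLetters = bigLetters (parts p)

  partOnes : ℕ
  partOnes = countOnes (parts p)

  character : Word → ℂ
  character = χ (partLetters ++ ones partOnes)

  partition-weight : partOnes ℕ.+ weight partLetters ≡ n
  partition-weight = begin
    partOnes ℕ.+ weight partLetters  ≡⟨ ℕ.+-comm partOnes (weight partLetters) ⟩
    weight partLetters ℕ.+ partOnes  ≡⟨ cong (weight partLetters ℕ.+_) (weight-ones partOnes) ⟨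
    weight partLetters ℕ.+ weight (ones partOnes)  ≡⟨ weight-++ partLetters (ones partOnes) ⟨
    weight (partLetters ++ ones partOnes)  ≡⟨ sum-↭ (parts-split (positive p)) ⟩
    sum (parts p)  ≡⟨ total p ⟩
    n ∎
    where open ≡-Reasoning

  character-basis : ∀ l w → ∫ (basis l w) character ≈ δ (l ℕ.≟ partOnes) * χ partLetters w
  character-basis l w = χ-basis partOnes l w (bigLetters>0 (parts p))

  character-⊛ : ∀ X Y → ∫ (X ⊛ Y) character ≈ ∫ X character * ∫ Y character
  character-⊛ X Y = begin
    ∫ (X ⊛ Y) character  ≈⟨ ∫-⊛ X Y character ⟩
    ∫ X (λ u → ∫ Y (star character u))  ≈⟨ ∫-cong X (λ u → ∫-cong Y (χ-star (partLetters ++ ones partOnes) u)) ⟩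
    ∫ X (λ u → ∫ Y (λ v → character u * character v))  ≈⟨ ∫-cong X (λ u → ∫-* (character u) Y character) ⟨
    ∫ X (λ u → character u * ∫ Y character)  ≈⟨ ∫-*ʳ (∫ Y character) X character ⟨
    ∫ X character * ∫ Y character ∎
    where open ≈-Reasoning

  partition-valid : ∀ {k} → partOnes ℕ.≤ k → Valid n k (partOnes , partLetters)
  partition-valid {k} ones≤k = ℕ.⊓-glb ones≤k (ℕ.≤-trans (ℕ.m≤m+n partOnes (weight partLetters)) (ℕ.≤-reflexive partition-weight)) ,
    partition-weight

  -- Only the summand of the unit with exponent `partOnes` is seen by the character, and there the
  -- bound on the number of ones ensures that this summand is present.
  character-unit : ∀ {k} → partOnes ℕ.≤ k → ∫ (unit n k) character ≈ 1#
  character-unit {k} ones≤k = begin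
    ∫ (unit n k) character
      ≈⟨ ∫-unit {n} {k} character ⟩
    ∑ℂ I (λ i → ∫ (basis i (letter (n ∸ i))) character)
      ≈⟨ ∑ℂ-cong I (λ i → ≈-trans (character-basis i (letter (n ∸ i))) (*-congʳ (δ-⇔ (i ℕ.≟ partOnes) (partOnes ℕ.≟ i) sym sym))) ⟩
    ∑ℂ I (λ i → δ (partOnes ℕ.≟ i) * χ partLetters (letter (n ∸ i)))
      ≈⟨ ∑ℂ-pick ℕ._≟_ (λ i → χ partLetters (letter (n ∸ i))) (Unique.upTo⁺ (suc (k ⊓ n))) (∈-upTo⁺ (s≤s (proj₁ (partition-valid ones≤k)))) ⟩
    χ partLetters (letter (n ∸ partOnes))
      ≈⟨ ≈-reflexive (cong (λ m → χ partLetters (letter m)) (trans (cong (_∸ partOnes) (sym partition-weight)) (ℕ.m+n∸m≡n partOnes (weight partLetters)))) ⟩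
    χ partLetters (letter (weight partLetters))
      ≈⟨ χ-letter partLetters ⟩
    1# ∎
    where
    open ≈-Reasoning
    I : List ℕ
    I = upTo (suc (k ⊓ n))

partition-unique : ∀ {n} (p q : Partition n) → partOnes p ≡ partOnes q → partLetters p ↭ partLetters q → parts p ≡ parts q
partition-unique p q ones≡ letters↭ = decreasing-unique (decreasing p) (decreasing q)
  (↭-trans (↭-sym (parts-split (positive p))) (↭-trans (↭.map⁺ suc
    (↭-trans (↭.++⁺ʳ (ones (partOnes p)) letters↭) (↭-reflexive (cong (λ m → partLetters q ++ ones m) ones≡))))
    (parts-split (positive q))))

module _ {n : ℕ} (j : ℕ) (u : Word) (u>0 : All (0 ℕ.<_) u) (j+u≡n : j ℕ.+ weight u ≡ n) where
  open Sort ≥-decTotalOrder using (sort; sort-↭; sort-↗)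

  private
    unsorted : List ℕ
    unsorted = map suc (u ++ ones j)

  -- Sorting forgets the order of the composition `u`, so `u` is recovered only up to permutation;
  -- by `χ-↭` that determines its character.
  indexPartition : Partition n
  indexPartition .parts      = sort unsorted
  indexPartition .decreasing = sort-↗ unsorted
  indexPartition .positive   = ↭.All-resp-↭ (↭-sym (sort-↭ unsorted)) (All.map⁺ (All.universal (λ _ → s≤s z≤n) (u ++ ones j)))
  indexPartition .total      = begin
    sum (sort unsorted)  ≡⟨ sum-↭ (sort-↭ unsorted) ⟩
    weight (u ++ ones j)  ≡⟨ weight-++ u (ones j) ⟩
    weight u ℕ.+ weight (ones j)  ≡⟨ cong (weight u ℕ.+_) (weight-ones j) ⟩
    weight u ℕ.+ j  ≡⟨ ℕ.+-comm (weight u) j ⟩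
    j ℕ.+ weight u  ≡⟨ j+u≡n ⟩
    n ∎
    where open ≡-Reasoning

  indexPartition-ones : partOnes indexPartition ≡ j
  indexPartition-ones = trans (↭.↭-length (↭.filter-↭ (ℕ._≟ 1) (sort-↭ unsorted))) (countOnes-letters j u>0)

  indexPartition-letters : partLetters indexPartition ↭ u
  indexPartition-letters = ↭-trans (↭.map⁺ ℕ.pred (↭.filter-↭ (1 ℕ.<?_) (sort-↭ unsorted)))
    (↭-reflexive (bigLetters-letters j u>0))

-- Representations

module _ {c₁ ℓ₁ c₂ ℓ₂} (V : LeftModule ℂ-ring c₁ ℓ₁) (W : LeftModule ℂ-ring c₂ ℓ₂) where
  private
    module V = LeftModule V
    module W = LeftModule W

  linear : (f : V.Carrierᴹ → W.Carrierᴹ) →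
    (∀ {v w} → v V.≈ᴹ w → f v W.≈ᴹ f w) → (∀ v w → f (v V.+ᴹ w) W.≈ᴹ f v W.+ᴹ f w) →
    (∀ a v → f (a V.*ₗ v) W.≈ᴹ a W.*ₗ f v) → Linear V W f
  linear f f-cong f-+ f-* = record
    { +ᴹ-isGroupHomomorphism = record
      { isMonoidHomomorphism = record
        { isMagmaHomomorphism = record { isRelHomomorphism = record { cong = f-cong } ; homo = f-+ }
        ; ε-homo = f-0
        }
      ; ⁻¹-homo = λ v → W.uniqueˡ‿-ᴹ (f (V.-ᴹ v)) (f v)
          (W.≈ᴹ-trans (W.≈ᴹ-sym (f-+ (V.-ᴹ v) v)) (W.≈ᴹ-trans (f-cong (V.-ᴹ‿inverseˡ v)) f-0))
      }
    ; *ₗ-homo = f-*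
    }
    where
    f-0 : f V.0ᴹ W.≈ᴹ W.0ᴹ
    f-0 = W.≈ᴹ-trans (f-cong (V.≈ᴹ-sym (V.*ₗ-zeroˡ V.0ᴹ))) (W.≈ᴹ-trans (f-* 0# V.0ᴹ) (W.*ₗ-zeroˡ (f V.0ᴹ)))

-- Lifted to arbitrary levels, so that characters live in the same universes as the representations
-- compared with them.
scalars : (c ℓ : Level) → LeftModule ℂ-ring c ℓ
scalars c ℓ = record
  { Carrierᴹ = Lift c ℂ
  ; _≈ᴹ_ = λ x y → Lift ℓ (lower x ≈ lower y)
  ; _+ᴹ_ = λ x y → lift (lower x + lower y)
  ; _*ₗ_ = λ a x → lift (a * lower x)
  ; 0ᴹ = lift 0#
  ; -ᴹ_ = λ x → lift (- lower x)
  ; isLeftModule = record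
    { isLeftSemimodule = record
      { +ᴹ-isCommutativeMonoid = record
        { isMonoid = record
          { isSemigroup = record
            { isMagma = record
              { isEquivalence = record
                { refl = lift ≈-refl
                ; sym = λ p → lift (≈-sym (lower p))
                ; trans = λ p q → lift (≈-trans (lower p) (lower q))
                }
              ; ∙-cong = λ p q → lift (+-cong (lower p) (lower q))
              }
            ; assoc = λ _ _ _ → lift (+-assoc _ _ _)
            }
          ; identity = (λ _ → lift (+-identityˡ _)) , (λ _ → lift (+-identityʳ _))
          }
        ; comm = λ _ _ → lift (+-comm _ _)
        }
      ; isPreleftSemimodule = record
        { *ₗ-cong = λ p q → lift (*-cong p (lower q))
        ; *ₗ-zeroˡ = λ _ → lift (zeroˡ _)
        ; *ₗ-distribʳ = λ _ _ _ → lift (distribʳ _ _ _)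
        ; *ₗ-identityˡ = λ _ → lift (*-identityˡ _)
        ; *ₗ-assoc = λ _ _ _ → lift (*-assoc _ _ _)
        ; *ₗ-zeroʳ = λ _ → lift (zeroʳ _)
        ; *ₗ-distribˡ = λ _ _ _ → lift (distribˡ _ _ _)
        }
      }
    ; -ᴹ‿cong = λ p → lift (-‿cong (lower p))
    ; -ᴹ‿inverse = (λ _ → lift (-‿inverseˡ _)) , (λ _ → lift (-‿inverseʳ _))
    }
  }

module _ {n k : ℕ} (c ℓ : Level) where

  characterRep : PartitionWithFewOnes n k → Representation n k c ℓ
  characterRep (p , ones≤k) = record
    { space = scalars c ℓ
    ; act = λ (X , _) v → lift (∫ X (character p) * lower v)
    ; act-linear = λ _ → linear (scalars c ℓ) (scalars c ℓ) _
        (λ v≈w → lift (*-congˡ (lower v≈w))) (λ _ _ → lift (distribˡ _ _ _)) (λ _ _ → lift (*-left-comm _ _ _))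
    ; act-cong = λ (X , _) (Y , _) X≋Y _ → lift (*-congʳ (≋⇒∫ X Y X≋Y (character p)))
    ; act-+ = λ (X , _) (Y , _) (Z , _) Z≋ _ → lift (≈-trans
        (*-congʳ (≈-trans (≋⇒∫ Z (X ⊕ Y) Z≋ (character p)) (∫-⊕ X Y (character p)))) (distribʳ _ _ _))
    ; act-• = λ a (X , _) (Z , _) Z≋ _ → lift (≈-trans
        (*-congʳ (≈-trans (≋⇒∫ Z (a • X) Z≋ (character p)) (∫-• a X (character p)))) (*-assoc _ _ _))
    ; act-⊛ = λ (X , _) (Y , _) (Z , _) Z≋ _ → lift (≈-trans
        (*-congʳ (≈-trans (≋⇒∫ Z (X ⊛ Y) Z≋ (character p)) (character-⊛ p X Y))) (*-assoc _ _ _))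
    ; act-unit = λ (Z , _) Z≋ _ → lift (≈-trans
        (*-congʳ (≈-trans (≋⇒∫ Z (unit n k) Z≋ (character p)) (character-unit p ones≤k))) (*-identityˡ _))
    }

  module _ (em : ExcludedMiddle (c ⊔ ℓ)) where
    private
      em₀ : ExcludedMiddle 0ℓ
      em₀ = lower-excluded-middle em

    characterRep-irreducible : ∀ p → IsIrreducible (characterRep p)
    characterRep-irreducible p = (lift 1# , λ 1≈0 → 1≉0 (lower 1≈0)) , dichotomy
      where
      open LeftModule (scalars c ℓ) using (Carrierᴹ; _≈ᴹ_; 0ᴹ)
      dichotomy : ∀ (W : Pred Carrierᴹ (c ⊔ ℓ)) → IsSubrepresentation (characterRep p) W →
        (∀ v → W v → v ≈ᴹ 0ᴹ) ⊎ (∀ v → W v)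
      dichotomy W W-sub with em {∃ λ v → W v × ¬ v ≈ᴹ 0ᴹ}
      ... | no none = inj₁ λ v Wv → lift (decidable-stable em₀ λ v≉0 → none (v , Wv , λ v≈0 → v≉0 (lower v≈0)))
      ... | yes (e , We , e≉0) = inj₂ λ v →
              let w , w*e≈1 = inverse em₀ (lower e) (λ e≈0 → e≉0 (lift e≈0)) in
              resp-≈ (lift (≈-trans (*-assoc _ _ _) (≈-trans (*-congˡ w*e≈1) (*-identityʳ _)))) (has-*ₗ (lower v * w) We)
        where open IsSubrepresentation W-sub

    irreducible : PartitionWithFewOnes n k → IrreducibleRepresentation n k c ℓ
    irreducible p = characterRep p , characterRep-irreducible p

    character-cong : ∀ (p q : PartitionWithFewOnes n k) → parts (proj₁ p) ≡ parts (proj₁ q) →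
      characterRep p ≅ characterRep q
    character-cong p q ps≡qs = record
      { to = id
      ; from = id
      ; to-linear = linear M M id id (λ _ _ → ≈ᴹ-refl) (λ _ _ → ≈ᴹ-refl)
      ; from-linear = linear M M id id (λ _ _ → ≈ᴹ-refl) (λ _ _ → ≈ᴹ-refl)
      ; to-act = λ (X , _) v → lift (same X (lower v))
      ; from-act = λ (X , _) v → lift (≈-sym (same X (lower v)))
      ; to∘from = λ _ → ≈ᴹ-refl
      ; from∘to = λ _ → ≈ᴹ-refl
      }
      where
      M : LeftModule ℂ-ring c ℓ
      M = scalars c ℓ
      open LeftModule M using (≈ᴹ-refl)
      same : ∀ X v → ∫ X (character (proj₁ p)) * v ≈ ∫ X (character (proj₁ q)) * v
      same X v = ≈-reflexive (cong (λ ps → ∫ X (χ (bigLetters ps ++ ones (countOnes ps))) * v) ps≡qs)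

    module _ (p q : PartitionWithFewOnes n k) (p≅q : characterRep p ≅ characterRep q) where
      private
        module i = _≅_ p≅q
        t : ℂ
        t = lower (i.to (lift 1#))
        t≉0 : ¬ t ≈ 0#
        t≉0 t≈0 = 1≉0 (≈-trans (≈-sym (lower (i.from∘to (lift 1#))))
          (≈-trans (lower (⟦⟧-cong i.from-linear (lift t≈0))) (lower (0ᴹ-homo i.from-linear))))

      -- An isomorphism takes 1 to a nonzero scalar `t`. Compatibility with the action equates the
      -- two values multiplied by `t`, which can be cancelled.
      characters-agree : ∀ (x : Element n k) → ∫ (proj₁ x) (character (proj₁ p)) ≈ ∫ (proj₁ x) (character (proj₁ q))
      characters-agree x = *-cancelʳ em₀ _ _ t≉0
        (≈-trans (≈-sym (lower (*ₗ-homo i.to-linear _ (lift 1#)))) (lower (i.to-act x (lift 1#))))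

    module _ {p q : PartitionWithFewOnes n k} where
      private
        μ ν : Word
        μ = partLetters (proj₁ p)
        ν = partLetters (proj₁ q)

      -- The characters are compared on basis (partOnes p) (partLetters p), where that of p does not vanish.
      character-test : characterRep p ≅ characterRep q →
        partOnes (proj₁ p) ≡ partOnes (proj₁ q) × ¬ χ ν μ ≈ 0#
      character-test p≅q = decidable-stable (partOnes (proj₁ p) ℕ.≟ partOnes (proj₁ q)) (λ m≢ → nonzero (≈-trans (*-congʳ (δ-no (partOnes (proj₁ p) ℕ.≟ partOnes (proj₁ q)) m≢)) (zeroˡ _))) ,
        λ χ≈0 → nonzero (≈-trans (*-congˡ χ≈0) (zeroʳ _))
        where
        m : ℕ
        m = partOnes (proj₁ p)
        x : Element n k
        x = basis m μ , let m≤ , eq = partition-valid (proj₁ p) (proj₂ p) in D-basis m μ m≤ eq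
        nonzero : ¬ δ (m ℕ.≟ partOnes (proj₁ q)) * χ ν μ ≈ 0#
        nonzero eq = χ-self≉0 μ (begin
          χ μ μ  ≈⟨ δ-yes-* (m ℕ.≟ m) refl ⟨
          δ (m ℕ.≟ m) * χ μ μ  ≈⟨ character-basis (proj₁ p) m μ ⟨
          ∫ (basis m μ) (character (proj₁ p))  ≈⟨ characters-agree p q p≅q x ⟩
          ∫ (basis m μ) (character (proj₁ q))  ≈⟨ character-basis (proj₁ q) m μ ⟩
          δ (m ℕ.≟ partOnes (proj₁ q)) * χ ν μ  ≈⟨ eq ⟩
          0# ∎)
          where open ≈-Reasoning

    character-injective : ∀ {p q : PartitionWithFewOnes n k} →
      characterRep p ≅ characterRep q → parts (proj₁ p) ≡ parts (proj₁ q)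
    character-injective {p} {q} p≅q = partition-unique (proj₁ p) (proj₁ q) (proj₁ p-on-q)
      -- By `χ-≈0`, nonvanishing of χ ν μ makes μ shorter than ν or a permutation of it, and the
      -- same holds with the roles exchanged. Both strict inequalities cannot hold.
      (decidable-stable em₀ λ μ≁ν →
        proj₂ p-on-q (χ-≈0 _ _ (λ μ<ν → proj₂ q-on-p (χ-≈0 _ _ (ℕ.<-asym μ<ν) (λ ν↭μ → μ≁ν (↭-sym ν↭μ)))) μ≁ν))
      where
      p-on-q = character-test {p} {q} p≅q
      q-on-p = character-test {q} {p} (≅-sym p≅q)

-- S♯₁ = S₁ - S₁ = 0, so a part equal to 1 annihilates the whole product.
Φ-zero : ∀ {u} → Any (λ a → ¬ 0 ℕ.< a) u → ∀ f → ∫ (Φ u) f ≈ 0#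
Φ-zero {suc a ∷ u} (here 1+a≯0) f = ⊥-elim (1+a≯0 (s≤s z≤n))
Φ-zero {zero ∷ u}  (here _)     f = begin
  ∫ (Φ (0 ∷ u)) f
    ≈⟨ ∫-Φ-∷ 0 u f ⟩
  ε 0 * x + (ε 1 * x + 0#)
    ≈⟨ +-congˡ (≈-trans (+-identityʳ _) (≈-trans (*-congʳ ε-one) (≈-sym (-‿distribˡ-* (ε 0) x)))) ⟩
  ε 0 * x + - (ε 0 * x)
    ≈⟨ -‿inverseʳ _ ⟩
  0# ∎
  where
  open ≈-Reasoning
  x : ℂ
  x = ∫ (Φ u) (f ∘ (0 ∷_))
  ε-one : ε 1 ≈ - ε 0
  ε-one = ≈-trans (≈-sym (≈-trans (*-congʳ (+-identityʳ 1#)) (*-identityˡ _))) (ε-suc 0)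
Φ-zero {a ∷ u} (there zero∈u) f = ≈-trans (∫-Φ-∷ a u f)
  (conv-≈0 (suc a) (λ i j → ≈-trans (*-congˡ (Φ-zero zero∈u _)) (zeroʳ _)))

row-letters : ∀ a r → sum r ≡ suc a → letters r ≡ a ∷ [] ⊎ 1 ℕ.< length (letters r)
row-letters a r Σr≡1+a with letters r | trans (weight-letters r) Σr≡1+a
... | x ∷ []    | eq = inj₁ (cong (_∷ []) (trans (sym (ℕ.+-identityʳ x)) (ℕ.suc-injective eq)))
... | x ∷ y ∷ w | _  = inj₂ (s≤s (s≤s z≤n))

-- A row of positive sum yields at least one letter, and only one if the whole sum sits in a single
-- entry. Equality of lengths thus forces every row to reproduce its part.
refinement : ∀ u M → rowSums M ≡ composition u → letters (concat M) ≡ u ⊎ length u ℕ.< length (letters (concat M))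
refinement []      []      _  = inj₁ refl
refinement (a ∷ u) (r ∷ M) eq rewrite letters-++ r (concat M) | List.length-++ (letters r) {letters (concat M)}
  with row-letters a r (List.∷-injectiveˡ eq) | refinement u M (List.∷-injectiveʳ eq)
... | inj₁ r≡a | inj₁ M≡u = inj₁ (cong₂ _++_ r≡a M≡u)
... | inj₁ r≡a | inj₂ u<M = inj₂ (ℕ.+-mono-≤-< (ℕ.≤-reflexive (sym (cong length r≡a))) u<M)
... | inj₂ 1<r | inj₁ M≡u = inj₂ (ℕ.+-mono-<-≤ 1<r (ℕ.≤-reflexive (sym (cong length M≡u))))
... | inj₂ 1<r | inj₂ u<M = inj₂ (ℕ.+-mono-<-≤ 1<r (ℕ.<⇒≤ u<M))

refinement-weight : ∀ u M → rowSums M ≡ composition u → weight (letters (concat M)) ≡ weight u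
refinement-weight u M eq = trans (weight-letters (concat M)) (trans (sum-concat M) (cong sum eq))
  where
  sum-concat : ∀ M → sum (concat M) ≡ sum (rowSums M)
  sum-concat []      = refl
  sum-concat (r ∷ M) = trans (sum-++ r (concat M)) (cong (sum r ℕ.+_) (sum-concat M))

matrices-rowSums : ∀ I J → All (λ M → rowSums M ≡ I) (matrices I J)
matrices-rowSums I J = All.map proj₁ (All.all-filter (has-margins (sum I) (length J) I J) (listsOver (rows (sum I) (length J)) (length I)))

-- The words v in the expansion S^u * S^w = Σ S^v.
starWords : Word → Word → List Word
starWords u w = map (λ M → letters (concat M)) (matrices (composition u) (composition w))

∑ℂ-starWords : ∀ f u w → ∑ℂ (starWords u w) f ≈ star f u w
∑ℂ-starWords f u w = ≈-trans (∑ℂ-map _ (matrices (composition u) (composition w)) f) (matrices-star u w f)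

starWords-refine : ∀ u w → All (λ v → (v ≡ u ⊎ length u ℕ.< length v) × weight v ≡ weight u) (starWords u w)
starWords-refine u w = All.map⁺ (All.map (λ {M} eq → refinement u M eq , refinement-weight u M eq)
  (matrices-rowSums (composition u) (composition w)))

-- This is `star-leading` for the indicator of `u`, which vanishes on longer words. It gives the
-- multiplicity of the leading term.
starWords-count : ∀ u w → ∑ℂ (starWords u w) (λ v → δ (v ≟ʷ u)) ≈ χ u w
starWords-count u w = ≈-trans (∑ℂ-starWords (λ v → δ (v ≟ʷ u)) u w) (≈-trans
  (star-leading (λ v → δ (v ≟ʷ u)) u w (λ v u<v → δ-no (v ≟ʷ u) (λ { refl → ℕ.<-irrefl refl u<v })))
  (≈-trans (*-congˡ (δ-yes (u ≟ʷ u) refl)) (*-identityʳ _)))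

-- Excluded middle decides at each stage whether a larger witness exists. The gap `N ∸ m x`
-- decreases with each one and serves as fuel.
maximal : ∀ {a} → ExcludedMiddle a → {A : Set} (P : A → Set a) (m : A → ℕ) (N : ℕ) → (∀ x → P x → m x ℕ.≤ N) →
  ∃ P → ∃ λ x → P x × (∀ y → m x ℕ.< m y → ¬ P y)
maximal em P m N m≤N (x , Px) = climb (N ∸ m x) x Px ℕ.≤-refl
  where
  climb : ∀ fuel x → P x → N ∸ m x ℕ.≤ fuel → ∃ λ x → P x × (∀ y → m x ℕ.< m y → ¬ P y)
  climb fuel x Px gap with em {∃ λ y → m x ℕ.< m y × P y}
  ... | no top = x , Px , λ y x<y Py → top (y , x<y , Py)
  climb zero x Px gap | yes (y , x<y , Py) =
    ⊥-elim (ℕ.<-irrefl refl (ℕ.<-≤-trans x<y (ℕ.≤-trans (m≤N y Py) (ℕ.m∸n≡0⇒m≤n (ℕ.n≤0⇒n≡0 gap)))))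
  climb (suc fuel) x Px gap | yes (y , x<y , Py) =
    climb fuel y Py (ℕ.≤-pred (ℕ.≤-trans (ℕ.∸-monoʳ-< x<y (m≤N y Py)) gap))

basis-zero : ∀ j {u} → Any (λ a → ¬ 0 ℕ.< a) u → ∀ f → ∫ (basis j u) f ≈ 0#
basis-zero j {u} zero∈u f = ≈-trans (∫-basis j u f) (≈-trans (*-congˡ (Φ-zero zero∈u _)) (zeroʳ _))

-- Encodes the lexicographic order on `(j , length u)`: words of valid indices have length at most
-- `n`, hence the factor `suc n`.
measure : ℕ → Index → ℕ
measure n (j , u) = j ℕ.* suc n ℕ.+ length u

length≤n : ∀ {n k} j u → Valid n k (j , u) → length u ℕ.≤ n
length≤n j u (_ , eq) = ℕ.≤-trans (length≤weight u) (ℕ.≤-trans (ℕ.m≤n+m (weight u) j) (ℕ.≤-reflexive eq))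

-- Irreducible representations and their leading basis element

module _ {n k : ℕ} {c ℓ : Level} (V : Representation n k c ℓ) where
  open Representation V
  open LeftModule space hiding (Carrierᴹ; _≈ᴹ_; _+ᴹ_; _*ₗ_; 0ᴹ)

  ∑ᴹ : {A : Set} → List (ℂ × A) → (A → Carrierᴹ) → Carrierᴹ
  ∑ᴹ []            F = 0ᴹ
  ∑ᴹ ((a , x) ∷ Z) F = a *ₗ F x +ᴹ ∑ᴹ Z F

  ∑ᴹ-cong : {A : Set} {Z : List (ℂ × A)} {F G : A → Carrierᴹ} → All (λ (_ , x) → F x ≈ᴹ G x) Z → ∑ᴹ Z F ≈ᴹ ∑ᴹ Z G
  ∑ᴹ-cong []            = ≈ᴹ-refl
  ∑ᴹ-cong (Fx≈Gx ∷ F≈G) = +ᴹ-cong (*ₗ-cong ≈-refl Fx≈Gx) (∑ᴹ-cong F≈G)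

  ∑ᴹ-0 : {A : Set} (Z : List (ℂ × A)) → ∑ᴹ Z (λ _ → 0ᴹ) ≈ᴹ 0ᴹ
  ∑ᴹ-0 []            = ≈ᴹ-refl
  ∑ᴹ-0 ((a , _) ∷ Z) = ≈ᴹ-trans (+ᴹ-cong (*ₗ-zeroʳ a) (∑ᴹ-0 Z)) (+ᴹ-identityˡ 0ᴹ)

  ∑ᴹ-scale : {A : Set} (Z : List (ℂ × A)) (g : A → ℂ) (v : Carrierᴹ) → ∑ᴹ Z (λ x → g x *ₗ v) ≈ᴹ ∫ Z g *ₗ v
  ∑ᴹ-scale []            g v = ≈ᴹ-sym (*ₗ-zeroˡ v)
  ∑ᴹ-scale ((a , x) ∷ Z) g v = ≈ᴹ-trans
    (+ᴹ-cong (≈ᴹ-sym (*ₗ-assoc a (g x) v)) (∑ᴹ-scale Z g v)) (≈ᴹ-sym (*ₗ-distribʳ v (a * g x) (∫ Z g)))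

  valid? : ∀ i → Dec (Valid n k i)
  valid? (j , u) = (j ℕ.≤? k ⊓ n) ×-dec (j ℕ.+ weight u ℕ.≟ n)

  basisElement : ∀ i → Valid n k i → Element n k
  basisElement (j , u) (j≤ , eq) = basis j u , D-basis j u j≤ eq

  -- Junk value 0 on the indices that are not valid.
  actOn : Index → Carrierᴹ → Carrierᴹ
  actOn i = by-validity (valid? i)
    where
    by-validity : Dec (Valid n k i) → Carrierᴹ → Carrierᴹ
    by-validity (yes valid) v = act (basisElement i valid) v
    by-validity (no _)      v = 0ᴹ

  actOn-valid : ∀ i (valid : Valid n k i) v → actOn i v ≈ᴹ act (basisElement i valid) v
  actOn-valid i valid v with valid? i
  ... | yes valid′ = act-cong (basisElement i valid′) (basisElement i valid) (λ _ → ≈-refl) v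
  ... | no ¬valid  = ⊥-elim (¬valid valid)

  -- Such a `z` equals `0# • z`, so the axiom for multiples applies to `z` as a multiple of itself.
  act-null : ∀ z → (∀ f → ∫ (proj₁ z) f ≈ 0#) → ∀ v → act z v ≈ᴹ 0ᴹ
  act-null z z≐0 v = ≈ᴹ-trans
    (act-• 0# z z (∫⇒≋ (proj₁ z) (0# • proj₁ z) λ f → ≈-trans (z≐0 f) (≈-sym (≈-trans (∫-• 0# (proj₁ z) f) (zeroˡ _)))) v)
    (*ₗ-zeroˡ (act z v))

  -- The axioms for `act` speak only of elements of the algebra, so each tail of the combination is
  -- carried along with its own membership proof.
  act-comb : ∀ Z → All (Valid n k ∘ proj₂) Z → ∀ z → (∀ f → ∫ (proj₁ z) f ≈ ∫ (comb Z) f) →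
    ∀ v → act z v ≈ᴹ ∑ᴹ Z (λ i → actOn i v)
  act-comb []                []              z z≐ v = act-null z z≐ v
  act-comb ((a , j , u) ∷ Z) (valid ∷ valids) z z≐ v = ≈ᴹ-trans
    (act-+ head-element tail-element z (∫⇒≋ (proj₁ z) (a • basis j u ⊕ comb Z) z≐) v)
    (+ᴹ-cong
      (≈ᴹ-trans (act-• a (basisElement (j , u) valid) head-element (λ _ → ≈-refl) v)
        (*ₗ-cong ≈-refl (≈ᴹ-sym (actOn-valid (j , u) valid v))))
      (act-comb Z valids tail-element (λ _ → ≈-refl) v))
    where
    head-element tail-element : Element n k
    head-element = a • basis j u , D-• a (basis j u) (proj₂ (basisElement (j , u) valid))
    tail-element = comb Z , D-comb Z valids

  module _ (x : Element n k) where

    act-congʳ : ∀ {v w} → v ≈ᴹ w → act x v ≈ᴹ act x w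
    act-congʳ = ⟦⟧-cong (act-linear x)

    act-∑ᴹ : {A : Set} (Z : List (ℂ × A)) (F : A → Carrierᴹ) → act x (∑ᴹ Z F) ≈ᴹ ∑ᴹ Z (λ i → act x (F i))
    act-∑ᴹ []            F = 0ᴹ-homo (act-linear x)
    act-∑ᴹ ((a , i) ∷ Z) F = ≈ᴹ-trans (+ᴹ-homo (act-linear x) _ _)
      (+ᴹ-cong (*ₗ-homo (act-linear x) a (F i)) (act-∑ᴹ Z F))

  module _ (em : ExcludedMiddle (c ⊔ ℓ)) (irr : IsIrreducible V) where
    private
      ≈ᴹ-stable : ∀ {v w} → ¬ ¬ v ≈ᴹ w → v ≈ᴹ w
      ≈ᴹ-stable ¬¬v≈w = lower (decidable-stable em (λ ¬v≈w → ¬¬v≈w (λ v≈w → ¬v≈w (lift {ℓ = c} v≈w))))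

      NonZero : Index → Set (c ⊔ ℓ)
      NonZero i = Valid n k i × ∃ λ v → ¬ actOn i v ≈ᴹ 0ᴹ

      some-nonzero : ∃ NonZero
      -- If all basis elements acted by 0, so would the unit, which is a combination of them, and
      -- the nonzero vector `v` would vanish.
      some-nonzero = decidable-stable em λ none → proj₂ (proj₁ irr) (≈ᴹ-trans
        (≈ᴹ-sym (act-unit (comb (unitTerms {n} {k}) , D-comb unitTerms unitTerms-valid)
          (∫⇒≋ (comb (unitTerms {n} {k})) (unit n k) (λ f → ≈-sym (unit-comb {n} {k} f))) v))
        (≈ᴹ-trans (act-comb (unitTerms {n} {k}) unitTerms-valid _ (λ _ → ≈-refl) v)
        (≈ᴹ-trans (∑ᴹ-cong {G = λ _ → 0ᴹ} (All.map (λ {(_ , i)} valid → ≈ᴹ-stable λ Bv≉0 → none (i , valid , v , Bv≉0)) (unitTerms-valid {n} {k})))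
          (∑ᴹ-0 (unitTerms {n} {k})))))
        where
        v : Carrierᴹ
        v = proj₁ (proj₁ irr)

      top : ∃ λ i → NonZero i × (∀ i′ → measure n i ℕ.< measure n i′ → ¬ NonZero i′)
      -- For a valid index both `j` and `length u` are at most `n`, which bounds `measure n` by this
      -- number.
      top = maximal em NonZero (measure n) (n ℕ.* suc n ℕ.+ n)
        (λ { (j , u) (valid , _) → ℕ.+-mono-≤ (ℕ.*-monoˡ-≤ (suc n) (ℕ.≤-trans (proj₁ valid) (ℕ.m⊓n≤n k n))) (length≤n j u valid) })
        some-nonzero

    leading-index : ∃ λ j → ∃ λ u → ∃ λ (valid : Valid n k (j , u)) →
      (∃ λ e → ¬ act (basisElement (j , u) valid) e ≈ᴹ 0ᴹ) ×
      (∀ i → Valid n k i → measure n (j , u) ℕ.< measure n i → ∀ v → actOn i v ≈ᴹ 0ᴹ)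
    leading-index = unpack top
      where
      unpack : (∃ λ i → NonZero i × (∀ i′ → measure n i ℕ.< measure n i′ → ¬ NonZero i′)) → _
      unpack ((j , u) , (valid , e , Be≉0) , largest) = j , u , valid ,
        (e , λ βe≈0 → Be≉0 (≈ᴹ-trans (actOn-valid (j , u) valid e) βe≈0)) ,
        λ i valid-i top<i v → ≈ᴹ-stable λ Bv≉0 → largest i top<i (valid-i , v , Bv≉0)

  module Leading (em : ExcludedMiddle (c ⊔ ℓ)) (irr : IsIrreducible V)
    (j : ℕ) (u : Word) (valid : Valid n k (j , u)) (e : Carrierᴹ)
    (βe≉0 : ¬ act (basisElement (j , u) valid) e ≈ᴹ 0ᴹ)
    (above : ∀ i → Valid n k i → measure n (j , u) ℕ.< measure n i → ∀ v → actOn i v ≈ᴹ 0ᴹ) where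
    private
      em₀ : ExcludedMiddle 0ℓ
      em₀ = lower-excluded-middle em

      β : Element n k
      β = basisElement (j , u) valid

      -- A part equal to 1 in `u` would make `β` itself zero, contrary to `βe≉0`. So `u` consists of
      -- parts greater than 1, as the partition requires.
      u>0 : All (0 ℕ.<_) u
      u>0 with All.all? (0 ℕ.<?_) u
      ... | yes u>0 = u>0
      ... | no ¬u>0 = ⊥-elim (βe≉0 (act-null β (basis-zero j (All.¬All⇒Any¬ (0 ℕ.<?_) u ¬u>0)) e))

      -- The scalar is the value on `basis l w` of the character of the partition made of `u` and
      -- `j` ones. For `l < j` the product is 0 in the algebra; for `l = j` it is expanded and only
      -- its leading term acts.
      β-product : ∀ l w → Valid n k (l , w) → ∀ v → act β (actOn (l , w) v) ≈ᴹ (δ (l ℕ.≟ j) * χ u w) *ₗ act β v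
      β-product l w valid-w v with ℕ.<-cmp l j
      ... | tri< l<j l≢j _ = begin
        act β (actOn (l , w) v)
          ≈⟨ act-congʳ β (actOn-valid (l , w) valid-w v) ⟩
        act β (act (basisElement (l , w) valid-w) v)
          ≈⟨ act-⊛ β (basisElement (l , w) valid-w) ([] , D-[]) (∫⇒≋ [] (basis j u ⊛ basis l w) (λ f → ≈-sym (basis-⊛-< l<j u w f))) v ⟨
        act ([] , D-[]) v
          ≈⟨ act-null ([] , D-[]) (λ _ → ≈-refl) v ⟩
        0ᴹ
          ≈⟨ ≈ᴹ-trans (*ₗ-cong (δ-no-* (l ℕ.≟ j) l≢j) ≈ᴹ-refl) (*ₗ-zeroˡ _) ⟨
        (δ (l ℕ.≟ j) * χ u w) *ₗ act β v ∎
        where open SetoidReasoning ≈ᴹ-setoid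
      -- Maximality replaces a product here: as `length u` is below `suc n`, a larger exponent alone
      -- places `(l , w)` above `(j , u)`, so `basis l w` acts by 0.
      ... | tri> _ l≢j j<l = begin
        act β (actOn (l , w) v)
          ≈⟨ act-congʳ β (above (l , w) valid-w j-first v) ⟩
        act β 0ᴹ
          ≈⟨ 0ᴹ-homo (act-linear β) ⟩
        0ᴹ
          ≈⟨ ≈ᴹ-trans (*ₗ-cong (δ-no-* (l ℕ.≟ j) l≢j) ≈ᴹ-refl) (*ₗ-zeroˡ _) ⟨
        (δ (l ℕ.≟ j) * χ u w) *ₗ act β v ∎
        where
        open SetoidReasoning ≈ᴹ-setoid
        j-first : measure n (j , u) ℕ.< measure n (l , w)
        j-first = ℕ.<-≤-trans (ℕ.+-monoʳ-< (j ℕ.* suc n) (s≤s (length≤n j u valid)))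
          (ℕ.≤-trans (ℕ.≤-reflexive (ℕ.+-comm (j ℕ.* suc n) (suc n)))
            (ℕ.≤-trans (ℕ.*-monoˡ-≤ (suc n) j<l) (ℕ.m≤m+n (l ℕ.* suc n) (length w))))
      ... | tri≈ _ refl _ = begin
        act β (actOn (j , w) v)
          ≈⟨ act-congʳ β (actOn-valid (j , w) valid-w v) ⟩
        act β (act (basisElement (j , w) valid-w) v)
          ≈⟨ act-⊛ β (basisElement (j , w) valid-w) (comb Z , D-comb Z Z-valid) (∫⇒≋ (comb Z) (basis j u ⊛ basis j w) Z≐) v ⟨
        act (comb Z , D-comb Z Z-valid) v
          ≈⟨ act-comb Z Z-valid _ (λ _ → ≈-refl) v ⟩
        ∑ᴹ Z (λ i → actOn i v)
          -- Any word of the expansion other than `u` is longer, hence its index lies above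
          -- `(j , u)` and acts by 0.
          ≈⟨ ∑ᴹ-cong {G = λ (_ , x) → δ (x ≟ʷ u) *ₗ act β v} (All.map⁺ (All.map (λ {x} (shape , eq) → leading x shape eq) (starWords-refine u w))) ⟩
        ∑ᴹ Z (λ (_ , x) → δ (x ≟ʷ u) *ₗ act β v)
          ≈⟨ ∑ᴹ-scale Z (λ (_ , x) → δ (x ≟ʷ u)) (act β v) ⟩
        ∫ Z (λ (_ , x) → δ (x ≟ʷ u)) *ₗ act β v
          ≈⟨ *ₗ-cong (≈-trans (≈-trans (∫-Z (λ (_ , x) → δ (x ≟ʷ u))) (starWords-count u w))
               (≈-sym (δ-yes-* (j ℕ.≟ j) refl))) ≈ᴹ-refl ⟩
        (δ (j ℕ.≟ j) * χ u w) *ₗ act β v ∎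
        where
        open SetoidReasoning ≈ᴹ-setoid
        Z : List (ℂ × Index)
        Z = map (λ x → 1# , j , x) (starWords u w)
        Z-valid : All (Valid n k ∘ proj₂) Z
        Z-valid = All.map⁺ (All.map (λ (_ , eq) → proj₁ valid , trans (cong (j ℕ.+_) eq) (proj₂ valid)) (starWords-refine u w))
        ∫-Z : (g : Index → ℂ) → ∫ Z g ≈ ∑ℂ (starWords u w) (λ x → g (j , x))
        ∫-Z g = ≈-trans (∑ℂ-map _ (starWords u w) _) (∑ℂ-cong (starWords u w) (λ x → *-identityˡ _))
        Z≐ : ∀ f → ∫ (comb Z) f ≈ ∫ (basis j u ⊛ basis j w) f
        Z≐ f = ≈-trans (∫-comb Z f) (≈-trans (∫-Z (λ (l , x) → ∫ (basis l x) f))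
          (≈-trans (∑ℂ-starWords (λ x → ∫ (basis j x) f) u w) (≈-sym (basis-⊛ j u w f))))
        leading : ∀ x → (x ≡ u ⊎ length u ℕ.< length x) → weight x ≡ weight u → actOn (j , x) v ≈ᴹ δ (x ≟ʷ u) *ₗ act β v
        leading x (inj₁ refl) _ = ≈ᴹ-trans (actOn-valid (j , u) valid v)
          (≈ᴹ-sym (≈ᴹ-trans (*ₗ-cong (δ-yes (u ≟ʷ u) refl) ≈ᴹ-refl) (*ₗ-identityˡ _)))
        leading x (inj₂ u<x) eq = ≈ᴹ-trans
          (above (j , x) (proj₁ valid , trans (cong (j ℕ.+_) eq) (proj₂ valid)) (ℕ.+-monoʳ-< (j ℕ.* suc n) u<x) v)
          (≈ᴹ-sym (≈ᴹ-trans (*ₗ-cong (δ-no (x ≟ʷ u) (λ { refl → ℕ.<-irrefl refl u<x })) ≈ᴹ-refl) (*ₗ-zeroˡ _)))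

    partition : PartitionWithFewOnes n k
    partition = indexPartition j u u>0 (proj₂ valid) ,
      ℕ.≤-trans (ℕ.≤-reflexive (indexPartition-ones j u u>0 (proj₂ valid))) (ℕ.≤-trans (proj₁ valid) (ℕ.m⊓n≤m k n))

    private
      θ : Element n k → ℂ
      θ x = ∫ (proj₁ x) (character (proj₁ partition))

      character-index : ∀ l w → ∫ (basis l w) (character (proj₁ partition)) ≈ δ (l ℕ.≟ j) * χ u w
      character-index l w = ≈-trans (character-basis (proj₁ partition) l w) (*-cong
        (≈-reflexive (cong (λ m → δ (l ℕ.≟ m)) (indexPartition-ones j u u>0 (proj₂ valid))))
        (χ-↭ (indexPartition-letters j u u>0 (proj₂ valid)) w))

      β-act : ∀ x v → act β (act x v) ≈ᴹ θ x *ₗ act β v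
      β-act x v = let Z , Z-valid , x≐ = D⇒span (proj₁ x) (proj₂ x) in begin
        act β (act x v)
          ≈⟨ act-congʳ β (act-comb Z Z-valid x x≐ v) ⟩
        act β (∑ᴹ Z (λ i → actOn i v))
          ≈⟨ act-∑ᴹ β Z (λ i → actOn i v) ⟩
        ∑ᴹ Z (λ i → act β (actOn i v))
          ≈⟨ ∑ᴹ-cong {G = λ (l , w) → (δ (l ℕ.≟ j) * χ u w) *ₗ act β v} (All.map (λ {(_ , l , w)} valid-w → β-product l w valid-w v) Z-valid) ⟩
        ∑ᴹ Z (λ (l , w) → (δ (l ℕ.≟ j) * χ u w) *ₗ act β v)
          ≈⟨ ∑ᴹ-scale Z (λ (l , w) → δ (l ℕ.≟ j) * χ u w) (act β v) ⟩
        ∫ Z (λ (l , w) → δ (l ℕ.≟ j) * χ u w) *ₗ act β v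
          ≈⟨ *ₗ-cong (≈-trans (x≐ _) (≈-trans (∫-comb Z _) (∫-cong Z (λ (l , w) → character-index l w)))) ≈ᴹ-refl ⟨
        θ x *ₗ act β v ∎
        where open SetoidReasoning ≈ᴹ-setoid

      kernel : Pred Carrierᴹ (c ⊔ ℓ)
      kernel v = Lift (c ⊔ ℓ) (act β v ≈ᴹ 0ᴹ)

      kernel-sub : IsSubrepresentation V kernel
      kernel-sub = record
        { resp-≈ = λ v≈w βv≈0 → lift (≈ᴹ-trans (≈ᴹ-sym (act-congʳ β v≈w)) (lower βv≈0))
        ; has-0 = lift (0ᴹ-homo (act-linear β))
        ; has-+ = λ βv≈0 βw≈0 → lift (≈ᴹ-trans (+ᴹ-homo (act-linear β) _ _) (≈ᴹ-trans (+ᴹ-cong (lower βv≈0) (lower βw≈0)) (+ᴹ-identityˡ 0ᴹ)))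
        ; has-*ₗ = λ a βv≈0 → lift (≈ᴹ-trans (*ₗ-homo (act-linear β) a _) (≈ᴹ-trans (*ₗ-cong ≈-refl (lower βv≈0)) (*ₗ-zeroʳ a)))
        ; has-act = λ x {v} βv≈0 → lift (≈ᴹ-trans (β-act x v) (≈ᴹ-trans (*ₗ-cong ≈-refl (lower βv≈0)) (*ₗ-zeroʳ (θ x))))
        }

      β-injective : ∀ v → act β v ≈ᴹ 0ᴹ → v ≈ᴹ 0ᴹ
      β-injective v βv≈0 = [ (λ trivial → trivial v (lift βv≈0)) , (λ whole → ⊥-elim (βe≉0 (lower (whole e)))) ]′
        (proj₂ irr kernel kernel-sub)

    -- By `β-act`, β takes `act x v` and the multiple of `v` by `θ x` to the same vector, and β is
    -- injective because its kernel is a proper subrepresentation.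
    act-scalar : ∀ x v → act x v ≈ᴹ θ x *ₗ v
    act-scalar x v = ≈ᴹ-trans (uniqueˡ‿-ᴹ (act x v) (-ᴹ (θ x *ₗ v)) (β-injective _ (begin
      act β (act x v +ᴹ -ᴹ (θ x *ₗ v))  ≈⟨ +ᴹ-homo (act-linear β) _ _ ⟩
      act β (act x v) +ᴹ act β (-ᴹ (θ x *ₗ v))  ≈⟨ +ᴹ-cong (β-act x v) (-ᴹ-homo (act-linear β) _) ⟩
      θ x *ₗ act β v +ᴹ -ᴹ act β (θ x *ₗ v)  ≈⟨ +ᴹ-cong ≈ᴹ-refl (-ᴹ‿cong (*ₗ-homo (act-linear β) (θ x) v)) ⟩
      θ x *ₗ act β v +ᴹ -ᴹ (θ x *ₗ act β v)  ≈⟨ -ᴹ‿inverseʳ _ ⟩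
      0ᴹ ∎))) (⁻¹-involutive _)
      where
      open SetoidReasoning ≈ᴹ-setoid
      open AbelianGroupProperties +ᴹ-abelianGroup using (⁻¹-involutive)

    private
      e≉0 : ¬ e ≈ᴹ 0ᴹ
      e≉0 e≈0 = βe≉0 (≈ᴹ-trans (act-congʳ β e≈0) (0ᴹ-homo (act-linear β)))

      -- Scalar action makes every line stable. This one contains `e`, which is nonzero, so
      -- irreducibility makes it the whole space.
      line : Pred Carrierᴹ (c ⊔ ℓ)
      line v = Lift (c ⊔ ℓ) (∃ λ a → v ≈ᴹ a *ₗ e)

      line-sub : IsSubrepresentation V line
      line-sub = record
        { resp-≈ = λ { v≈w (lift (a , v≈ae)) → lift (a , ≈ᴹ-trans (≈ᴹ-sym v≈w) v≈ae) }
        ; has-0 = lift (0# , ≈ᴹ-sym (*ₗ-zeroˡ e))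
        ; has-+ = λ { (lift (a , v≈ae)) (lift (a′ , w≈a′e)) → lift (a + a′ , ≈ᴹ-trans (+ᴹ-cong v≈ae w≈a′e) (≈ᴹ-sym (*ₗ-distribʳ e a a′))) }
        ; has-*ₗ = λ { a′ (lift (a , v≈ae)) → lift (a′ * a , ≈ᴹ-trans (*ₗ-cong ≈-refl v≈ae) (≈ᴹ-sym (*ₗ-assoc a′ a e))) }
        ; has-act = λ { x {v} (lift (a , v≈ae)) → lift (θ x * a , ≈ᴹ-trans (act-scalar x v) (≈ᴹ-trans (*ₗ-cong ≈-refl v≈ae) (≈ᴹ-sym (*ₗ-assoc (θ x) a e)))) }
        }

      spanned : ∀ v → ∃ λ a → v ≈ᴹ a *ₗ e
      spanned v = [ (λ trivial → ⊥-elim (e≉0 (trivial e (lift (1# , ≈ᴹ-sym (*ₗ-identityˡ e)))))) , (λ whole → lower (whole v)) ]′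
        (proj₂ irr line line-sub)

      independent : ∀ a → a *ₗ e ≈ᴹ 0ᴹ → a ≈ 0#
      independent a ae≈0 = decidable-stable em₀ λ a≉0 →
        let w , w*a≈1 = inverse em₀ a a≉0 in e≉0 (≈ᴹ-trans (≈ᴹ-sym (*ₗ-identityˡ e))
          (≈ᴹ-trans (*ₗ-cong (≈-sym w*a≈1) ≈ᴹ-refl) (≈ᴹ-trans (*ₗ-assoc w a e) (≈ᴹ-trans (*ₗ-cong ≈-refl ae≈0) (*ₗ-zeroʳ w)))))

      coefficient-unique : ∀ {a a′} → a *ₗ e ≈ᴹ a′ *ₗ e → a ≈ a′
      coefficient-unique {a} {a′} ae≈a′e = begin
        a  ≈⟨ +-identityʳ a ⟨
        a + 0#  ≈⟨ +-congˡ (-‿inverseˡ a′) ⟨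
        a + (- a′ + a′)  ≈⟨ +-assoc a (- a′) a′ ⟨
        (a + - a′) + a′  ≈⟨ +-congʳ (independent (a + - a′) (≈ᴹ-trans (*ₗ-distribʳ e a (- a′))
                                    (≈ᴹ-trans (+ᴹ-cong ae≈a′e ≈ᴹ-refl) (≈ᴹ-trans (≈ᴹ-sym (*ₗ-distribʳ e a′ (- a′)))
                                      (≈ᴹ-trans (*ₗ-cong (-‿inverseʳ a′) ≈ᴹ-refl) (*ₗ-zeroˡ e)))))) ⟩
        0# + a′  ≈⟨ +-identityˡ a′ ⟩
        a′ ∎
        where open ≈-Reasoning

    dimension-one : HasDimension V 1
    dimension-one = (λ _ → e)
      , (λ v → (λ _ → proj₁ (spanned v)) , ≈ᴹ-trans (proj₂ (spanned v)) (≈ᴹ-sym (+ᴹ-identityʳ _)))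
      , (λ { a ae≈0 Fin.zero → independent (a Fin.zero) (≈ᴹ-trans (≈ᴹ-sym (+ᴹ-identityʳ _)) ae≈0) })

    classified : characterRep c ℓ partition ≅ V
    classified = record
      { to = λ a → lower a *ₗ e
      ; from = λ v → lift (proj₁ (spanned v))
      ; to-linear = linear (scalars c ℓ) space (λ a → lower a *ₗ e)
          (λ a≈a′ → *ₗ-cong (lower a≈a′) ≈ᴹ-refl) (λ a a′ → *ₗ-distribʳ e (lower a) (lower a′)) (λ a a′ → *ₗ-assoc a (lower a′) e)
      ; from-linear = linear space (scalars c ℓ) (λ v → lift (proj₁ (spanned v)))
          (λ {v} {w} v≈w → lift (coefficient-unique (≈ᴹ-trans (≈ᴹ-sym (proj₂ (spanned v))) (≈ᴹ-trans v≈w (proj₂ (spanned w))))))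
          (λ v w → lift (coefficient-unique (≈ᴹ-trans (≈ᴹ-sym (proj₂ (spanned (v +ᴹ w))))
            (≈ᴹ-trans (+ᴹ-cong (proj₂ (spanned v)) (proj₂ (spanned w))) (≈ᴹ-sym (*ₗ-distribʳ e _ _))))))
          (λ a v → lift (coefficient-unique (≈ᴹ-trans (≈ᴹ-sym (proj₂ (spanned (a *ₗ v))))
            (≈ᴹ-trans (*ₗ-cong ≈-refl (proj₂ (spanned v))) (≈ᴹ-sym (*ₗ-assoc a _ e))))))
      ; to-act = λ x a → ≈ᴹ-trans (*ₗ-assoc (θ x) (lower a) e) (≈ᴹ-sym (act-scalar x (lower a *ₗ e)))
      ; from-act = λ x v → lift (coefficient-unique (≈ᴹ-trans (≈ᴹ-sym (proj₂ (spanned (act x v))))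
          (≈ᴹ-trans (act-scalar x v) (≈ᴹ-trans (*ₗ-cong ≈-refl (proj₂ (spanned v))) (≈ᴹ-sym (*ₗ-assoc (θ x) _ e))))))
      ; to∘from = λ v → ≈ᴹ-sym (proj₂ (spanned v))
      ; from∘to = λ a → lift (coefficient-unique (≈ᴹ-sym (proj₂ (spanned (lower a *ₗ e)))))
      }

corollary2p14 : {c ℓ : Level} → ExcludedMiddle (c ⊔ ℓ) → (n k : ℕ) →
    ((V : IrreducibleRepresentation n k c ℓ) → HasDimension (proj₁ V) 1) ×
    Bijection (partitions-with-few-ones n k) (irreducibles-up-to-≅ n k c ℓ)
corollary2p14 {c} {ℓ} em n k = (λ (V , irr) → proj₁ (proj₂ (classify V irr))) , record
  { to = irreducible c ℓ em
  ; cong = λ {p} {q} → character-cong c ℓ em p q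
  ; bijective = (λ {p} {q} → character-injective c ℓ em {p} {q})
              -- Surjectivity between setoids asks for an isomorphism with `V` from every `q` having
              -- the same parts as `p`, hence the detour through `character-cong`.
              , λ (V , irr) → let p , _ , p≅V = classify V irr in p , λ {q} q≡p →
                  ≅-trans (character-cong c ℓ em q p q≡p) p≅V
  }
  where
  classify : (V : Representation n k c ℓ) → IsIrreducible V →
    ∃ λ p → HasDimension V 1 × characterRep c ℓ p ≅ V
  classify V irr = let j , u , valid , (e , βe≉0) , above = leading-index V em irr
                       open Leading V em irr j u valid e βe≉0 above
                   in partition , dimension-one , classified
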